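{- Let $q$ be a prime power, $\mathbb{F}_q$ the field with $q$ elements, $V=\mathbb{F}_q^n$, and let $1<k<n-1$. (1) If $q\ge 3$ or $k\ge 3$, then every isomorphism of $\Gamma(n,k)_q$ onto a subgraph of $\Gamma_k(V)$ can be uniquely extended to an automorphism of $\Gamma_k(V)$; that is, for every injective map $f:\mathcal{C}(n,k)_q\to\mathcal{G}_k(V)$ which is an isomorphism of $\Gamma(n,k)_q$ onto some (not necessarily induced) subgraph of $\Gamma_k(V)$, there is a unique automorphism $g$ of $\Gamma_k(V)$ whose restriction to $\mathcal{C}(n,k)_q$ equals $f$. (2) If $q=k=2$, then there exist subgraphs of $\Gamma_k(V)$ isomorphic to $\Gamma(n,k)_q$ such that isomorphisms between these subgraphs and $\Gamma(n,k)_q$ cannot be extended to automorphisms of $\Gamma_k(V)$.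
   Context: For a vector space $V$ of dimension $n$ over $\mathbb{F}_q$, $\mathcal{G}_k(V)$ denotes the set of $k$-dimensional subspaces of $V$. Two $k$-dimensional subspaces are adjacent if their intersection is $(k-1)$-dimensional. The Grassmann graph $\Gamma_k(V)$ has vertex set $\mathcal{G}_k(V)$, with edges joining adjacent subspaces. For $V=\mathbb{F}_q^n$ with standard basis $e_1,\dots,e_n$, let $C_i$ be the coordinate hyperplane $\{x: x_i=0\}$. A $k$-dimensional subspace $C$ (a linear $[n,k]_q$ code) is non-degenerate if it is contained in no $C_i$; $\mathcal{C}(n,k)_q=\mathcal{G}_k(V)\setminus\bigcup_{i=1}^n\mathcal{G}_k(C_i)$ is the set of non-degenerate codes, and $\Gamma(n,k)_q$ is the induced subgraph of $\Gamma_k(V)$ on $\mathcal{C}(n,k)_q$. Subgraphs of $\Gamma_k(V)$ are not assumed to be induced. -}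

module Defs where

open import Level using (0ℓ)
open import Algebra.Bundles using (CommutativeRing)
open import Data.Nat using (ℕ; zero; suc; _∸_)
open import Data.Fin using (Fin; zero; suc)
open import Data.Product using (Σ; ∃; _×_; _,_; proj₁; proj₂)
open import Relation.Nullary using (¬_)
open import Relation.Binary.Definitions using (Decidable)
open import Relation.Binary.PropositionalEquality using (_≡_)

record Field : Set₁ where
  field
    commRing : CommutativeRing 0ℓ 0ℓ
  open CommutativeRing commRing public
  field
    0≉1     : ¬ (0# ≈ 1#)
    inverse : ∀ x → ¬ (x ≈ 0#) → ∃ λ y → x * y ≈ 1#

record HasSize (F : Field) (q : ℕ) : Set where
  open Field F using (Carrier; _≈_; _+_; _*_; 0#)
  field
    _≟_   : Decidable _≈_
    enum  : Fin q → Carrier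
    enum-injective  : ∀ i j → enum i ≈ enum j → i ≡ j
    enum-surjective : ∀ x → ∃ λ i → enum i ≈ x

module Grassmann (F : Field) (n k : ℕ) where
  open Field F using (Carrier; _≈_; _+_; _*_; 0#)

  Vect : Set
  Vect = Fin n → Carrier

  _≈ᵥ_ : Vect → Vect → Set
  u ≈ᵥ v = ∀ i → u i ≈ v i

  0ᵥ : Vect
  0ᵥ _ = 0#

  ∑ : ∀ {m} → (Fin m → Carrier) → Carrier
  ∑ {zero}  _ = 0#
  ∑ {suc m} c = c zero + ∑ (λ j → c (suc j))

  lincomb : ∀ {m} → (Fin m → Carrier) → (Fin m → Vect) → Vect
  lincomb c vs i = ∑ (λ j → c j * vs j i)

  LinIndep : ∀ {m} → (Fin m → Vect) → Set
  LinIndep vs = ∀ c → lincomb c vs ≈ᵥ 0ᵥ → ∀ j → c j ≈ 0#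

  _∈Span_ : ∀ {m} → Vect → (Fin m → Vect) → Set
  x ∈Span vs = ∃ λ c → x ≈ᵥ lincomb c vs

  HasDim : (Vect → Set) → ℕ → Set
  HasDim P d = Σ (Fin d → Vect) λ vs →
    LinIndep vs × (∀ j → P (vs j)) × (∀ x → P x → x ∈Span vs)

  -- a k-dimensional subspace, presented by a basis; equality is equality of subspaces
  record Gr : Set where
    constructor gr
    field
      basis : Fin k → Vect
      indep : LinIndep basis

  _∈_ : Vect → Gr → Set
  x ∈ U = x ∈Span Gr.basis U

  _≈ₛ_ : Gr → Gr → Set
  U ≈ₛ W = ∀ x → (x ∈ U → x ∈ W) × (x ∈ W → x ∈ U)

  Adj : Gr → Gr → Set
  Adj U W = HasDim (λ x → x ∈ U × x ∈ W) (k ∸ 1)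

  _⊆C_ : Gr → Fin n → Set
  U ⊆C i = ∀ x → x ∈ U → x i ≈ 0#

  NonDegenerate : Gr → Set
  NonDegenerate U = ∀ i → ¬ (U ⊆C i)

  Code : Set
  Code = Σ Gr NonDegenerate

  -- f is an isomorphism of Γ(n,k) onto a (not necessarily induced) subgraph of Γ_k(V):
  -- a well-defined injective map sending edges to edges
  IsIsoOntoSubgraph : (Code → Gr) → Set
  IsIsoOntoSubgraph f =
    (∀ C D → proj₁ C ≈ₛ proj₁ D → f C ≈ₛ f D) ×
    (∀ C D → f C ≈ₛ f D → proj₁ C ≈ₛ proj₁ D) ×
    (∀ C D → Adj (proj₁ C) (proj₁ D) → Adj (f C) (f D))

  IsAutomorphism : (Gr → Gr) → Set
  IsAutomorphism g =
    (∀ U W → U ≈ₛ W → g U ≈ₛ g W) ×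
    (∀ U W → g U ≈ₛ g W → U ≈ₛ W) ×
    (∀ W → ∃ λ U → g U ≈ₛ W) ×
    (∀ U W → (Adj U W → Adj (g U) (g W)) × (Adj (g U) (g W) → Adj U W))

  Extends : (Gr → Gr) → (Code → Gr) → Set
  Extends g f = ∀ C → g (proj₁ C) ≈ₛ f C

  record Subgraph : Set₁ where
    field
      Vtx : Gr → Set
      Edg : Gr → Gr → Set
      Vtx-resp : ∀ U W → U ≈ₛ W → Vtx U → Vtx W
      Edg-resp : ∀ U U' W W' → U ≈ₛ U' → W ≈ₛ W' → Edg U W → Edg U' W'
      Edg-vtx  : ∀ U W → Edg U W → Vtx U × Vtx W
      Edg-adj  : ∀ U W → Edg U W → Adj U W

  IsIsoOnto : (Code → Gr) → Subgraph → Set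
  IsIsoOnto h S =
    (∀ C D → proj₁ C ≈ₛ proj₁ D → h C ≈ₛ h D) ×
    (∀ C D → h C ≈ₛ h D → proj₁ C ≈ₛ proj₁ D) ×
    (∀ C → Subgraph.Vtx S (h C)) ×
    (∀ U → Subgraph.Vtx S U → ∃ λ C → h C ≈ₛ U) ×
    (∀ C D → (Adj (proj₁ C) (proj₁ D) → Subgraph.Edg S (h C) (h D)) ×
             (Subgraph.Edg S (h C) (h D) → Adj (proj₁ C) (proj₁ D)))

{-# OPTIONS --safe #-}
module Submission where

-- Part (1).  Write S, T for subspaces of dimension k − 1 and k + 1; the stars {U ⊇ S} and the tops
-- {U ⊆ T} are the maximal cliques of the Grassmann graph.  A count produces one non-degenerate S whose
-- star is mapped into a star (or, when n = 2k, possibly into a top: such images are called A-blocks, the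
-- other maximal cliques B-blocks), and by connectedness the same holds for every non-degenerate S.  Every
-- T with two non-degenerate hyperplanes S is then mapped into a B-block.  The map is extended to a
-- degenerate U as the unique common vertex of the B-blocks belonging to U + ⟨x⟩ and U + ⟨y⟩, where x, y
-- have no zero coordinate.  Over a field with at least three elements there are enough such vectors to do
-- this at once; over the binary field 𝟙 is the only one, so the coordinate hyperplanes are dropped one at
-- a time, using 𝟙 and the vectors 𝟙 + e_b.  The result maps each star onto a star and each top onto a top
-- by counting, hence is onto by connectedness, hence bijective by finiteness.
--
-- Part (2).  Fix the planes that contain 𝟙 and replace any other plane by its image under
-- x ↦ x − x₀ 𝟙.  On non-degenerate planes this is injective and preserves adjacency, but it makes some
-- nonadjacent planes adjacent, which no automorphism does.

open import Defs
open import Level using (0ℓ)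
open import Algebra.Bundles using (CommutativeRing; RawRing)
open import Algebra.Solver.Ring.AlmostCommutativeRing using (fromCommutativeRing; _-Raw-AlmostCommutative⟶_)
open import Data.Nat as ℕ using (ℕ; suc; _<_; _≤_; s≤s; z≤n; _^_; _∸_) renaming (zero to 0ⁿ)
import Data.Nat.Properties as ℕₚ
open import Data.Integer as ℤ using (ℤ; +_; -[1+_])
import Data.Integer.Properties as ℤₚ
open import Data.Fin as Fin using (Fin; zero; suc; splitAt; join; finToFun; funToFin; toℕ; _↑ˡ_; _↑ʳ_)
import Data.Fin.Properties as Fₚ
open import Data.Vec.Functional using (_∷_; [])
open import Data.List as List using (List)
open import Data.List.Relation.Unary.All as All using (All)
open import Data.List.Relation.Unary.All.Properties using (¬All⇒Any¬)
open import Data.List.Relation.Unary.Any using (here; there; satisfied)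
open import Data.List.Membership.Propositional using (find) renaming (_∈_ to _∈ᴸ_)
open import Data.List.Membership.Propositional.Properties using (∈-allFin)
import Data.List.Membership.DecPropositional as DecMembership
open import Data.Maybe as Maybe using (Maybe)
open import Data.Product using (Σ; ∃; _×_; _,_; proj₁; proj₂)
open import Data.Sum as Sum using (_⊎_; inj₁; inj₂; [_,_]′)
open import Data.Unit using (⊤; tt)
open import Data.Empty using (⊥; ⊥-elim)
open import Function using (_∘_)
open import Relation.Nullary using (¬_; Dec; yes; no)
open import Relation.Nullary.Decidable using (map′; ¬?; _×-dec_; _→-dec_; decidable-stable; dec⇒maybe)
open import Relation.Binary.Definitions using (tri<; tri≈; tri>)
open import Relation.Binary.PropositionalEquality as ≡ using (_≡_)

-- The basic tool is a count of pencils: an A-block and a B-block share at most q + 1 vertices, and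
-- for non-degenerate S the q + 1 vertices between S and T already have distinct images, so they
-- fill the intersection. Global injectivity of a partial extension is out of reach until the end.
-- Adjacency gives injectivity inside stars and tops, and the invariant adds that distinct
-- non-degenerate S₁, S₂ inside a common U have A-blocks with at most one common vertex. The
-- delicate case of the initial count is n < 2k, where a star is small enough to fit into a top. It
-- is excluded by two tops that would have to share one B-block and together have one vertex too
-- many for it. Over the binary field 𝟙 + e_b vanishes only at b. When the hyperplane C_m is
-- dropped, a new U lies in C_m but in no C_b still in force, so 𝟙 + e_b with b ≠ m is harmless for
-- U. To use it one needs a (k - 2)-dimensional X ⊂ U with a vector that is nonzero at b, hence k -
-- 2 ≥ 1; this is where q = k = 2 drops out.

module RingSolver (R : CommutativeRing 0ℓ 0ℓ) where
  open CommutativeRing R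
  open import Algebra.Properties.Ring ring using (-‿distribˡ-*; -‿distribʳ-*)
  open import Algebra.Properties.Semiring.Mult.TCOptimised semiring using (1+×; ×-homo-+; ×1-homo-*) renaming (_×_ to _×ⁿ_)
  open import Algebra.Properties.AbelianGroup +-abelianGroup using (⁻¹-∙-comm; ε⁻¹≈ε; ⁻¹-involutive)
  open import Relation.Binary.Reasoning.Setoid setoid

  -- Integer coefficients, because terms over the abstract `Carrier` do not compute while equality
  -- of integers is decided by evaluation. The optimised multiple makes `⟦ + 1 ⟧` reduce to `1#`, so
  -- `con (+ 1)` in a solver goal is `1#` on the nose.
  ⟦_⟧ : ℤ → Carrier
  ⟦ + n ⟧ = n ×ⁿ 1#
  ⟦ -[1+ n ] ⟧ = - (suc n ×ⁿ 1#)

  private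
    shift : ∀ x y z → y + - z ≈ (x + y) + - (x + z)
    shift x y z = begin
      y + - z ≈⟨ +-congʳ (+-identityˡ y) ⟨
      0# + y + - z ≈⟨ +-congʳ (+-congʳ (-‿inverseʳ x)) ⟨
      x + - x + y + - z ≈⟨ +-congʳ (+-assoc x (- x) y) ⟩
      x + (- x + y) + - z ≈⟨ +-congʳ (+-congˡ (+-comm (- x) y)) ⟩
      x + (y + - x) + - z ≈⟨ +-congʳ (+-assoc x y (- x)) ⟨
      x + y + - x + - z ≈⟨ +-assoc (x + y) (- x) (- z) ⟩
      x + y + (- x + - z) ≈⟨ +-congˡ (⁻¹-∙-comm x z) ⟩
      (x + y) + - (x + z) ∎

  ⊖-homo : ∀ m n → ⟦ m ℤ.⊖ n ⟧ ≈ m ×ⁿ 1# + - (n ×ⁿ 1#)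
  ⊖-homo 0ⁿ 0ⁿ = sym (-‿inverseʳ 0#)
  ⊖-homo 0ⁿ (suc n) = sym (+-identityˡ _)
  ⊖-homo (suc m) 0ⁿ = sym (trans (+-congˡ ε⁻¹≈ε) (+-identityʳ _))
  ⊖-homo (suc m) (suc n) = begin
    ⟦ suc m ℤ.⊖ suc n ⟧ ≡⟨ ≡.cong ⟦_⟧ (ℤₚ.[1+m]⊖[1+n]≡m⊖n m n) ⟩
    ⟦ m ℤ.⊖ n ⟧ ≈⟨ ⊖-homo m n ⟩
    m ×ⁿ 1# + - (n ×ⁿ 1#) ≈⟨ shift 1# _ _ ⟩
    (1# + m ×ⁿ 1#) + - (1# + n ×ⁿ 1#) ≈⟨ +-cong (1+× m 1#) (-‿cong (1+× n 1#)) ⟨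
    suc m ×ⁿ 1# + - (suc n ×ⁿ 1#) ∎

  ⟦⟧-homo-+ : ∀ i j → ⟦ i ℤ.+ j ⟧ ≈ ⟦ i ⟧ + ⟦ j ⟧
  ⟦⟧-homo-+ (+ m) (+ n) = ×-homo-+ 1# m n
  ⟦⟧-homo-+ (+ m) -[1+ n ] = ⊖-homo m (suc n)
  ⟦⟧-homo-+ -[1+ m ] (+ n) = trans (⊖-homo n (suc m)) (+-comm _ _)
  ⟦⟧-homo-+ -[1+ m ] -[1+ n ] = begin
    - (suc (suc (m ℕ.+ n)) ×ⁿ 1#) ≡⟨ ≡.cong (λ h → - (h ×ⁿ 1#)) (ℕₚ.+-suc (suc m) n) ⟨
    - ((suc m ℕ.+ suc n) ×ⁿ 1#) ≈⟨ -‿cong (×-homo-+ 1# (suc m) (suc n)) ⟩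
    - (suc m ×ⁿ 1# + suc n ×ⁿ 1#) ≈⟨ ⁻¹-∙-comm _ _ ⟨
    - (suc m ×ⁿ 1#) + - (suc n ×ⁿ 1#) ∎

  ⟦⟧-homo-- : ∀ i → ⟦ ℤ.- i ⟧ ≈ - ⟦ i ⟧
  ⟦⟧-homo-- (+ 0ⁿ) = sym ε⁻¹≈ε
  ⟦⟧-homo-- (+ suc n) = refl
  ⟦⟧-homo-- -[1+ n ] = sym (⁻¹-involutive _)

  private
    +*+ : ∀ m n → ⟦ + m ℤ.* + n ⟧ ≈ ⟦ + m ⟧ * ⟦ + n ⟧
    +*+ m n = begin
      ⟦ + m ℤ.* + n ⟧ ≡⟨ ≡.cong ⟦_⟧ (ℤₚ.pos-* m n) ⟨
      (m ℕ.* n) ×ⁿ 1# ≈⟨ ×1-homo-* m n ⟩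
      (m ×ⁿ 1#) * (n ×ⁿ 1#) ∎

    +* : ∀ m j → ⟦ + m ℤ.* j ⟧ ≈ ⟦ + m ⟧ * ⟦ j ⟧
    +* m (+ n) = +*+ m n
    +* m -[1+ n ] = begin
      ⟦ + m ℤ.* ℤ.- (+ suc n) ⟧ ≡⟨ ≡.cong ⟦_⟧ (ℤₚ.neg-distribʳ-* (+ m) (+ suc n)) ⟨
      ⟦ ℤ.- (+ m ℤ.* + suc n) ⟧ ≈⟨ ⟦⟧-homo-- (+ m ℤ.* + suc n) ⟩
      - ⟦ + m ℤ.* + suc n ⟧ ≈⟨ -‿cong (+*+ m (suc n)) ⟩
      - (⟦ + m ⟧ * ⟦ + suc n ⟧) ≈⟨ -‿distribʳ-* _ _ ⟩
      ⟦ + m ⟧ * ⟦ -[1+ n ] ⟧ ∎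

  ⟦⟧-homo-* : ∀ i j → ⟦ i ℤ.* j ⟧ ≈ ⟦ i ⟧ * ⟦ j ⟧
  ⟦⟧-homo-* (+ m) j = +* m j
  ⟦⟧-homo-* -[1+ m ] j = begin
    ⟦ ℤ.- (+ suc m) ℤ.* j ⟧ ≡⟨ ≡.cong ⟦_⟧ (ℤₚ.neg-distribˡ-* (+ suc m) j) ⟨
    ⟦ ℤ.- (+ suc m ℤ.* j) ⟧ ≈⟨ ⟦⟧-homo-- (+ suc m ℤ.* j) ⟩
    - ⟦ + suc m ℤ.* j ⟧ ≈⟨ -‿cong (+* (suc m) j) ⟩
    - (⟦ + suc m ⟧ * ⟦ j ⟧) ≈⟨ -‿distribˡ-* _ _ ⟩
    ⟦ -[1+ m ] ⟧ * ⟦ j ⟧ ∎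

  private
    ℤ-raw : RawRing 0ℓ 0ℓ
    ℤ-raw = record { Carrier = ℤ ; _≈_ = ≡._≡_ ; _+_ = ℤ._+_ ; _*_ = ℤ._*_ ; -_ = ℤ.-_ ; 0# = ℤ.0ℤ ; 1# = ℤ.1ℤ }

    morphism : ℤ-raw -Raw-AlmostCommutative⟶ fromCommutativeRing R
    morphism = record
      { ⟦_⟧ = ⟦_⟧
      ; +-homo = ⟦⟧-homo-+
      ; *-homo = ⟦⟧-homo-*
      ; -‿homo = ⟦⟧-homo--
      ; 0-homo = refl
      ; 1-homo = refl }

    weakly-decide : ∀ i j → Maybe (⟦ i ⟧ ≈ ⟦ j ⟧)
    weakly-decide i j = Maybe.map (λ p → reflexive (≡.cong ⟦_⟧ p)) (dec⇒maybe (i ℤₚ.≟ j))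

  open import Algebra.Solver.Ring ℤ-raw (fromCommutativeRing R) morphism weakly-decide public
    using (solve; _:=_; _:+_; _:*_; :-_; _:-_; con)

-- Partitions of the coordinates

merge : ∀ {m} → Fin (4 ℕ.+ m) → Fin (2 ℕ.+ m)
merge zero = zero
merge (suc zero) = zero
merge (suc (suc zero)) = zero
merge (suc (suc (suc j))) = suc j

-- Two partitions of the n coordinates into 4 + m classes that agree after merging the first three
-- classes; p and p′ share a class of the first partition but not of the second.
record TwoPartitions (n m : ℕ) : Set where
  field
    cl₀ cl₁ : Fin n → Fin (4 ℕ.+ m)
    σ₀ σ₁ : Fin (4 ℕ.+ m) → Fin n
    sec₀ : ∀ j → cl₀ (σ₀ j) ≡ j
    sec₁ : ∀ j → cl₁ (σ₁ j) ≡ j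
    p p′ : Fin n
    together : cl₀ p ≡ cl₀ p′
    p-cl : cl₁ p ≡ suc zero
    p′-cl : cl₁ p′ ≡ suc (suc zero)
    merged : ∀ i → merge (cl₀ i) ≡ merge (cl₁ i)

twoPartitions : ∀ d₂ m → TwoPartitions (4 ℕ.+ (suc m ℕ.+ d₂)) m
twoPartitions d₂ m = record
  { cl₀ = cl₀ ; cl₁ = cl₁ ; σ₀ = σ₀ ; σ₁ = σ₁ ; sec₀ = sec₀ ; sec₁ = sec₁ ; p = zero ; p′ = suc (suc (suc zero))
  ; together = ≡.refl ; p-cl = ≡.refl ; p′-cl = ≡.refl ; merged = merged }
  where
  rest⊎ : Fin (suc m) ⊎ Fin d₂ → Fin (4 ℕ.+ m)
  rest⊎ (inj₁ j) = suc (suc (suc j))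
  -- The surplus d₂ coordinates join class zero in both partitions.
  rest⊎ (inj₂ _) = zero
  rest : Fin (suc m ℕ.+ d₂) → Fin (4 ℕ.+ m)
  rest i = rest⊎ (splitAt (suc m) i)
  cl₀ cl₁ : Fin (4 ℕ.+ (suc m ℕ.+ d₂)) → Fin (4 ℕ.+ m)
  cl₀ zero = zero
  cl₀ (suc zero) = suc zero
  cl₀ (suc (suc zero)) = suc (suc zero)
  cl₀ (suc (suc (suc zero))) = zero
  cl₀ (suc (suc (suc (suc i)))) = rest i
  cl₁ zero = suc zero
  cl₁ (suc zero) = zero
  cl₁ (suc (suc zero)) = zero
  cl₁ (suc (suc (suc zero))) = suc (suc zero)
  cl₁ (suc (suc (suc (suc i)))) = rest i
  σ₀ σ₁ : Fin (4 ℕ.+ m) → Fin (4 ℕ.+ (suc m ℕ.+ d₂))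
  σ₀ zero = zero
  σ₀ (suc zero) = suc zero
  σ₀ (suc (suc zero)) = suc (suc zero)
  σ₀ (suc (suc (suc j))) = suc (suc (suc (suc (j ↑ˡ d₂))))
  σ₁ zero = suc zero
  σ₁ (suc zero) = zero
  σ₁ (suc (suc zero)) = suc (suc (suc zero))
  σ₁ (suc (suc (suc j))) = suc (suc (suc (suc (j ↑ˡ d₂))))
  sec₀ : ∀ j → cl₀ (σ₀ j) ≡ j
  sec₀ zero = ≡.refl
  sec₀ (suc zero) = ≡.refl
  sec₀ (suc (suc zero)) = ≡.refl
  sec₀ (suc (suc (suc j))) = ≡.cong rest⊎ (Fₚ.splitAt-↑ˡ (suc m) j d₂)
  sec₁ : ∀ j → cl₁ (σ₁ j) ≡ j
  sec₁ zero = ≡.refl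
  sec₁ (suc zero) = ≡.refl
  sec₁ (suc (suc zero)) = ≡.refl
  sec₁ (suc (suc (suc j))) = ≡.cong rest⊎ (Fₚ.splitAt-↑ˡ (suc m) j d₂)
  merged : ∀ i → merge (cl₀ i) ≡ merge (cl₁ i)
  merged zero = ≡.refl
  merged (suc zero) = ≡.refl
  merged (suc (suc zero)) = ≡.refl
  merged (suc (suc (suc zero))) = ≡.refl
  merged (suc (suc (suc (suc i)))) = ≡.refl

-- Linear algebra over a finite field: spans and independence

module Grassmannian (F : Field) (q : ℕ) (hs : HasSize F q) (n k₂ d₂ : ℕ) (n≡ : suc (suc (suc d₂)) ℕ.+ suc k₂ ≡ n) where
  open Field F public using (Carrier; _≈_; _+_; _*_; -_; 0#; 1#; 0≉1; inverse; refl; sym; trans; setoid; commRing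
    ; +-cong; +-congˡ; +-congʳ; *-cong; *-congˡ; *-congʳ; -‿cong; zeroˡ; zeroʳ; +-identityˡ; +-identityʳ; *-identityˡ; *-identityʳ; *-comm; +-comm; -‿inverseʳ; *-assoc; reflexive)
  open HasSize hs public using (_≟_; enum; enum-injective; enum-surjective)
  open Grassmann F n (suc (suc k₂)) public using (Vect; _≈ᵥ_; 0ᵥ; ∑; lincomb; LinIndep) renaming (_∈Span_ to _∈ˢᵖ_)
  open RingSolver commRing public using (solve; _:=_; _:+_; _:*_; :-_; _:-_; con)
  open import Relation.Binary.Reasoning.Setoid setoid hiding (start)

  inv : ∀ x → ¬ x ≈ 0# → Carrier
  inv x x≉0 = proj₁ (inverse x x≉0)

  opaque
    inv-* : ∀ x (p : ¬ x ≈ 0#) → inv x p * x ≈ 1#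
    inv-* x p = trans (*-comm _ _) (proj₂ (inverse x p))

  opaque
    *-≉0 : ∀ {x y} → ¬ x ≈ 0# → ¬ y ≈ 0# → ¬ x * y ≈ 0#
    *-≉0 {x} {y} x≉0 y≉0 xy≈0 = y≉0 (begin
      y ≈⟨ *-identityˡ y ⟨
      1# * y ≈⟨ *-congʳ (inv-* x x≉0) ⟨
      inv x x≉0 * x * y ≈⟨ *-assoc _ _ _ ⟩
      inv x x≉0 * (x * y) ≈⟨ *-congˡ xy≈0 ⟩
      inv x x≉0 * 0# ≈⟨ zeroʳ _ ⟩
      0# ∎)

  opaque
    x-y≈0⇒x≈y : ∀ {x y} → x + - y ≈ 0# → x ≈ y
    x-y≈0⇒x≈y {x} {y} e = begin
      x ≈⟨ solve 2 (λ x y → x := (x :- y) :+ y) refl x y ⟩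
      (x + - y) + y ≈⟨ +-congʳ e ⟩
      0# + y ≈⟨ +-identityˡ y ⟩
      y ∎

  Fam : ℕ → Set
  Fam m = Fin m → Vect

  infixl 6 _+ᵥ_ _-ᵥ_
  infixl 7 _·_
  infix 4 _⊆_ _⊈_ _∈ₛ_ _∉ₛ_ _≐_

  _+ᵥ_ _-ᵥ_ : Vect → Vect → Vect
  (x +ᵥ y) i = x i + y i
  (x -ᵥ y) i = x i + - y i

  _·_ : Carrier → Vect → Vect
  (α · x) i = α * x i

  record IsSub (P : Vect → Set) : Set where
    field
      resp  : ∀ {x y} → x ≈ᵥ y → P x → P y
      nil   : P 0ᵥ
      add   : ∀ {x y} → P x → P y → P (x +ᵥ y)
      scale : ∀ α {x} → P x → P (α · x)

    comb : ∀ α {a s x} → (∀ i → x i ≈ α * a i + s i) → P a → P s → P x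
    comb α e pa ps = resp (λ i → sym (e i)) (add (scale α pa) ps)

    uncomb′ : ∀ α {a s x} → (∀ i → x i ≈ α * a i + s i) → P a → P x → P s
    uncomb′ α {a} {s} {x} e pa px = comb (- α) {a} {x} {s} (λ i →
      trans (solve 3 (λ α w s → s := :- α :* w :+ (α :* w :+ s)) refl α (a i) (s i)) (+-congˡ (sym (e i)))) pa px

    sub : ∀ {x y} → P x → P y → P (x -ᵥ y)
    sub {x} {y} px py = comb (- 1#) {a = y} {s = x}
      (λ i → solve 2 (λ x y → x :- y := :- con (+ 1) :* y :+ x) refl (x i) (y i)) py px

    -- Solves x = αa + s for a by dividing by α. Most span arguments bring a membership to this form
    -- and split on whether α vanishes.
    uncomb : ∀ {α a s x} → ¬ α ≈ 0# → (∀ i → x i ≈ α * a i + s i) → P x → P s → P a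
    uncomb {α} {a} {s} {x} α≉0 e px ps = resp
      (λ i → begin
        inv α α≉0 * (x i + - s i) ≈⟨ *-congˡ (+-congʳ (e i)) ⟩
        inv α α≉0 * (α * a i + s i + - s i) ≈⟨ solve 4 (λ β α a s → β :* (α :* a :+ s :- s) := (β :* α) :* a) refl _ _ _ _ ⟩
        (inv α α≉0 * α) * a i ≈⟨ *-congʳ (inv-* α α≉0) ⟩
        1# * a i ≈⟨ *-identityˡ _ ⟩
        a i ∎)
      (scale (inv α α≉0) (sub px ps))

  opaque
    ∑-cong : ∀ {m} {c c′ : Fin m → Carrier} → (∀ j → c j ≈ c′ j) → ∑ c ≈ ∑ c′
    ∑-cong {0ⁿ} e = refl
    ∑-cong {suc m} e = +-cong (e zero) (∑-cong (e ∘ suc))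

  opaque
    ∑-zero : ∀ {m} {c : Fin m → Carrier} → (∀ j → c j ≈ 0#) → ∑ c ≈ 0#
    ∑-zero {0ⁿ} e = refl
    ∑-zero {suc m} e = trans (+-cong (e zero) (∑-zero (e ∘ suc))) (+-identityˡ 0#)

  opaque
    ∑-single : ∀ {m} (c : Fin m → Carrier) i → (∀ j → ¬ j ≡ i → c j ≈ 0#) → ∑ c ≈ c i
    ∑-single c zero e = trans (+-congˡ (∑-zero (λ j → e (suc j) λ ()))) (+-identityʳ _)
    ∑-single c (suc i) e = trans (+-cong (e zero λ ()) (∑-single (c ∘ suc) i (λ j j≢i → e (suc j) (λ p → j≢i (Fₚ.suc-injective p))))) (+-identityˡ _)

  infix 4 _∈Span_
  -- A record, since the underlying Σ-type unfolds and `x` and `vs` could not be inferred from it;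
  -- `_∈ₛ_` and `_⊆_` are records for the same reason.
  record _∈Span_ {m} (x : Vect) (vs : Fam m) : Set where
    constructor ⟪_⟫
    field coeffs : x ∈ˢᵖ vs
  open _∈Span_ public

  uncons-∈ : ∀ {m x} {vs : Fam (suc m)} → x ∈Span vs →
    ∃ λ α → ∃ λ s → s ∈Span (vs ∘ suc) × (∀ i → x i ≈ α * vs zero i + s i)
  uncons-∈ {vs = vs} ⟪ c , e ⟫ = c zero , lincomb (c ∘ suc) (vs ∘ suc) , ⟪ c ∘ suc , (λ _ → refl) ⟫ , e

  cons-∈ : ∀ {m x s} α {vs : Fam (suc m)} → (∀ i → x i ≈ α * vs zero i + s i) → s ∈Span (vs ∘ suc) → x ∈Span vs
  cons-∈ α e ⟪ c , e′ ⟫ = ⟪ α ∷ c , (λ i → trans (e i) (+-congˡ (e′ i))) ⟫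

  opaque
    span-sub : ∀ {m} (vs : Fam m) → IsSub (_∈Span vs)
    span-sub {0ⁿ} vs = record
      { resp = λ { e ⟪ c , e′ ⟫ → ⟪ c , (λ i → trans (sym (e i)) (e′ i)) ⟫ }
      ; nil = ⟪ (λ ()) , (λ _ → refl) ⟫
      ; add = λ { ⟪ c , e ⟫ ⟪ c′ , e′ ⟫ → ⟪ c , (λ i → trans (+-cong (e i) (e′ i)) (+-identityˡ 0#)) ⟫ }
      ; scale = λ { α ⟪ c , e ⟫ → ⟪ c , (λ i → trans (*-congˡ (e i)) (zeroʳ α)) ⟫ } }
    span-sub {suc m} vs = record
      { resp = λ { e ⟪ c , e′ ⟫ → ⟪ c , (λ i → trans (sym (e i)) (e′ i)) ⟫ }
      ; nil = cons-∈ 0# {vs} (λ i → sym (trans (+-congʳ (zeroˡ _)) (+-identityˡ 0#))) (IsSub.nil ih)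
      ; add = λ p p′ → add′ (uncons-∈ {vs = vs} p) (uncons-∈ {vs = vs} p′)
      ; scale = λ α p → scale′ α (uncons-∈ {vs = vs} p) }
      where
      ih : IsSub (_∈Span (vs ∘ suc))
      ih = span-sub (vs ∘ suc)
      add′ : ∀ {x y} → (∃ λ α → ∃ λ s → s ∈Span (vs ∘ suc) × (∀ i → x i ≈ α * vs zero i + s i)) →
        (∃ λ α → ∃ λ s → s ∈Span (vs ∘ suc) × (∀ i → y i ≈ α * vs zero i + s i)) → (x +ᵥ y) ∈Span vs
      add′ (α , s , ps , e) (β , t , pt , e′) = cons-∈ (α + β) {vs}
        (λ i → trans (+-cong (e i) (e′ i))
          (solve 5 (λ α β v s t → (α :* v :+ s) :+ (β :* v :+ t) := (α :+ β) :* v :+ (s :+ t)) refl α β _ _ _))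
        (IsSub.add ih {s} {t} ps pt)
      scale′ : ∀ α {x} → (∃ λ β → ∃ λ s → s ∈Span (vs ∘ suc) × (∀ i → x i ≈ β * vs zero i + s i)) → (α · x) ∈Span vs
      scale′ α (β , s , ps , e) = cons-∈ (α * β) {vs}
        (λ i → trans (*-congˡ (e i)) (solve 4 (λ α β v s → α :* (β :* v :+ s) := α :* β :* v :+ α :* s) refl α β _ _))
        (IsSub.scale ih α {s} ps)

  tail-∈ : ∀ {m x} {vs : Fam (suc m)} → x ∈Span (vs ∘ suc) → x ∈Span vs
  tail-∈ {vs = vs} p = cons-∈ 0# {vs} (λ i → sym (trans (+-congʳ (zeroˡ _)) (+-identityˡ _))) p

  head-∈ : ∀ {m} (vs : Fam (suc m)) → vs zero ∈Span vs
  head-∈ vs = cons-∈ 1# {vs} (λ i → sym (trans (+-congʳ (*-identityˡ _)) (+-identityʳ _))) (IsSub.nil (span-sub (vs ∘ suc)))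

  opaque
    gen-∈ : ∀ {m} (vs : Fam m) j → vs j ∈Span vs
    gen-∈ vs zero = head-∈ vs
    gen-∈ vs (suc j) = tail-∈ {vs = vs} (gen-∈ (vs ∘ suc) j)

  opaque
    span-least : ∀ {m} {vs : Fam m} {P} → IsSub P → (∀ j → P (vs j)) → ∀ x → x ∈Span vs → P x
    span-least {0ⁿ} P-sub g x ⟪ c , e ⟫ = IsSub.resp P-sub (λ i → sym (e i)) (IsSub.nil P-sub)
    span-least {suc m} {vs} P-sub g x p with uncons-∈ {vs = vs} p
    ... | α , s , ps , e = IsSub.comb P-sub α e (g zero) (span-least P-sub (g ∘ suc) s ps)

  opaque
    searchᶜ : {P : Carrier → Set} → (∀ {x y} → x ≈ y → P x → P y) → (∀ x → Dec (P x)) → Dec (∃ P)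
    searchᶜ {P} P-resp P? = map′ (λ (i , p) → enum i , p)
      (λ (x , p) → proj₁ (enum-surjective x) , P-resp (sym (proj₂ (enum-surjective x))) p)
      (Fₚ.any? (P? ∘ enum))

  opaque
    search : ∀ m {P : (Fin m → Carrier) → Set} → (∀ {c c′} → (∀ i → c i ≈ c′ i) → P c → P c′) → (∀ c → Dec (P c)) → Dec (∃ P)
    search 0ⁿ P-resp P? = map′ (λ p → _ , p) (λ (c , p) → P-resp (λ ()) p) (P? (λ ()))
    search (suc m) {P} P-resp P? = map′ (λ (α , c , p) → α ∷ c , p)
      (λ (c , p) → c zero , c ∘ suc , P-resp (λ { zero → refl ; (suc i) → refl }) p)
      (searchᶜ (λ e (c , p) → c , P-resp (λ { zero → e ; (suc i) → refl }) p)
        (λ α → search m (λ e → P-resp (λ { zero → refl ; (suc i) → e i })) (λ c → P? (α ∷ c))))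

  opaque
    _∈Span?_ : ∀ {m} x (vs : Fam m) → Dec (x ∈Span vs)
    x ∈Span? vs = map′ ⟪_⟫ coeffs (search _
      (λ e e′ i → trans (e′ i) (∑-cong (λ j → *-congʳ (e j))))
      (λ c → Fₚ.all? (λ i → x i ≟ lincomb c vs i)))

  -- Each vector lies outside the span of those after it. In this form a basis is enlarged by
  -- consing a vector and a proof that it is outside; the next two lemmas give the equivalence with
  -- `LinIndep`.
  Ind : ∀ {m} → Fam m → Set
  Ind {0ⁿ} vs = ⊤
  Ind {suc m} vs = ¬ (vs zero ∈Span (vs ∘ suc)) × Ind (vs ∘ suc)

  opaque
    Ind⇒LinIndep : ∀ {m} {vs : Fam m} → Ind vs → LinIndep vs
    Ind⇒LinIndep {suc m} {vs} (h , t) c e = λ { zero → c₀≈0 ; (suc j) → Ind⇒LinIndep t (c ∘ suc) e′ j }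
      where
      tl : Vect
      tl = lincomb (c ∘ suc) (vs ∘ suc)
      c₀≈0 : c zero ≈ 0#
      c₀≈0 = decidable-stable (c zero ≟ 0#) (λ c₀≉0 →
        h (IsSub.uncomb (span-sub (vs ∘ suc)) c₀≉0 (λ i → sym (e i)) (IsSub.nil (span-sub (vs ∘ suc))) ⟪ c ∘ suc , (λ _ → refl) ⟫))
      e′ : ∀ i → tl i ≈ 0#
      e′ i = begin
        tl i ≈⟨ +-identityˡ _ ⟨
        0# + tl i ≈⟨ +-congʳ (trans (*-congʳ c₀≈0) (zeroˡ _)) ⟨
        c zero * vs zero i + tl i ≈⟨ e i ⟩
        0# ∎

  opaque
    LinIndep⇒Ind : ∀ {m} {vs : Fam m} → LinIndep vs → Ind vs
    LinIndep⇒Ind {0ⁿ} ind = tt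
    LinIndep⇒Ind {suc m} {vs} ind = notin , LinIndep⇒Ind tl
      where
      tl : LinIndep (vs ∘ suc)
      tl c e j = ind (0# ∷ c) (λ i → trans (+-cong (zeroˡ _) (e i)) (+-identityˡ 0#)) (suc j)
      notin : ¬ (vs zero ∈Span (vs ∘ suc))
      notin ⟪ c , e ⟫ = 0≉1 (sym (begin
        1# ≈⟨ solve 0 (con (+ 1) := :- (:- con (+ 1))) refl ⟩
        - (- 1#) ≈⟨ -‿cong (ind (- 1# ∷ c) (λ i → trans (+-congʳ (*-congˡ (e i)))
             (solve 1 (λ s → :- con (+ 1) :* s :+ s := con (+ 0)) refl _)) zero) ⟩
        - 0# ≈⟨ solve 0 (:- con (+ 0) := con (+ 0)) refl ⟩
        0# ∎))

  app : ∀ {r m} → Fam r → Fam m → Fam (r ℕ.+ m)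
  app {0ⁿ} R vs = vs
  app {suc r} R vs = R zero ∷ app (R ∘ suc) vs

  opaque
    app-right : ∀ {r m} (R : Fam r) (vs : Fam m) {x} → x ∈Span vs → x ∈Span (app R vs)
    app-right {0ⁿ} R vs p = p
    app-right {suc r} R vs p = tail-∈ {vs = app R vs} (app-right (R ∘ suc) vs p)

  opaque
    app-left : ∀ {r m} (R : Fam r) (vs : Fam m) j → R j ∈Span (app R vs)
    app-left {suc r} R vs zero = head-∈ (app R vs)
    app-left {suc r} R vs (suc j) = tail-∈ {vs = app R vs} (app-left (R ∘ suc) vs j)

  opaque
    app-least : ∀ {r m} (R : Fam r) (vs : Fam m) {P} → IsSub P → (∀ j → P (R j)) → (∀ j → P (vs j)) → ∀ x → x ∈Span (app R vs) → P x
    app-least {0ⁿ} R vs P-sub g h = span-least P-sub h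
    app-least {suc r} R vs P-sub g h x p with uncons-∈ {vs = app R vs} p
    ... | α , s , ps , e = IsSub.comb P-sub α e (g zero) (app-least (R ∘ suc) vs P-sub (g ∘ suc) h s ps)

  opaque
    -- The first nonzero coefficient of `v` among those of `R` tells which member of `R` the vector
    -- can replace.
    exchange : ∀ {r m} (R : Fam r) (vs : Fam m) {v} → v ∈Span (app R vs) → ¬ v ∈Span vs →
      ∃ λ r′ → r ≡ suc r′ × Σ (Fam r′) λ R′ → ∀ x → x ∈Span (app R vs) → x ∈Span (v ∷ app R′ vs)
    exchange {0ⁿ} R vs p v∉ = ⊥-elim (v∉ p)
    exchange {suc r} R vs {v} p v∉ with uncons-∈ {vs = app R vs} p
    ... | α , s , ps , e with α ≟ 0#
    ...   | no α≉0 = r , ≡.refl , R ∘ suc , span-least {vs = app R vs} sb (λ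
              { zero → IsSub.uncomb sb α≉0 e (head-∈ (v ∷ app (R ∘ suc) vs)) (tail-∈ {vs = v ∷ app (R ∘ suc) vs} ps)
              ; (suc j) → tail-∈ {vs = v ∷ app (R ∘ suc) vs} (gen-∈ (app (R ∘ suc) vs) j) })
              where
              sb : IsSub (_∈Span (v ∷ app (R ∘ suc) vs))
              sb = span-sub (v ∷ app (R ∘ suc) vs)
    ...   | yes α≈0 with exchange (R ∘ suc) vs (IsSub.resp (span-sub (app (R ∘ suc) vs)) {s} {v} (λ i → sym (trans (e i) (trans (+-congʳ (trans (*-congʳ α≈0) (zeroˡ _))) (+-identityˡ _)))) ps) v∉
    ...     | r′ , ≡.refl , R′ , h = suc r′ , ≡.refl , (R zero ∷ R′) , span-least {vs = app R vs} sb (λ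
              { zero → tail-∈ {vs = v ∷ app (R zero ∷ R′) vs} (head-∈ (app (R zero ∷ R′) vs))
              ; (suc j) → span-least {vs = v ∷ app R′ vs} sb (λ
                 { zero → head-∈ (v ∷ app (R zero ∷ R′) vs)
                 ; (suc i) → tail-∈ {vs = v ∷ app (R zero ∷ R′) vs} (tail-∈ {vs = app (R zero ∷ R′) vs} (gen-∈ (app R′ vs) i)) })
                 (app (R ∘ suc) vs j) (h _ (gen-∈ (app (R ∘ suc) vs) j)) })
              where
              sb : IsSub (_∈Span (v ∷ app (R zero ∷ R′) vs))
              sb = span-sub (v ∷ app (R zero ∷ R′) vs)

  opaque
    -- The source of the dimension comparisons: the existence of r gives m ≤ p, and r = 0 makes the
    -- two spans equal.
    steinitz : ∀ {m p} (vs : Fam m) → Ind vs → (ws : Fam p) → (∀ j → vs j ∈Span ws) →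
      ∃ λ r → r ℕ.+ m ≡ p × Σ (Fam r) λ R → ∀ x → x ∈Span ws → x ∈Span (app R vs)
    steinitz {0ⁿ} {p} vs _ ws _ = p , ℕₚ.+-identityʳ p , ws , span-least (span-sub (app ws vs)) (app-left ws vs)
    steinitz {suc m} {p} vs (v∉ , ind) ws g with steinitz (vs ∘ suc) ind ws (g ∘ suc)
    ... | r , r+m≡p , R , h with exchange R (vs ∘ suc) (h _ (g zero)) v∉
    ...   | r′ , ≡.refl , R′ , h′ = r′ , ≡.trans (ℕₚ.+-suc r′ m) r+m≡p , R′ , λ x p →
             span-least {vs = vs zero ∷ app R′ (vs ∘ suc)} (span-sub (app R′ vs)) (λ { zero → app-right R′ vs (head-∈ vs)
               ; (suc j) → app-least R′ (vs ∘ suc) (span-sub (app R′ vs)) (app-left R′ vs) (λ j → app-right R′ vs (gen-∈ vs (suc j))) _ (gen-∈ (app R′ (vs ∘ suc)) j) })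
               x (h′ x (h x p))

  -- Subspaces of given dimension, intersections, the standard basis

  record Sp (m : ℕ) : Set where
    constructor sp
    field
      fam : Fam m
      ind : Ind fam
  open Sp public

  record _∈ₛ_ {m} (x : Vect) (S : Sp m) : Set where
    constructor ⟨_⟩
    field un : x ∈Span fam S
  open _∈ₛ_ public

  _∉ₛ_ : ∀ {m} → Vect → Sp m → Set
  x ∉ₛ S = ¬ x ∈ₛ S

  record _⊆_ {m p} (S : Sp m) (U : Sp p) : Set where
    constructor incl
    infixl 5 _!_
    field _!_ : ∀ {x} → x ∈ₛ S → x ∈ₛ U
  open _⊆_ public

  _⊈_ : ∀ {m p} → Sp m → Sp p → Set
  S ⊈ U = ¬ (S ⊆ U)

  ⊆-refl : ∀ {m} {S : Sp m} → S ⊆ S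
  ⊆-refl = incl λ p → p

  ⊆-trans : ∀ {m p r} {S : Sp m} {U : Sp p} {W : Sp r} → S ⊆ U → U ⊆ W → S ⊆ W
  ⊆-trans h g = incl λ p → g ! (h ! p)

  record _≐_ {m p} (S : Sp m) (U : Sp p) : Set where
    constructor _,_
    field
      fwd : S ⊆ U
      bwd : U ⊆ S
  open _≐_ public

  ≐-sym : ∀ {m p} {S : Sp m} {U : Sp p} → S ≐ U → U ≐ S
  ≐-sym (a , b) = b , a

  ≐-trans : ∀ {m p r} {S : Sp m} {U : Sp p} {W : Sp r} → S ≐ U → U ≐ W → S ≐ W
  ≐-trans (a , b) (c , d) = ⊆-trans a c , ⊆-trans d b

  ≐-refl : ∀ {m} {S : Sp m} → S ≐ S
  ≐-refl = ⊆-refl , ⊆-refl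

  opaque
    isSub : ∀ {m} (S : Sp m) → IsSub (_∈ₛ S)
    isSub S = record
      { resp = λ e p → ⟨ IsSub.resp sb e (un p) ⟩
      ; nil = ⟨ IsSub.nil sb ⟩
      ; add = λ p p′ → ⟨ IsSub.add sb (un p) (un p′) ⟩
      ; scale = λ α p → ⟨ IsSub.scale sb α (un p) ⟩ }
      where
      sb : IsSub (_∈Span fam S)
      sb = span-sub (fam S)


  opaque
    gen : ∀ {m} (S : Sp m) j → fam S j ∈ₛ S
    gen S j = ⟨ gen-∈ (fam S) j ⟩

  opaque
    _∈?_ : ∀ {m} x (S : Sp m) → Dec (x ∈ₛ S)
    x ∈? S = map′ ⟨_⟩ un (x ∈Span? fam S)

  opaque
    least : ∀ {m} (S : Sp m) {P} → IsSub P → (∀ j → P (fam S j)) → ∀ {x} → x ∈ₛ S → P x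
    least S P-sub g {x} p = span-least P-sub g x (un p)

  opaque
    _⊆?_ : ∀ {m p} (S : Sp m) (U : Sp p) → Dec (S ⊆ U)
    S ⊆? U = map′ (λ g → incl (least S (isSub U) g)) (λ h j → h ! gen S j) (Fₚ.all? (λ j → fam S j ∈? U))

  opaque
    ⊈-witness : ∀ {m p} {S : Sp m} {U : Sp p} → S ⊈ U → ∃ λ x → x ∈ₛ S × x ∉ₛ U
    ⊈-witness {S = S} {U} S⊈U with Fₚ.any? (λ j → ¬? (fam S j ∈? U))
    ... | yes (j , p) = fam S j , gen S j , p
    ... | no h = ⊥-elim (S⊈U (incl (least S (isSub U) (λ j → decidable-stable (fam S j ∈? U) (λ p → h (j , p))))))

  opaque
    ⊆-dim : ∀ {m p} {S : Sp m} {U : Sp p} → S ⊆ U → m ≤ p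
    ⊆-dim {m} {S = S} {U} h with steinitz (fam S) (ind S) (fam U) (λ j → un (h ! gen S j))
    ... | r , ≡.refl , _ = ℕₚ.m≤n+m m r

  opaque
    eqdim : ∀ {m} {S U : Sp m} → S ⊆ U → U ⊆ S
    eqdim {m} {S} {U} h with steinitz (fam S) (ind S) (fam U) (λ j → un (h ! gen S j))
    ... | 0ⁿ , _ , _ , g = incl λ p → ⟨ g _ (un p) ⟩
    ... | suc r , e , _ = ⊥-elim (ℕₚ.m≢1+n+m m (≡.sym e))

  ⊆⇒≐ : ∀ {m} {S U : Sp m} → S ⊆ U → S ≐ U
  ⊆⇒≐ h = h , eqdim h

  opaque
    _≐?_ : ∀ {m} (S U : Sp m) → Dec (S ≐ U)
    S ≐? U = map′ ⊆⇒≐ fwd (S ⊆? U)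

  opaque
    outside : ∀ {m p} → m < p → (S : Sp m) (U : Sp p) → ∃ λ x → x ∈ₛ U × x ∉ₛ S
    outside m<p S U = ⊈-witness {S = U} {S} (λ h → ℕₚ.<⇒≱ m<p (⊆-dim h))

  ext : ∀ {m} (S : Sp m) x → x ∉ₛ S → Sp (suc m)
  ext S x x∉ = sp (x ∷ fam S) ((λ p → x∉ ⟨ p ⟩) , ind S)

  opaque
    ext-⊆ : ∀ {m} {S : Sp m} {x} {x∉ : x ∉ₛ S} → S ⊆ ext S x x∉
    ext-⊆ {S = S} {x} {x∉} = incl λ p → ⟨ tail-∈ {vs = fam (ext S x x∉)} (un p) ⟩

  opaque
    ext-∈ : ∀ {m} {S : Sp m} {x} {x∉ : x ∉ₛ S} → x ∈ₛ ext S x x∉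
    ext-∈ {S = S} {x} {x∉} = gen (ext S x x∉) zero

  opaque
    ext-least : ∀ {m p} {S : Sp m} {x} {x∉ : x ∉ₛ S} {U : Sp p} → S ⊆ U → x ∈ₛ U → ext S x x∉ ⊆ U
    ext-least {S = S} {x} {x∉} {U} h p = incl (least (ext S x x∉) (isSub U) (λ { zero → p ; (suc j) → h ! gen S j }))

  opaque
    ext-inv : ∀ {m} {S : Sp m} {x} {x∉ : x ∉ₛ S} {y} → y ∈ₛ ext S x x∉ → ∃ λ α → ∃ λ s → s ∈ₛ S × (∀ i → y i ≈ α * x i + s i)
    ext-inv {S = S} {x} {x∉} p with uncons-∈ {vs = fam (ext S x x∉)} (un p)
    ... | α , s , s∈ , e = α , s , ⟨ s∈ ⟩ , e

  opaque
    ext-intro : ∀ {m} {S : Sp m} {x} {x∉ : x ∉ₛ S} {y s} α → (∀ i → y i ≈ α * x i + s i) → s ∈ₛ S → y ∈ₛ ext S x x∉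
    ext-intro {S = S} {x} {x∉} α e p = ⟨ cons-∈ α {fam (ext S x x∉)} e (un p) ⟩

  opaque
    ext-hyper : ∀ {m} {S : Sp m} {x} {x∉ : x ∉ₛ S} {U : Sp (suc m)} → S ⊆ U → x ∈ₛ U → U ⊆ ext S x x∉
    ext-hyper h p = eqdim (ext-least h p)

  opaque
    hyper-inv : ∀ {m} {S : Sp m} {U : Sp (suc m)} → S ⊆ U → ∀ {x} → x ∈ₛ U → x ∉ₛ S →
      ∀ {y} → y ∈ₛ U → ∃ λ α → ∃ λ s → s ∈ₛ S × (∀ i → y i ≈ α * x i + s i)
    hyper-inv h p x∉ y∈ = ext-inv {x∉ = x∉} (ext-hyper h p ! y∈)

  _⊂ᴾ_ : ∀ {m} → Sp m → (Vect → Set) → Set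
  S ⊂ᴾ P = ∀ x → x ∈ₛ S → P x

  nilSp : Sp 0
  nilSp = sp [] tt

  opaque
    nilSp-least : ∀ {P} → IsSub P → nilSp ⊂ᴾ P
    nilSp-least P-sub x = least nilSp P-sub (λ ())

  opaque
    extᴾ : ∀ {m} (S : Sp m) x x∉ {P} → IsSub P → S ⊂ᴾ P → P x → ext S x x∉ ⊂ᴾ P
    extᴾ S x x∉ P-sub h p y = least (ext S x x∉) P-sub (λ { zero → p ; (suc j) → h _ (gen S j) })

  opaque
    -- For subspaces known only through a predicate, such as intersections: as long as no smaller
    -- subspace exhausts `P`, a vector of `P` outside can be added.
    build : ∀ {P} → IsSub P → ∀ r {j} → (∀ {i} → i < r ℕ.+ j → (Y : Sp i) → Y ⊂ᴾ P → ∃ λ x → P x × x ∉ₛ Y) →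
      (Y : Sp j) → Y ⊂ᴾ P → Σ (Sp (r ℕ.+ j)) λ S → (Y ⊆ S) × (S ⊂ᴾ P)
    build P-sub 0ⁿ h Y g = Y , ⊆-refl , g
    build P-sub (suc r) {j} h Y g with build P-sub r (λ i< → h (ℕₚ.m<n⇒m<1+n i<)) Y g
    ... | S , Y⊆S , S⊂P with h ℕₚ.≤-refl S S⊂P
    ...   | x , px , x∉ = ext S x x∉ , ⊆-trans Y⊆S ext-⊆ , extᴾ S x x∉ P-sub S⊂P px

  opaque
    between : ∀ r {j p} {Y : Sp j} {U : Sp p} → Y ⊆ U → r ℕ.+ j ≤ p → Σ (Sp (r ℕ.+ j)) λ S → (Y ⊆ S) × (S ⊆ U)
    between r {Y = Y} {U} Y⊆U r+j≤p with build (isSub U) r (λ i< Z _ → outside (ℕₚ.<-≤-trans i< r+j≤p) Z U) Y (λ _ p → Y⊆U ! p)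
    ... | S , Y⊆S , S⊆U = S , Y⊆S , incl (S⊆U _)

  opaque
    ∩-sub : ∀ {m p} (U : Sp m) (W : Sp p) → IsSub (λ x → x ∈ₛ U × x ∈ₛ W)
    ∩-sub U W = record
      { resp = λ e (a , b) → IsSub.resp (isSub U) e a , IsSub.resp (isSub W) e b
      ; nil = IsSub.nil (isSub U) , IsSub.nil (isSub W)
      ; add = λ (a , b) (c , d) → IsSub.add (isSub U) a c , IsSub.add (isSub W) b d
      ; scale = λ α (a , b) → IsSub.scale (isSub U) α a , IsSub.scale (isSub W) α b }

  opaque
    -- A form of the dimension formula. Since T = U + ⟨w⟩, every element of W is a multiple of w
    -- plus an element of U ∩ W; if Y contained U ∩ W, then W ⊆ Y + ⟨w⟩, whose dimension is too
    -- small.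
    ∩-big : ∀ {m i} (U W : Sp (suc m)) (T : Sp (suc (suc m))) → U ⊆ T → W ⊆ T → ∀ w → w ∈ₛ W → w ∉ₛ U →
      i < m → (Y : Sp i) → Y ⊂ᴾ (λ x → x ∈ₛ U × x ∈ₛ W) → ¬ (∀ x → x ∈ₛ U → x ∈ₛ W → x ∈ₛ Y)
    ∩-big {m} {i} U W T U⊆T W⊆T w w∈W w∉U i<m Y Y⊂ all = ℕₚ.<⇒≱ i<m (ℕₚ.≤-pred (⊆-dim (incl go)))
      where
      w∉Y : w ∉ₛ Y
      w∉Y p = w∉U (proj₁ (Y⊂ w p))
      go : ∀ {x} → x ∈ₛ W → x ∈ₛ ext Y w w∉Y
      go {x} x∈W with hyper-inv U⊆T (W⊆T ! w∈W) w∉U (W⊆T ! x∈W)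
      ... | α , s , s∈U , e = ext-intro α e (all s s∈U (IsSub.uncomb′ (isSub W) α e w∈W x∈W))

  opaque
    search-∩ : ∀ {m p r} (U : Sp m) (W : Sp p) (Y : Sp r) → ¬ (∀ x → x ∈ₛ U → x ∈ₛ W → x ∈ₛ Y) →
      ∃ λ x → (x ∈ₛ U × x ∈ₛ W) × x ∉ₛ Y
    search-∩ U W Y h = decidable-stable
      (search n (λ e (b , c) → IsSub.resp (∩-sub U W) e b , λ d → c (IsSub.resp (isSub Y) (λ i → sym (e i)) d))
        (λ x → ((x ∈? U) ×-dec (x ∈? W)) ×-dec ¬? (x ∈? Y)))
      (λ ∄ → h (λ x u w → decidable-stable (x ∈? Y) (λ x∉ → ∄ (x , (u , w) , x∉))))

  opaque
    meet : ∀ {m} {U W : Sp (suc m)} {T : Sp (suc (suc m))} → U ⊆ T → W ⊆ T → W ⊈ U →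
      Σ (Sp m) λ S → (S ⊆ U) × (S ⊆ W)
    meet {m} {U} {W} {T} U⊆T W⊆T W⊈U with ⊈-witness W⊈U
    ... | w , w∈W , w∉U with build (∩-sub U W) m {0}
            (λ {i} i<m Y Y⊂ → search-∩ U W Y (∩-big U W T U⊆T W⊆T w w∈W w∉U (≡.subst (i <_) (ℕₚ.+-identityʳ m) i<m) Y Y⊂))
            nilSp (nilSp-least (∩-sub U W))
    ...   | S , _ , S⊂ = ≡.subst (λ p → Σ (Sp p) λ S → (S ⊆ U) × (S ⊆ W)) (ℕₚ.+-identityʳ m)
            (S , incl (λ p → proj₁ (S⊂ _ p)) , incl (λ p → proj₂ (S⊂ _ p)))

  opaque
    𝕖 : Fin n → Vect
    𝕖 i j with i Fₚ.≟ j
    ... | yes _ = 1#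
    ... | no _ = 0#

    𝕖-diag : ∀ i → 𝕖 i i ≈ 1#
    𝕖-diag i with i Fₚ.≟ i
    ... | yes _ = refl
    ... | no ¬p = ⊥-elim (¬p ≡.refl)

    𝕖-off : ∀ {i j} → ¬ i ≡ j → 𝕖 i j ≈ 0#
    𝕖-off {i} {j} i≢j with i Fₚ.≟ j
    ... | yes p = ⊥-elim (i≢j p)
    ... | no _ = refl

  opaque
    lincomb-𝕖 : ∀ c → lincomb c 𝕖 ≈ᵥ c
    lincomb-𝕖 c i = trans (∑-single _ i (λ j j≢i → trans (*-congˡ (𝕖-off j≢i)) (zeroʳ _)))
      (trans (*-congˡ (𝕖-diag i)) (*-identityʳ _))

  𝕖-basis : Sp n
  𝕖-basis = sp 𝕖 (LinIndep⇒Ind (λ c e j → trans (sym (lincomb-𝕖 c j)) (e j)))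

  opaque
    𝕖-spans : ∀ {P} → IsSub P → (∀ i → P (𝕖 i)) → ∀ x → P x
    𝕖-spans P-sub g x = least 𝕖-basis P-sub g ⟨ ⟪ x , (λ i → sym (lincomb-𝕖 x i)) ⟫ ⟩

  opaque
    𝕖-outside : ∀ {m} → m < n → (S : Sp m) → ∃ λ i → 𝕖 i ∉ₛ S
    𝕖-outside m<n S with Fₚ.any? (λ i → ¬? (𝕖 i ∈? S))
    ... | yes p = p
    ... | no h = ⊥-elim (ℕₚ.<⇒≱ m<n (⊆-dim (incl (λ p → least 𝕖-basis (isSub S) (λ i → decidable-stable (𝕖 i ∈? S) (λ p → h (i , p))) p))))

  -- The number of points of the projective space of F^m.
  N : ℕ → ℕ
  N 0ⁿ = 0
  N (suc m) = q ^ m ℕ.+ N m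

  -- Numbering of vectors, projective points and stars

  scalars : ∀ m → Fin (q ^ m) → Fin m → Carrier
  scalars m c = enum ∘ finToFun {q} {m} c

  opaque
    scalars-surj : ∀ {m} (c : Fin m → Carrier) → ∃ λ i → ∀ j → scalars m i j ≈ c j
    scalars-surj {m} c = funToFin idx , λ j → trans (reflexive (≡.cong enum (Fₚ.finToFun-funToFin idx j))) (proj₂ (enum-surjective (c j)))
      where
      idx : Fin m → Fin q
      idx j = proj₁ (enum-surjective (c j))

  opaque
    funToFin-cong : ∀ {m p} {f g : Fin m → Fin p} → (∀ j → f j ≡ g j) → funToFin f ≡ funToFin g
    funToFin-cong {0ⁿ} h = ≡.refl
    funToFin-cong {suc m} h = ≡.cong₂ Fin.combine (h zero) (funToFin-cong (h ∘ suc))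

  opaque
    scalars-inj : ∀ {m} (c c′ : Fin (q ^ m)) → (∀ j → scalars m c j ≈ scalars m c′ j) → c ≡ c′
    scalars-inj {m} c c′ e = ≡.trans (≡.sym (Fₚ.funToFin-finToFin {m} {q} c))
      (≡.trans (funToFin-cong (λ j → enum-injective (finToFun {q} {m} c j) (finToFun {q} {m} c′ j) (e j))) (Fₚ.funToFin-finToFin {m} {q} c′))

  split : ∀ m → Fin (N (suc m)) → Fin (q ^ m) ⊎ Fin (N m)
  split m = splitAt (q ^ m)

  opaque
    split-inj : ∀ m (i j : Fin (N (suc m))) → split m i ≡ split m j → i ≡ j
    split-inj m i j e = ≡.trans (≡.sym (Fₚ.join-splitAt (q ^ m) (N m) i)) (≡.trans (≡.cong (join (q ^ m) (N m)) e) (Fₚ.join-splitAt (q ^ m) (N m) j))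

  -- A projective point is represented by its vector whose first nonzero coordinate is 1; the sum
  -- type separates a leading 1 from a leading 0.
  pt : ∀ m → Fin (N m) → Fin m → Carrier
  pt⊎ : ∀ m → Fin (q ^ m) ⊎ Fin (N m) → Fin (suc m) → Carrier
  pt (suc m) j = pt⊎ m (split m j)
  pt⊎ m (inj₁ c) = 1# ∷ scalars m c
  pt⊎ m (inj₂ j) = 0# ∷ pt m j

  opaque
    pt-nonzero : ∀ m j → ¬ (∀ i → pt m j i ≈ 0#)
    pt-nonzero (suc m) j h with split m j
    ... | inj₁ c = 0≉1 (sym (h zero))
    ... | inj₂ j′ = pt-nonzero m j′ (h ∘ suc)

  opaque
    pt-inj : ∀ m j j′ α → (∀ i → pt m j i ≈ α * pt m j′ i) → j ≡ j′
    pt-inj (suc m) j j′ α e with split m j in eq | split m j′ in eq′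
    ... | inj₁ c | inj₂ _ = ⊥-elim (0≉1 (sym (trans (e zero) (zeroʳ α))))
    ... | inj₂ i | inj₁ c = ⊥-elim (pt-nonzero m i (λ l → trans (e (suc l)) (trans (*-congʳ (trans (sym (*-identityʳ α)) (sym (e zero)))) (zeroˡ _))))
    ... | inj₁ c | inj₁ c′ = split-inj m j j′ (≡.trans eq (≡.trans (≡.cong inj₁ (scalars-inj c c′
            (λ i → trans (e (suc i)) (trans (*-congʳ (trans (sym (*-identityʳ α)) (sym (e zero)))) (*-identityˡ _))))) (≡.sym eq′)))
    ... | inj₂ i | inj₂ i′ = split-inj m j j′ (≡.trans eq (≡.trans (≡.cong inj₂ (pt-inj m i i′ α (e ∘ suc))) (≡.sym eq′)))

  opaque
    pt-surj : ∀ m (c : Fin m → Carrier) → ¬ (∀ i → c i ≈ 0#) → ∃ λ j → ∃ λ α → ¬ α ≈ 0# × (∀ i → c i ≈ α * pt m j i)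
    pt-surj 0ⁿ c h = ⊥-elim (h λ ())
    pt-surj (suc m) c h with c zero ≟ 0#
    ... | yes c₀≈0 with pt-surj m (c ∘ suc) (λ g → h (λ { zero → c₀≈0 ; (suc i) → g i }))
    ...   | j , α , α≉0 , e = q ^ m ↑ʳ j , α , α≉0 , λ i → trans (go i) (*-congˡ (reflexive (≡.cong (λ z → pt⊎ m z i) (≡.sym (Fₚ.splitAt-↑ʳ (q ^ m) (N m) j)))))
      where
      go : ∀ i → c i ≈ α * pt⊎ m (inj₂ j) i
      go zero = trans c₀≈0 (sym (zeroʳ α))
      go (suc i) = e i
    pt-surj (suc m) c h | no c₀≉0 = r ↑ˡ N m , c zero , c₀≉0 ,
        λ i → trans (go i) (*-congˡ (reflexive (≡.cong (λ z → pt⊎ m z i) (≡.sym (Fₚ.splitAt-↑ˡ (q ^ m) r (N m))))))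
      where
      d : Fin m → Carrier
      d i = inv (c zero) c₀≉0 * c (suc i)
      r : Fin (q ^ m)
      r = proj₁ (scalars-surj d)
      go : ∀ i → c i ≈ c zero * pt⊎ m (inj₁ r) i
      go zero = sym (*-identityʳ _)
      go (suc i) = begin
        c (suc i) ≈⟨ *-identityˡ _ ⟨
        1# * c (suc i) ≈⟨ *-congʳ (inv-* (c zero) c₀≉0) ⟨
        inv (c zero) c₀≉0 * c zero * c (suc i) ≈⟨ solve 3 (λ a b c → a :* b :* c := b :* (a :* c)) refl _ _ _ ⟩
        c zero * d i ≈⟨ *-congˡ (proj₂ (scalars-surj d) i) ⟨
        c zero * scalars m r i ∎

  opaque
    lincomb-∈ : ∀ {r} (c : Fin r → Carrier) (R : Fam r) → lincomb c R ∈Span R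
    lincomb-∈ c R = ⟪ c , (λ _ → refl) ⟫

  opaque
    lincomb-scale : ∀ {r} α (c c′ : Fin r → Carrier) (R : Fam r) → (∀ j → c j ≈ α * c′ j) → ∀ i → lincomb c R i ≈ α * lincomb c′ R i
    lincomb-scale {0ⁿ} α c c′ R e i = sym (zeroʳ α)
    lincomb-scale {suc r} α c c′ R e i = begin
      c zero * R zero i + lincomb (c ∘ suc) (R ∘ suc) i ≈⟨ +-cong (*-congʳ (e zero)) (lincomb-scale α (c ∘ suc) (c′ ∘ suc) (R ∘ suc) (e ∘ suc) i) ⟩
      α * c′ zero * R zero i + α * lincomb (c′ ∘ suc) (R ∘ suc) i ≈⟨ solve 4 (λ a b c d → a :* b :* c :+ a :* d := a :* (b :* c :+ d)) refl _ _ _ _ ⟩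
      α * (c′ zero * R zero i + lincomb (c′ ∘ suc) (R ∘ suc) i) ∎

  opaque
    lincomb-comb : ∀ {r} α (c c′ : Fin r → Carrier) (R : Fam r) → ∀ i →
      lincomb (λ j → c j + - (α * c′ j)) R i ≈ lincomb c R i + - (α * lincomb c′ R i)
    lincomb-comb {0ⁿ} α c c′ R i = solve 1 (λ a → con (+ 0) := con (+ 0) :- a :* con (+ 0)) refl α
    lincomb-comb {suc r} α c c′ R i = trans (+-congˡ (lincomb-comb α (c ∘ suc) (c′ ∘ suc) (R ∘ suc) i))
      (solve 6 (λ α a b v s t → (a :- α :* b) :* v :+ (s :- α :* t) := (a :* v :+ s) :- α :* (b :* v :+ t)) refl α (c zero) (c′ zero) (R zero i) _ _)

  opaque
    -- Independence of `R` in the quotient by the span of `vs`, without forming the quotient.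
    ind-mod : ∀ {r m} (R : Fam r) (vs : Fam m) → Ind (app R vs) → ∀ c → lincomb c R ∈Span vs → ∀ j → c j ≈ 0#
    ind-mod {suc r} R vs (h , t) c p = λ { zero → c₀≈0 ; (suc j) → ind-mod (R ∘ suc) vs t (c ∘ suc) p′ j }
      where
      tl : Vect
      tl = lincomb (c ∘ suc) (R ∘ suc)
      tl∈ : tl ∈Span app (R ∘ suc) vs
      tl∈ = span-least (span-sub (app (R ∘ suc) vs)) (app-left (R ∘ suc) vs) tl (lincomb-∈ (c ∘ suc) (R ∘ suc))
      c₀≈0 : c zero ≈ 0#
      c₀≈0 = decidable-stable (c zero ≟ 0#) (λ c₀≉0 → h (IsSub.uncomb (span-sub (app (R ∘ suc) vs)) c₀≉0 (λ i → refl) (app-right (R ∘ suc) vs p) tl∈))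
      p′ : tl ∈Span vs
      p′ = IsSub.resp (span-sub vs) (λ i → trans (+-congʳ (trans (*-congʳ c₀≈0) (zeroˡ _))) (+-identityˡ _)) p

  opaque
    complete : ∀ r {m} (S : Sp m) → r ℕ.+ m ≤ n → Σ (Fam r) λ R → Ind (app R (fam S))
    complete 0ⁿ S _ = [] , ind S
    complete (suc r) S r+m<n with complete r S (ℕₚ.<⇒≤ r+m<n)
    ... | R , ind-R with 𝕖-outside r+m<n (sp (app R (fam S)) ind-R)
    ...   | i , ∉ = 𝕖 i ∷ R , (λ p → ∉ ⟨ p ⟩) , ind-R

  opaque
    app-inv : ∀ {r m} (R : Fam r) (vs : Fam m) {x} → x ∈Span (app R vs) → ∃ λ c → ∃ λ s → s ∈Span vs × (∀ i → x i ≈ lincomb c R i + s i)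
    app-inv {0ⁿ} R vs {x} p = (λ ()) , x , p , λ i → sym (+-identityˡ _)
    app-inv {suc r} R vs p with uncons-∈ {vs = app R vs} p
    ... | α , s , ps , e with app-inv (R ∘ suc) vs ps
    ...   | c , t , pt , e′ = α ∷ c , t , pt , λ i → trans (e i) (trans (+-congˡ (e′ i)) (solve 3 (λ a b c → a :+ (b :+ c) := a :+ b :+ c) refl _ _ _))

  -- A complement `R` of S identifies the star of S with the projective points of F^r, so the star
  -- has N r members.
  module StarCode {m r} (S : Sp m) (r+m≡n : r ℕ.+ m ≡ n) where
    opaque
      R : Fam r
      R = proj₁ (complete r S (ℕₚ.≤-reflexive r+m≡n))

      R-ind : Ind (app R (fam S))
      R-ind = proj₂ (complete r S (ℕₚ.≤-reflexive r+m≡n))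

    point : Fin (N r) → Vect
    point j = lincomb (pt r j) R

    opaque
      point-∉ : ∀ j → point j ∉ₛ S
      point-∉ j p = pt-nonzero r j (ind-mod R (fam S) R-ind (pt r j) (un p))

    opaque
      R-spans : ∀ x → x ∈Span app R (fam S)
      R-spans x = un {S = Y} (eqdim′ ! 𝕖-spans (isSub E) (gen E) x)
        where
        Y : Sp (r ℕ.+ m)
        Y = sp (app R (fam S)) R-ind
        E : Sp n
        E = 𝕖-basis
        eqdim′ : E ⊆ Y
        eqdim′ = ≡.subst (λ z → (Z : Sp z) → E ⊆ Z) (≡.sym r+m≡n) (λ Z → eqdim (incl (λ {x} _ → 𝕖-spans (isSub E) (gen E) x))) Y

    opaque
      point-surj : ∀ {x} → x ∉ₛ S → ∃ λ j → ∃ λ α → ¬ α ≈ 0# × ∃ λ s → s ∈ₛ S × (∀ i → x i ≈ α * point j i + s i)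
      point-surj {x} x∉ with app-inv R (fam S) (R-spans x)
      ... | c , s , ps , e with pt-surj r c (λ c≈0 → x∉ ⟨ IsSub.resp (span-sub (fam S)) {s}
             (λ i → sym (trans (e i) (trans (+-congʳ (∑-zero (λ j → trans (*-congʳ (c≈0 j)) (zeroˡ _)))) (+-identityˡ _)))) ps ⟩)
      ...   | j , α , α≉0 , e′ = j , α , α≉0 , s , ⟨ ps ⟩ , λ i → trans (e i) (+-congʳ (lincomb-scale α c (pt r j) R e′ i))

    opaque
      point-inj : ∀ j j′ → point j ∈ₛ ext S (point j′) (point-∉ j′) → j ≡ j′
      point-inj j j′ p with ext-inv p
      ... | α , s , s∈ , e = pt-inj r j j′ α (λ i → x-y≈0⇒x≈y (ind-mod R (fam S) R-ind (λ i → pt r j i + - (α * pt r j′ i))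
              (IsSub.resp (span-sub (fam S)) {s} (λ i → trans (solve 2 (λ a s → s := (a :+ s) :- a) refl _ _) (trans (+-congʳ (sym (e i))) (sym (lincomb-comb α (pt r j) (pt r j′) R i)))) (un s∈)) i))

    star : Fin (N r) → Sp (suc m)
    star j = ext S (point j) (point-∉ j)

    opaque
      star-code : (U : Sp (suc m)) → S ⊆ U → ∃ λ j → point j ∈ₛ U
      star-code U S⊆U with outside ℕₚ.≤-refl S U
      ... | x , x∈ , x∉ with point-surj x∉
      ...   | j , α , α≉0 , s , s∈ , e = j , IsSub.uncomb (isSub U) α≉0 e x∈ (S⊆U ! s∈)

    opaque
      star-count : (h : Fin (suc (N r)) → Sp (suc m)) → (∀ i → S ⊆ h i) → ∃ λ i → ∃ λ j → ¬ i ≡ j × h i ≐ h j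
      star-count h S⊆h with Fₚ.pigeonhole (ℕₚ.n<1+n (N r)) (λ i → proj₁ (star-code (h i) (S⊆h i)))
      ... | i , j , i<j , e = i , j , Fₚ.<⇒≢ i<j ,
            ⊆⇒≐ (⊆-trans (ext-hyper {x∉ = point-∉ _} (S⊆h i) (proj₂ (star-code (h i) (S⊆h i)))) (ext-least (S⊆h j) (≡.subst (λ z → point z ∈ₛ h j) (≡.sym e) (proj₂ (star-code (h j) (S⊆h j))))))

  -- Numbering of hyperplanes and tops

  Code : ∀ {m} → Fam m → Fin (N m) → (Vect → Set) → Set
  -- Row-reduced description of a hyperplane Q of the span of t. If `t zero` is outside Q, each
  -- later basis vector is brought into Q by subtracting a unique multiple of `t zero`; if it is
  -- inside, one recurses. This counts hyperplanes without dual spaces.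
  Code⊎ : ∀ {m} → Fam (suc m) → Fin (q ^ m) ⊎ Fin (N m) → (Vect → Set) → Set
  Code {suc m} t j Q = Code⊎ t (split m j) Q
  Code⊎ {m} t (inj₁ c) Q = ¬ Q (t zero) × (∀ i → Q (t (suc i) -ᵥ scalars m c i · t zero))
  Code⊎ t (inj₂ j) Q = Q (t zero) × Code (t ∘ suc) j Q

  opaque
    code-unique : ∀ {m} (t : Fam m) i j {Q} → IsSub Q → Code t i Q → Code t j Q → i ≡ j
    code-unique {suc m} t i j {Q} Q-sub ci cj with split m i in eq | split m j in eq′
    code-unique {suc m} t i j Q-sub (∉ , _) (∈ , _) | inj₁ _ | inj₂ _ = ⊥-elim (∉ ∈)
    code-unique {suc m} t i j Q-sub (∈ , _) (∉ , _) | inj₂ _ | inj₁ _ = ⊥-elim (∉ ∈)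
    code-unique {suc m} t i j Q-sub (_ , ci) (_ , cj) | inj₂ i′ | inj₂ j′ =
      split-inj m i j (≡.trans eq (≡.trans (≡.cong inj₂ (code-unique (t ∘ suc) i′ j′ Q-sub ci cj)) (≡.sym eq′)))
    code-unique {suc m} t i j {Q} Q-sub (∉ , ci) (_ , cj) | inj₁ c | inj₁ c′ =
      split-inj m i j (≡.trans eq (≡.trans (≡.cong inj₁ (scalars-inj c c′ same)) (≡.sym eq′)))
      where
      same : ∀ l → scalars m c l ≈ scalars m c′ l
      same l = decidable-stable (scalars m c l ≟ scalars m c′ l) (λ ne → ∉ (IsSub.uncomb Q-sub {scalars m c′ l + - scalars m c l} {t zero} {0ᵥ}
        {(t (suc l) -ᵥ scalars m c l · t zero) -ᵥ (t (suc l) -ᵥ scalars m c′ l · t zero)}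
        (λ e → ne (sym (x-y≈0⇒x≈y e)))
        (λ i → solve 4 (λ a b v t → (t :- a :* v) :- (t :- b :* v) := (b :- a) :* v :+ con (+ 0)) refl _ _ _ _)
        (IsSub.sub Q-sub (ci l) (cj l)) (IsSub.nil Q-sub)))

  opaque
    code-cong : ∀ {m} (t : Fam m) j {Q Q′} → (∀ x → x ∈Span t → Q x → Q′ x) → (∀ x → x ∈Span t → Q′ x → Q x) → Code t j Q → Code t j Q′
    code-cong {suc m} t j f g c with split m j
    code-cong {suc m} t j f g (∉ , c) | inj₁ a = (λ p → ∉ (g _ (head-∈ t) p)) ,
      λ i → f _ (IsSub.sub (span-sub t) (gen-∈ t (suc i)) (IsSub.scale (span-sub t) _ (head-∈ t))) (c i)
    code-cong {suc m} t j f g (∈ , c) | inj₂ j′ = f _ (head-∈ t) ∈ , code-cong (t ∘ suc) j′ (λ x p → f x (tail-∈ p)) (λ x p → g x (tail-∈ p)) c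

  opaque
    code-exists : ∀ {m} (t : Fam m) {Q} → (∀ x → Dec (Q x)) → (∀ a b → a ∈Span t → b ∈Span t → ¬ Q a → ∃ λ α → Q (b -ᵥ α · a)) →
      IsSub Q → ¬ (∀ i → Q (t i)) → ∃ λ j → Code t j Q
    code-exists {0ⁿ} t Q? H Q-sub h = ⊥-elim (h λ ())
    code-exists {suc m} t {Q} Q? H Q-sub h with Q? (t zero)
    ... | yes p with code-exists (t ∘ suc) Q? (λ a b pa pb → H a b (tail-∈ pa) (tail-∈ pb)) Q-sub (λ g → h (λ { zero → p ; (suc i) → g i }))
    ...   | j , c = q ^ m ↑ʳ j , ≡.subst (λ z → Code⊎ t z Q) (≡.sym (Fₚ.splitAt-↑ʳ (q ^ m) (N m) j)) (p , c)
    code-exists {suc m} t {Q} Q? H Q-sub h | no ∉ = r ↑ˡ N m , ≡.subst (λ z → Code⊎ t z Q) (≡.sym (Fₚ.splitAt-↑ˡ (q ^ m) r (N m))) (∉ , ok)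
      where
      d : Fin m → Carrier
      d i = proj₁ (H (t zero) (t (suc i)) (head-∈ t) (gen-∈ t (suc i)) ∉)
      r : Fin (q ^ m)
      r = proj₁ (scalars-surj d)
      ok : ∀ i → Q (t (suc i) -ᵥ scalars m r i · t zero)
      ok i = IsSub.resp Q-sub (λ l → +-congˡ (-‿cong (*-congʳ (sym (proj₂ (scalars-surj d) i))))) (proj₂ (H (t zero) (t (suc i)) (head-∈ t) (gen-∈ t (suc i)) ∉))

  opaque
    -- When `t zero` is outside, every vector of the span is β · `t zero` plus a vector common to Q
    -- and Q′; if it lies in Q, so does β · `t zero`, which forces β = 0.
    code-det : ∀ {m} (t : Fam m) j {Q Q′} → IsSub Q → IsSub Q′ → Code t j Q → Code t j Q′ → ∀ x → x ∈Span t → Q x → Q′ x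
    code-det {suc m} t j Q-sub Q′-sub c c′ x p qx with split m j
    code-det {suc m} t j Q-sub Q′-sub (∈ , c) (∈′ , c′) x p qx | inj₂ j′ with uncons-∈ {vs = t} p
    ... | α , s , ps , e = IsSub.comb Q′-sub α e ∈′ (code-det (t ∘ suc) j′ Q-sub Q′-sub c c′ s ps (IsSub.uncomb′ Q-sub α e ∈ qx))
    code-det {suc m} t j {Q} {Q′} Q-sub Q′-sub (∉ , c) (_ , c′) x p qx | inj₁ a = go (span-least P-sub (λ { zero → P0 ; (suc i) → Ps i }) x p)
      where
      P : Vect → Set
      P y = ∃ λ β → Q (y -ᵥ β · t zero) × Q′ (y -ᵥ β · t zero)
      P-sub : IsSub P
      P-sub = record
        { resp = λ e (β , u , v) → β , IsSub.resp Q-sub (λ i → +-congʳ (e i)) u , IsSub.resp Q′-sub (λ i → +-congʳ (e i)) v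
        ; nil = 0# , IsSub.resp Q-sub (λ i → solve 1 (λ v → con (+ 0) := con (+ 0) :- con (+ 0) :* v) refl (t zero i)) (IsSub.nil Q-sub)
                   , IsSub.resp Q′-sub (λ i → solve 1 (λ v → con (+ 0) := con (+ 0) :- con (+ 0) :* v) refl (t zero i)) (IsSub.nil Q′-sub)
        ; add = λ {y} {z} (β , u , v) (γ , u′ , v′) → β + γ , IsSub.resp Q-sub (add-eq y z β γ) (IsSub.add Q-sub u u′) , IsSub.resp Q′-sub (add-eq y z β γ) (IsSub.add Q′-sub v v′)
        ; scale = λ α {y} (β , u , v) → α * β , IsSub.resp Q-sub (scale-eq α y β) (IsSub.scale Q-sub α u) , IsSub.resp Q′-sub (scale-eq α y β) (IsSub.scale Q′-sub α v) }
        where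
        add-eq : ∀ (y z : Vect) β γ i → (y i + - (β * t zero i)) + (z i + - (γ * t zero i)) ≈ (y i + z i) + - ((β + γ) * t zero i)
        add-eq y z β γ i = solve 5 (λ y z b c v → (y :- b :* v) :+ (z :- c :* v) := (y :+ z) :- (b :+ c) :* v) refl _ _ _ _ _
        scale-eq : ∀ α (y : Vect) β i → α * (y i + - (β * t zero i)) ≈ α * y i + - (α * β * t zero i)
        scale-eq α y β i = solve 4 (λ a y b v → a :* (y :- b :* v) := a :* y :- a :* b :* v) refl _ _ _ _
      P0 : P (t zero)
      P0 = 1# , IsSub.resp Q-sub (λ i → solve 1 (λ v → con (+ 0) := v :- con (+ 1) :* v) refl (t zero i)) (IsSub.nil Q-sub)
              , IsSub.resp Q′-sub (λ i → solve 1 (λ v → con (+ 0) := v :- con (+ 1) :* v) refl (t zero i)) (IsSub.nil Q′-sub)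
      Ps : ∀ i → P (t (suc i))
      Ps i = scalars m a i , c i , c′ i
      go : P x → Q′ x
      go (β , u , v) with β ≟ 0#
      ... | yes β≈0 = IsSub.resp Q′-sub (λ i → trans (+-congˡ (-‿cong (*-congʳ β≈0))) (solve 2 (λ x v → x :- con (+ 0) :* v := x) refl _ _)) v
      ... | no β≉0 = ⊥-elim (∉ (IsSub.uncomb Q-sub {β} {t zero} {0ᵥ} {x -ᵥ (x -ᵥ β · t zero)} β≉0
                (λ i → solve 3 (λ x b v → x :- (x :- b :* v) := b :* v :+ con (+ 0)) refl _ _ _) (IsSub.sub Q-sub qx u) (IsSub.nil Q-sub)))

  opaque
    shear : ∀ {m} (x : Vect) (vs : Fam m) (c : Fin m → Carrier) → Ind (x ∷ vs) → Ind (x ∷ (λ i → vs i -ᵥ c i · x))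
    shear {0ⁿ} x vs c (x∉ , _) = (λ { ⟪ _ , e ⟫ → x∉ ⟪ (λ ()) , e ⟫ }) , tt
    shear {suc m} x vs c (x∉ , v∉ , ind-vs) = x∉′ , v∉′ , proj₂ ih
      where
      ws : Fam (suc m)
      ws i = vs i -ᵥ c i · x
      ih : Ind (x ∷ (ws ∘ suc))
      ih = shear x (vs ∘ suc) (c ∘ suc) ((λ p → x∉ (tail-∈ p)) , ind-vs)
      lift : ∀ {y} → y ∈Span (ws ∘ suc) → y ∈Span (x ∷ (vs ∘ suc))
      lift {y} = span-least (span-sub (x ∷ (vs ∘ suc))) (λ i → IsSub.sub (span-sub (x ∷ (vs ∘ suc))) (gen-∈ (x ∷ (vs ∘ suc)) (suc i)) (IsSub.scale (span-sub (x ∷ (vs ∘ suc))) _ (head-∈ (x ∷ (vs ∘ suc))))) y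
      bad : ¬ (vs zero ∈Span (x ∷ (vs ∘ suc)))
      bad p with uncons-∈ {vs = x ∷ (vs ∘ suc)} p
      ... | α , s , ps , e with α ≟ 0#
      ...   | yes α≈0 = v∉ (IsSub.resp (span-sub (vs ∘ suc)) {s} (λ i → sym (trans (e i) (trans (+-congʳ (trans (*-congʳ α≈0) (zeroˡ _))) (+-identityˡ _)))) ps)
      ...   | no α≉0 = x∉ (IsSub.uncomb (span-sub vs) α≉0 e (head-∈ vs) (tail-∈ {vs = vs} ps))
      v∉′ : ¬ (ws zero ∈Span (ws ∘ suc))
      v∉′ p = bad (IsSub.resp (span-sub (x ∷ (vs ∘ suc))) {ws zero +ᵥ c zero · x} (λ i → solve 3 (λ v c x → (v :- c :* x) :+ c :* x := v) refl _ _ _)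
        (IsSub.add (span-sub (x ∷ (vs ∘ suc))) (lift p) (IsSub.scale (span-sub (x ∷ (vs ∘ suc))) (c zero) (head-∈ (x ∷ (vs ∘ suc))))))
      x∉′ : ¬ (x ∈Span ws)
      x∉′ p with uncons-∈ {vs = ws} p
      ... | α , s , ps , e with α ≟ 0#
      ...   | yes α≈0 = proj₁ ih (IsSub.resp (span-sub (ws ∘ suc)) {s} (λ i → sym (trans (e i) (trans (+-congʳ (trans (*-congʳ α≈0) (zeroˡ _))) (+-identityˡ _)))) ps)
      ...   | no α≉0 = bad (IsSub.resp (span-sub (x ∷ (vs ∘ suc))) {ws zero +ᵥ c zero · x} (λ i → solve 3 (λ v c x → (v :- c :* x) :+ c :* x := v) refl _ _ _)
              (IsSub.add (span-sub (x ∷ (vs ∘ suc))) (IsSub.uncomb (span-sub (x ∷ (vs ∘ suc))) α≉0 e (head-∈ (x ∷ (vs ∘ suc))) (lift ps)) (IsSub.scale (span-sub (x ∷ (vs ∘ suc))) (c zero) (head-∈ (x ∷ (vs ∘ suc))))))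

  hyp : ∀ {m} (t : Fam (suc m)) (c : Fin m → Carrier) → Fam m
  hyp t c i = t (suc i) -ᵥ c i · t zero

  -- As `c` varies, these are the q^m hyperplanes of T that miss its first basis vector.
  hypSp : ∀ {m} (T : Sp (suc m)) (c : Fin m → Carrier) → Sp m
  hypSp T c = sp (hyp (fam T) c) (proj₂ (shear (fam T zero) (fam T ∘ suc) c (ind T)))

  opaque
    hypSp-⊆ : ∀ {m} (T : Sp (suc m)) c → hypSp T c ⊆ T
    hypSp-⊆ T c = incl (least (hypSp T c) (isSub T) (λ i → IsSub.sub (isSub T) (gen T (suc i)) (IsSub.scale (isSub T) (c i) (gen T zero))))

  opaque
    hypSp-∉ : ∀ {m} (T : Sp (suc m)) c → fam T zero ∉ₛ hypSp T c
    hypSp-∉ T c p = proj₁ (shear (fam T zero) (fam T ∘ suc) c (ind T)) (un p)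

  tailSp : ∀ {m} → Sp (suc m) → Sp m
  tailSp T = sp (fam T ∘ suc) (proj₂ (ind T))

  opaque
    tailSp-⊆ : ∀ {m} {T : Sp (suc m)} → tailSp T ⊆ T
    tailSp-⊆ {T = T} = incl λ p → ⟨ tail-∈ {vs = fam T} (un p) ⟩

    head-∉ : ∀ {m} (T : Sp (suc m)) → fam T zero ∉ₛ tailSp T
    head-∉ T p = proj₁ (ind T) (un p)

  opaque
    hyper : ∀ {m} (T : Sp (suc m)) (j : Fin (N (suc m))) → Σ (Sp m) λ W → (W ⊆ T) × Code (fam T) j (_∈ₛ W)
    hyper {m} T j with split m j
    ... | inj₁ c = hypSp T (scalars m c) , hypSp-⊆ T (scalars m c) , hypSp-∉ T (scalars m c) , gen (hypSp T (scalars m c))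
    hyper {0ⁿ} T j | inj₂ ()
    hyper {suc m} T j | inj₂ j′ with hyper (tailSp T) j′
    ... | W , W⊆ , c = ext W (fam T zero) t∉ , ext-least (⊆-trans W⊆ tailSp-⊆) (gen T zero) , ext-∈ ,
          code-cong (fam T ∘ suc) j′ (λ x _ p → ext-⊆ ! p) back c
      where
      t∉ : fam T zero ∉ₛ W
      t∉ p = head-∉ T (W⊆ ! p)
      back : ∀ x → x ∈Span (fam T ∘ suc) → x ∈ₛ ext W (fam T zero) t∉ → x ∈ₛ W
      back x p x∈ with ext-inv x∈
      ... | α , s , s∈ , e with α ≟ 0#
      ...   | yes α≈0 = IsSub.resp (isSub W) {s} (λ i → sym (trans (e i) (trans (+-congʳ (trans (*-congʳ α≈0) (zeroˡ _))) (+-identityˡ _)))) s∈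
      ...   | no α≉0 = ⊥-elim (head-∉ T (IsSub.uncomb (isSub (tailSp T)) α≉0 e ⟨ p ⟩ (W⊆ ! s∈)))

  opaque
    top-code : ∀ {m} (T : Sp (suc m)) (W : Sp m) → W ⊆ T → ∃ λ j → Code (fam T) j (_∈ₛ W)
    top-code T W W⊆T = code-exists (fam T) (λ x → x ∈? W) H (isSub W) (λ g → ℕₚ.<⇒≱ ℕₚ.≤-refl (⊆-dim {S = T} {W} (incl (least T (isSub W) g))))
      where
      H : ∀ a b → a ∈Span fam T → b ∈Span fam T → a ∉ₛ W → ∃ λ α → (b -ᵥ α · a) ∈ₛ W
      H a b pa pb a∉ with hyper-inv W⊆T ⟨ pa ⟩ a∉ ⟨ pb ⟩
      ... | α , s , s∈ , e = α , IsSub.resp (isSub W) {s} (λ i → trans (solve 2 (λ a s → s := (a :+ s) :- a) refl _ _) (+-congʳ (sym (e i)))) s∈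

  opaque
    top-count : ∀ {m} (T : Sp (suc m)) (h : Fin (suc (N (suc m))) → Sp m) → (∀ i → h i ⊆ T) → ∃ λ i → ∃ λ j → ¬ i ≡ j × h i ≐ h j
    top-count {m} T h h⊆T with Fₚ.pigeonhole (ℕₚ.n<1+n (N (suc m))) (λ i → proj₁ (top-code T (h i) (h⊆T i)))
    ... | i , j , i<j , e = i , j , Fₚ.<⇒≢ i<j , ⊆⇒≐ (incl (λ {x} p → code-det (fam T) (proj₁ (top-code T (h i) (h⊆T i))) (isSub (h i)) (isSub (h j))
            (proj₂ (top-code T (h i) (h⊆T i))) (≡.subst (λ z → Code (fam T) z (_∈ₛ h j)) (≡.sym e) (proj₂ (top-code T (h j) (h⊆T j)))) x (un (h⊆T i ! p)) p))

  top : ∀ {m} (T : Sp (suc m)) → Fin (N (suc m)) → Sp m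
  top T j = proj₁ (hyper T j)

  opaque
    top-inj : ∀ {m} (T : Sp (suc m)) i j → top T i ≐ top T j → i ≡ j
    top-inj T i j e = code-unique (fam T) i j (isSub (top T i)) (proj₂ (proj₂ (hyper T i)))
      (code-cong (fam T) j (λ x _ p → bwd e ! p) (λ x _ p → fwd e ! p) (proj₂ (proj₂ (hyper T j))))

  -- The Grassmann graph: adjacency, cliques, pencils

  k+1<n : 3 ℕ.+ k₂ < n
  k+1<n = ≡.subst (3 ℕ.+ k₂ <_) n≡ (ℕₚ.≤-trans (ℕₚ.≤-reflexive (≡.cong (3 ℕ.+_) (≡.sym (ℕₚ.+-comm k₂ 1)))) (s≤s (s≤s (s≤s (≡.subst (_≤ d₂ ℕ.+ suc k₂) (ℕₚ.+-comm 1 k₂) (ℕₚ.m≤n+m (suc k₂) d₂))))))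

  -- Dimensions k - 2, k - 1, k, k + 1, where k = k₂ + 2 and n - k = d₂ + 2, so that 1 < k < n - 1
  -- is built in. A star has N (d₂ + 3) vertices and a top N (k₂ + 3); they are equally large if n =
  -- 2k.
  Pre Edge Vtx Cap : Set
  Pre = Sp k₂
  Edge = Sp (suc k₂)
  Vtx = Sp (suc (suc k₂))
  Cap = Sp (suc (suc (suc k₂)))

  infix 4 _~_
  record _~_ (U W : Vtx) : Set where
    constructor adj
    field
      core : Edge
      core-l : core ⊆ U
      core-r : core ⊆ W
      differ : U ⊈ W
  open _~_ public

  opaque
    ~-sym : ∀ {U W} → U ~ W → W ~ U
    ~-sym (adj S a b c) = adj S b a (λ h → c (eqdim h))

    ~⇒≭ : ∀ {U W} → U ~ W → ¬ U ≐ W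
    ~⇒≭ a e = differ a (fwd e)

    ~-resp : ∀ {U U′ W W′} → U ≐ U′ → W ≐ W′ → U ~ W → U′ ~ W′
    ~-resp e e′ (adj S a b c) = adj S (⊆-trans a (fwd e)) (⊆-trans b (fwd e′)) (λ h → c (⊆-trans (fwd e) (⊆-trans h (bwd e′))))

    star-adj : ∀ {S : Edge} {U W} → S ⊆ U → S ⊆ W → ¬ U ≐ W → U ~ W
    star-adj {S} a b c = adj S a b (λ h → c (⊆⇒≐ h))

    top-adj : ∀ {T : Cap} {U W} → U ⊆ T → W ⊆ T → ¬ U ≐ W → U ~ W
    top-adj {T} {U} {W} a b c with meet {T = T} b a (λ h → c (⊆⇒≐ h))
    ... | S , s , t = adj S t s (λ h → c (⊆⇒≐ h))

  opaque
    edges-span : ∀ {S S′ : Edge} {U W : Vtx} → S′ ⊈ S → S ⊆ U → S′ ⊆ U → S ⊆ W → S′ ⊆ W → U ≐ W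
    edges-span S′⊈S a b c d with ⊈-witness S′⊈S
    ... | x , x∈ , x∉ = ⊆⇒≐ (⊆-trans (ext-hyper {x∉ = x∉} a (b ! x∈)) (ext-least c (d ! x∈)))

    caps-meet : ∀ {U W : Vtx} {T T′ : Cap} → W ⊈ U → U ⊆ T → W ⊆ T → U ⊆ T′ → W ⊆ T′ → T ≐ T′
    caps-meet W⊈U a b c d with ⊈-witness W⊈U
    ... | x , x∈ , x∉ = ⊆⇒≐ (⊆-trans (ext-hyper {x∉ = x∉} a (b ! x∈)) (ext-least c (d ! x∈)))

  opaque
    span-of : ∀ {U W} → U ~ W → Σ Cap λ T → (U ⊆ T) × (W ⊆ T)
    span-of {U} {W} (adj S a b c) with ⊈-witness {S = W} {U} (λ h → c (eqdim h))
    ... | w , w∈ , w∉ = ext U w w∉ , ext-⊆ , ⊆-trans (ext-hyper {x∉ = λ p → w∉ (a ! p)} b w∈) (ext-least (⊆-trans a ext-⊆) ext-∈)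

  opaque
    -- If the edges that Z shares with U and with W differ, they span Z inside U + W; if they are
    -- equal, the common edge is U ∩ W.
    clique⋆ : ∀ {U W Z : Vtx} {S : Edge} {T : Cap} → U ~ W → U ~ Z → W ~ Z → S ⊆ U → S ⊆ W → U ⊆ T → W ⊆ T → (S ⊆ Z) ⊎ (Z ⊆ T)
    clique⋆ {U} {W} {Z} {S} {T} UW (adj S₁ a b _) (adj S₂ a′ b′ _) s s′ t t′ with S₂ ⊆? S₁
    ... | no S₂⊈S₁ with ⊈-witness S₂⊈S₁
    ...   | x , x∈ , x∉ = inj₂ (⊆-trans (ext-hyper {x∉ = x∉} b (b′ ! x∈)) (ext-least (⊆-trans a t) (t′ ! (a′ ! x∈))))
    clique⋆ {U} {W} {Z} {S} {T} UW (adj S₁ a b _) (adj S₂ a′ b′ _) s s′ t t′ | yes S₂⊆S₁ with S ⊆? S₁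
    ... | yes S⊆S₁ = inj₁ (⊆-trans S⊆S₁ b)
    ... | no S⊈S₁ = ⊥-elim (~⇒≭ UW (edges-span S⊈S₁ a s (⊆-trans (eqdim S₂⊆S₁) a′) s′))

  -- The q + 1 points of the projective line T/S: the point of a, and those of b + αa for the q
  -- scalars α.
  module Pencil (S : Edge) (T : Cap) (S⊆T : S ⊆ T) where
    opaque
      a : Vect
      a = proj₁ (outside (ℕₚ.m<n⇒m<1+n ℕₚ.≤-refl) S T)
      a∈ : a ∈ₛ T
      a∈ = proj₁ (proj₂ (outside (ℕₚ.m<n⇒m<1+n ℕₚ.≤-refl) S T))
      a∉ : a ∉ₛ S
      a∉ = proj₂ (proj₂ (outside (ℕₚ.m<n⇒m<1+n ℕₚ.≤-refl) S T))

    U₀ : Vtx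
    U₀ = ext S a a∉

    opaque
      b : Vect
      b = proj₁ (outside ℕₚ.≤-refl U₀ T)
      b∈ : b ∈ₛ T
      b∈ = proj₁ (proj₂ (outside ℕₚ.≤-refl U₀ T))
      b∉ : b ∉ₛ U₀
      b∉ = proj₂ (proj₂ (outside ℕₚ.≤-refl U₀ T))

    dir : Fin (suc q) → Vect
    dir zero = a
    dir (suc i) = b +ᵥ enum i · a

    opaque
      dir-∈ : ∀ i → dir i ∈ₛ T
      dir-∈ zero = a∈
      dir-∈ (suc i) = IsSub.add (isSub T) b∈ (IsSub.scale (isSub T) (enum i) a∈)

      dir-∉ : ∀ i → dir i ∉ₛ S
      dir-∉ zero = a∉
      dir-∉ (suc i) p = b∉ (IsSub.resp (isSub U₀) {(b +ᵥ enum i · a) -ᵥ enum i · a} (λ j → solve 2 (λ x y → (x :+ y) :- y := x) refl _ _)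
        (IsSub.sub (isSub U₀) (ext-⊆ ! p) (IsSub.scale (isSub U₀) (enum i) ext-∈)))

      not-both : (U : Vtx) → S ⊆ U → U ⊆ T → a ∈ₛ U → b ∉ₛ U
      not-both U s t p p′ = b∉ (ext-hyper s p ! p′)

      dir-uniq : (U : Vtx) → S ⊆ U → U ⊆ T → ∀ i j → dir i ∈ₛ U → dir j ∈ₛ U → i ≡ j
      dir-uniq U s t zero zero p p′ = ≡.refl
      dir-uniq U s t zero (suc j) p p′ = ⊥-elim (not-both U s t p (IsSub.resp (isSub U) {(b +ᵥ enum j · a) -ᵥ enum j · a} (λ j → solve 2 (λ x y → (x :+ y) :- y := x) refl _ _)
        (IsSub.sub (isSub U) p′ (IsSub.scale (isSub U) (enum j) p))))
      dir-uniq U s t (suc i) zero p p′ = ⊥-elim (not-both U s t p′ (IsSub.resp (isSub U) {(b +ᵥ enum i · a) -ᵥ enum i · a} (λ j → solve 2 (λ x y → (x :+ y) :- y := x) refl _ _)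
        (IsSub.sub (isSub U) p (IsSub.scale (isSub U) (enum i) p′))))
      dir-uniq U s t (suc i) (suc j) p p′ with enum i ≟ enum j
      ... | yes e = ≡.cong suc (enum-injective i j e)
      ... | no ne = ⊥-elim (not-both U s t a∈U (IsSub.resp (isSub U) {(b +ᵥ enum i · a) -ᵥ enum i · a} (λ j → solve 2 (λ x y → (x :+ y) :- y := x) refl _ _)
              (IsSub.sub (isSub U) p (IsSub.scale (isSub U) (enum i) a∈U))))
        where
        a∈U : a ∈ₛ U
        a∈U = IsSub.uncomb (isSub U) {enum i + - enum j} {a} {0ᵥ} {(b +ᵥ enum i · a) -ᵥ (b +ᵥ enum j · a)} (λ z → ne (x-y≈0⇒x≈y z))
          (λ l → solve 4 (λ b x y a → (b :+ x :* a) :- (b :+ y :* a) := (x :- y) :* a :+ con (+ 0)) refl _ _ _ _) (IsSub.sub (isSub U) p p′) (IsSub.nil (isSub U))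

    pen : Fin (suc q) → Vtx
    pen i = ext S (dir i) (dir-∉ i)

    opaque
      pen-⊆ : ∀ i → pen i ⊆ T
      pen-⊆ i = ext-least S⊆T (dir-∈ i)

      pen-inj : ∀ i j → pen i ≐ pen j → i ≡ j
      pen-inj i j e = dir-uniq (pen i) ext-⊆ (pen-⊆ i) i j ext-∈ (bwd e ! ext-∈)

      pen-code : (U : Vtx) → S ⊆ U → U ⊆ T → ∃ λ i → dir i ∈ₛ U
      pen-code U s t with a ∈? U
      ... | yes p = zero , p
      ... | no a∉U with hyper-inv t a∈ a∉U b∈
      ...   | α , u , u∈ , e with enum-surjective (- α)
      ...     | i , ei = suc i , IsSub.resp (isSub U) {u} (λ l → trans (solve 3 (λ α a u → u := (α :* a :+ u) :+ :- α :* a) refl α (a l) (u l))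
                            (+-cong (sym (e l)) (*-congʳ (sym ei)))) u∈

    opaque
      pencil : (h : Fin (suc (suc q)) → Vtx) → (∀ i → S ⊆ h i) → (∀ i → h i ⊆ T) → ∃ λ i → ∃ λ j → ¬ i ≡ j × h i ≐ h j
      pencil h s t with Fₚ.pigeonhole (ℕₚ.n<1+n (suc q)) (λ i → proj₁ (pen-code (h i) (s i) (t i)))
      ... | i , j , i<j , e = i , j , Fₚ.<⇒≢ i<j , ⊆⇒≐ (⊆-trans (ext-hyper {x∉ = dir-∉ (proj₁ (pen-code (h i) (s i) (t i)))} (s i) (proj₂ (pen-code (h i) (s i) (t i))))
              (ext-least (s j) (≡.subst (λ z → dir z ∈ₛ h j) (≡.sym e) (proj₂ (pen-code (h j) (s j) (t j))))))

  -- Stars and tops as abstract systems of blocks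

  Collide : ∀ {m} → (Fin m → Vtx) → Set
  Collide h = ∃ λ i → ∃ λ j → ¬ i ≡ j × h i ≐ h j

  -- A list of statements that stars and tops satisfy, from which the extension argument proceeds
  -- whichever kind is called A. `A∩B` bounds the intersection of two blocks by the size of a
  -- pencil, and `cross` finds a common vertex of two A-blocks and two B-blocks each meeting each.
  record Geo : Set₁ where
    infix 4 _∈A_ _∈B_
    field
      A B : Set
      _∈A_ : Vtx → A → Set
      _∈B_ : Vtx → B → Set
      A-resp : ∀ {U W a} → U ≐ W → U ∈A a → W ∈A a
      B-resp : ∀ {U W b} → U ≐ W → U ∈B b → W ∈B b
      A? : ∀ U a → Dec (U ∈A a)
      B? : ∀ U b → Dec (U ∈B b)
      A-adj : ∀ {U W a} → U ∈A a → W ∈A a → ¬ U ≐ W → U ~ W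
      B-adj : ∀ {U W b} → U ∈B b → W ∈B b → ¬ U ≐ W → U ~ W
      A-join : ∀ {U W} → U ~ W → ∃ λ a → U ∈A a × W ∈A a
      B-join : ∀ {U W} → U ~ W → ∃ λ b → U ∈B b × W ∈B b
      A-uniq : ∀ {U W a a′} → U ~ W → U ∈A a → W ∈A a → U ∈A a′ → W ∈A a′ → ∀ {Z} → Z ∈A a → Z ∈A a′
      B-uniq : ∀ {U W b b′} → U ~ W → U ∈B b → W ∈B b → U ∈B b′ → W ∈B b′ → ∀ {Z} → Z ∈B b → Z ∈B b′
      clique : ∀ {U W Z a b} → U ~ W → U ~ Z → W ~ Z → U ∈A a → W ∈A a → U ∈B b → W ∈B b → (Z ∈A a) ⊎ (Z ∈B b)
      A∩B : ∀ {a b} (h : Fin (suc (suc q)) → Vtx) → (∀ i → h i ∈A a) → (∀ i → h i ∈B b) → Collide h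
      another : ∀ {v a b} → v ∈A a → v ∈B b → ∃ λ w → w ∈A a × w ∈B b × v ~ w
      cross : ∀ {a₁ a₂ b₁ b₂} → ¬ (∀ {Z} → Z ∈A a₁ → Z ∈A a₂) → ¬ (∀ {Z} → Z ∈B b₁ → Z ∈B b₂) →
        (∃ λ v → v ∈A a₁ × v ∈B b₁) → (∃ λ v → v ∈A a₁ × v ∈B b₂) → (∃ λ v → v ∈A a₂ × v ∈B b₁) → (∃ λ v → v ∈A a₂ × v ∈B b₂) →
        ∃ λ v → v ∈A a₁ × v ∈A a₂ × v ∈B b₁ × v ∈B b₂
      A-count : ∀ {a} (h : Fin (suc (N (suc (suc (suc d₂))))) → Vtx) → (∀ i → h i ∈A a) → Collide h
      B-count : ∀ {b} (h : Fin (suc (N (suc (suc (suc k₂))))) → Vtx) → (∀ i → h i ∈B b) → Collide h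

  opaque
    another⋆ : ∀ {v : Vtx} {S : Edge} {T : Cap} → S ⊆ v → v ⊆ T → ∃ λ w → (S ⊆ w) × (w ⊆ T) × v ~ w
    another⋆ {v} {S} {T} s t with outside ℕₚ.≤-refl v T
    ... | x , x∈ , x∉ = ext S x (λ p → x∉ (s ! p)) , ext-⊆ , ext-least (⊆-trans s t) x∈ , adj S s ext-⊆ (λ h → x∉ (eqdim h ! ext-∈))

    -- S₁ and one vector of S₂ span a vertex v in T₁ and in T₂. A vector x of S₂ outside v would
    -- give T₁ = v + ⟨x⟩ = T₂, so v contains S₂ as well.
    cross⋆ : ∀ {S₁ S₂ : Edge} {T₁ T₂ : Cap} → ¬ S₁ ≐ S₂ → ¬ T₁ ≐ T₂ → S₁ ⊆ T₁ → S₁ ⊆ T₂ → S₂ ⊆ T₁ → S₂ ⊆ T₂ →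
      Σ Vtx λ v → (S₁ ⊆ v) × (S₂ ⊆ v) × (v ⊆ T₁) × (v ⊆ T₂)
    cross⋆ {S₁} {S₂} {T₁} {T₂} S≭ T≭ a b c d with ⊈-witness {S = S₂} {S₁} (λ h → S≭ (≐-sym (⊆⇒≐ h)))
    ... | s , s∈ , s∉ = v , ext-⊆ , S₂⊆v , v⊆T₁ , v⊆T₂
      where
      v : Vtx
      v = ext S₁ s s∉
      v⊆T₁ : v ⊆ T₁
      v⊆T₁ = ext-least a (c ! s∈)
      v⊆T₂ : v ⊆ T₂
      v⊆T₂ = ext-least b (d ! s∈)
      in-v : ∀ {x} → x ∈ₛ S₂ → x ∈ₛ v
      in-v {x} x∈ = decidable-stable (x ∈? v) (λ x∉ → T≭ (⊆⇒≐ (⊆-trans (ext-hyper {x∉ = x∉} v⊆T₁ (c ! x∈)) (ext-least v⊆T₂ (d ! x∈)))))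
      S₂⊆v : S₂ ⊆ v
      S₂⊆v = incl in-v

  star-top : Geo
  star-top = record
    { A = Edge ; B = Cap ; _∈A_ = λ U S → S ⊆ U ; _∈B_ = λ U T → U ⊆ T
    ; A-resp = λ e h → ⊆-trans h (fwd e)
    ; B-resp = λ e h → ⊆-trans (bwd e) h
    ; A? = λ U S → S ⊆? U
    ; B? = λ U T → U ⊆? T
    ; A-adj = star-adj
    ; B-adj = top-adj
    ; A-join = λ a → core a , core-l a , core-r a
    ; B-join = span-of
    ; A-uniq = λ {U} {W} {S} {S′} a s t s′ t′ h → ⊆-trans (same a s t s′ t′) h
    ; B-uniq = λ a s t s′ t′ h → ⊆-trans h (fwd (caps-meet (λ g → differ a (eqdim g)) s t s′ t′))
    ; clique = clique⋆
    ; A∩B = λ {S} {T} h s t → Pencil.pencil S T (⊆-trans (s zero) (t zero)) h s t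
    ; another = another⋆
    ; cross = λ a≢ b≢ (v , p , p′) (w , r , r′) (x , s , s′) (y , t , t′) →
        cross⋆ (λ e → a≢ (λ h → ⊆-trans (bwd e) h)) (λ e → b≢ (λ h → ⊆-trans h (fwd e))) (⊆-trans p p′) (⊆-trans r r′) (⊆-trans s s′) (⊆-trans t t′)
    ; A-count = λ {S} → StarCode.star-count {suc k₂} {suc (suc (suc d₂))} S n≡
    ; B-count = λ {T} → top-count T }
    where
    same : ∀ {U W : Vtx} {S S′ : Edge} → U ~ W → S ⊆ U → S ⊆ W → S′ ⊆ U → S′ ⊆ W → S′ ⊆ S
    same {S = S} {S′} a s t s′ t′ = decidable-stable (S′ ⊆? S) (λ h → ~⇒≭ a (edges-span h s s′ t t′))

  -- For n = 2k, f may interchange stars and tops.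
  top-star : d₂ ≡ k₂ → Geo
  top-star e = record
    { A = B ; B = A ; _∈A_ = _∈B_ ; _∈B_ = _∈A_ ; A-resp = B-resp ; B-resp = A-resp ; A? = B? ; B? = A?
    ; A-adj = B-adj ; B-adj = A-adj ; A-join = B-join ; B-join = A-join ; A-uniq = B-uniq ; B-uniq = A-uniq
    ; clique = λ a b c p p′ r r′ → Sum.swap (clique a b c r r′ p p′)
    ; A∩B = λ h s t → A∩B h t s
    ; another = λ p p′ → let w , r , r′ , a = another p′ p in w , r′ , r , a
    ; cross = λ a≢ b≢ (v , p , p′) (w , r , r′) (x , s , s′) (y , t , t′) →
        let z , h₁ , h₂ , h₃ , h₄ = cross b≢ a≢ (v , p′ , p) (x , s′ , s) (w , r′ , r) (y , t′ , t) in z , h₃ , h₄ , h₁ , h₂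
    ; A-count = λ {T} → ≡.subst (λ z → (h : Fin (suc (N (suc (suc (suc z))))) → Vtx) → (∀ i → h i ⊆ T) → Collide h) (≡.sym e) B-count
    ; B-count = λ {S} → ≡.subst (λ z → (h : Fin (suc (N (suc (suc (suc z))))) → Vtx) → (∀ i → S ⊆ h i) → Collide h) e A-count }
    where
    open Geo star-top

  -- Non-degeneracy, and the invariant of the extension

  Hits : ∀ {m} → Fin n → Sp m → Set
  Hits j S = ∃ λ x → x ∈ₛ S × ¬ x j ≈ 0#

  -- Relative to a list of coordinate hyperplanes: the full list gives the codes, the empty list
  -- admits every subspace, and the binary extension shortens the list one entry at a time.
  ND : ∀ {m} → List (Fin n) → Sp m → Set
  ND J S = All (λ j → Hits j S) J

  coord-sub : ∀ j → IsSub (λ x → x j ≈ 0#)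
  coord-sub j = record
    { resp = λ e p → trans (sym (e j)) p
    ; nil = refl
    ; add = λ p p′ → trans (+-cong p p′) (+-identityˡ 0#)
    ; scale = λ α p → trans (*-congˡ p) (zeroʳ α) }

  opaque
    Hits? : ∀ {m} j (S : Sp m) → Dec (Hits j S)
    Hits? j S = map′ (λ (i , p) → fam S i , gen S i , p)
      (λ (x , x∈ , x≉) → decidable-stable (Fₚ.any? (λ i → ¬? (fam S i j ≟ 0#)))
        (λ h → x≉ (least S (coord-sub j) (λ i → decidable-stable (fam S i j ≟ 0#) (λ p → h (i , p))) x∈)))
      (Fₚ.any? (λ i → ¬? (fam S i j ≟ 0#)))

    ND? : ∀ {m} J (S : Sp m) → Dec (ND J S)
    ND? J S = All.all? (λ j → Hits? j S) J

    ¬Hits : ∀ {m j} {S : Sp m} → ¬ Hits j S → ∀ {x} → x ∈ₛ S → x j ≈ 0#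
    ¬Hits {j = j} h {x} x∈ = decidable-stable (x j ≟ 0#) (λ p → h (x , x∈ , p))

    Hits-mono : ∀ {m p j} {S : Sp m} {U : Sp p} → S ⊆ U → Hits j S → Hits j U
    Hits-mono h (x , x∈ , x≉) = x , h ! x∈ , x≉

    ND-mono : ∀ {m p J} {S : Sp m} {U : Sp p} → S ⊆ U → ND J S → ND J U
    ND-mono h = All.map (Hits-mono h)

  opaque
    -- x and y are independent modulo U, so both their coefficients in z vanish.
    in-base : ∀ {m p} {S : Sp m} {U : Sp p} {x y z} {x∉S : x ∉ₛ S} {y∉S+x : y ∉ₛ ext S x x∉S} → S ⊆ U → (x∉ : x ∉ₛ U) → y ∉ₛ ext U x x∉ →
      z ∈ₛ ext (ext S x x∉S) y y∉S+x → z ∈ₛ U → z ∈ₛ S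
    in-base {S = S} {U} {x} {y} {z} S⊆U x∉ y∉ z∈ z∈U with ext-inv z∈
    ... | β , r , r∈ , e with β ≟ 0#
    ...   | no β≉0 = ⊥-elim (y∉ (IsSub.uncomb (isSub (ext U x x∉)) β≉0 e (ext-⊆ ! z∈U) (ext-least (⊆-trans S⊆U ext-⊆) ext-∈ ! r∈)))
    ...   | yes β≈0 with ext-inv r∈
    ...     | α , s , s∈ , e′ with α ≟ 0#
    ...       | no α≉0 = ⊥-elim (x∉ (IsSub.uncomb (isSub U) α≉0 (λ i → trans (trans (sym (+-identityˡ _)) (trans (+-congʳ (sym (trans (*-congʳ β≈0) (zeroˡ _)))) (sym (e i))) ) (trans (e i) (trans (+-congʳ (trans (*-congʳ β≈0) (zeroˡ _))) (trans (+-identityˡ _) (e′ i))))) (IsSub.resp (isSub U) (λ i → trans (e i) (trans (+-congʳ (trans (*-congʳ β≈0) (zeroˡ _))) (+-identityˡ _))) z∈U) (S⊆U ! s∈)))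
    ...       | yes α≈0 = IsSub.resp (isSub S) {s} (λ i → sym (trans (e i) (trans (+-congʳ (trans (*-congʳ β≈0) (zeroˡ _))) (trans (+-identityˡ _) (trans (e′ i) (trans (+-congʳ (trans (*-congʳ α≈0) (zeroˡ _))) (+-identityˡ _))))))) s∈

  record Embedding (J : List (Fin n)) (f : Vtx → Vtx) : Set where
    field
      resp : ∀ {U W} → ND J U → U ≐ W → f U ≐ f W
      hom : ∀ {U W} → ND J U → ND J W → U ~ W → f U ~ f W
      inj : ∀ {U W} → ND J U → ND J W → f U ≐ f W → U ≐ W

  module Maps (G : Geo) (J : List (Fin n)) (f : Vtx → Vtx) where
    open Geo G

    CovA : A → Edge → Set
    CovA a S = ∀ {U} → S ⊆ U → ND J U → f U ∈A a

    CovB : B → Cap → Set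
    CovB b T = ∀ {U} → U ⊆ T → ND J U → f U ∈B b

    -- What one extension step hands to the next. Since global injectivity is not yet known for a
    -- partial extension, `hom` supplies it inside stars and tops, and `sep` keeps the A-blocks of
    -- two edges of U₀ from having two common vertices.
    record Inv : Set where
      field
        resp : ∀ {U W} → ND J U → U ≐ W → f U ≐ f W
        hom : ∀ {U W} → ND J U → ND J W → U ~ W → f U ~ f W
        edgeA : ∀ {S : Edge} → ND J S → ∃ λ a → CovA a S
        sep : ∀ {S₁ S₂ : Edge} {U₀ : Vtx} {a₁ a₂} → ND J S₁ → ND J S₂ → S₁ ⊆ U₀ → S₂ ⊆ U₀ → S₂ ⊈ S₁ → CovA a₁ S₁ → CovA a₂ S₂ →
          ∀ {v w} → v ~ w → v ∈A a₁ → w ∈A a₁ → v ∈A a₂ → w ∈A a₂ → ⊥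

    module Core (inv : Inv) where
      open Inv inv public

      opaque
        f-top : ∀ {U W} {T : Cap} → U ⊆ T → W ⊆ T → ND J U → ND J W → f U ≐ f W → U ≐ W
        f-top {U} {W} a b c d e = decidable-stable (U ≐? W) (λ h → ~⇒≭ (hom c d (top-adj a b h)) e)

        f-star : ∀ {U W} {S : Edge} → S ⊆ U → S ⊆ W → ND J U → ND J W → f U ≐ f W → U ≐ W
        f-star {U} {W} a b c d e = decidable-stable (U ≐? W) (λ h → ~⇒≭ (hom c d (star-adj a b h)) e)

      opaque
        -- The q + 1 vertices between S and T inherit non-degeneracy from S and have distinct images
        -- in both blocks. If v were none of these images, there would be q + 2 vertices, more than
        -- `A∩B` allows.
        preimage : ∀ {S : Edge} {T : Cap} {a b v} → ND J S → S ⊆ T → CovA a S → CovB b T → v ∈A a → v ∈B b →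
          ∃ λ W → (S ⊆ W) × (W ⊆ T) × f W ≐ v
        preimage {S} {T} {a} {b} {v} nd S⊆T ca cb va vb with Fₚ.any? (λ i → f (Pencil.pen S T S⊆T i) ≐? v)
        ... | yes (i , e) = Pencil.pen S T S⊆T i , ext-⊆ , Pencil.pen-⊆ S T S⊆T i , e
        ... | no ∄ = ⊥-elim (go (A∩B {a} {b} h h∈a h∈b))
          where
          open Pencil S T S⊆T using (pen; pen-⊆; pen-inj)
          ndp : ∀ i → ND J (pen i)
          ndp i = ND-mono ext-⊆ nd
          h : Fin (suc (suc q)) → Vtx
          h zero = v
          h (suc i) = f (pen i)
          h∈a : ∀ i → h i ∈A a
          h∈a zero = va
          h∈a (suc i) = ca ext-⊆ (ndp i)
          h∈b : ∀ i → h i ∈B b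
          h∈b zero = vb
          h∈b (suc i) = cb (pen-⊆ i) (ndp i)
          go : Collide h → ⊥
          go (zero , zero , i≢j , e) = i≢j ≡.refl
          go (zero , suc j , i≢j , e) = ∄ (j , ≐-sym e)
          go (suc i , zero , i≢j , e) = ∄ (i , e)
          go (suc i , suc j , i≢j , e) = i≢j (≡.cong suc (pen-inj i j (f-star {S = S} ext-⊆ ext-⊆ (ndp i) (ndp j) e)))

      opaque
        -- A second common vertex would make b₁ and b₂ equal. A vertex over S in T₁ but not in T₂
        -- would then, by `preimage`, have the same image as a vertex over S in T₂, against
        -- injectivity on the star of S.
        caps-share : ∀ {S : Edge} {P : Vtx} {T₁ T₂ : Cap} {b₁ b₂ v} → ND J S → S ⊆ P → P ⊆ T₁ → P ⊆ T₂ → T₁ ⊈ T₂ →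
          CovB b₁ T₁ → CovB b₂ T₂ → v ∈B b₁ → v ∈B b₂ → v ≐ f P
        caps-share {S} {P} {T₁} {T₂} {b₁} {b₂} {v} nd S⊆P P⊆T₁ P⊆T₂ T₁⊈T₂ c₁ c₂ v₁ v₂ = decidable-stable (v ≐? f P) contra
          where
          ndP : ND J P
          ndP = ND-mono S⊆P nd
          contra : ¬ ¬ v ≐ f P
          contra v≭ with ⊈-witness T₁⊈T₂ | edgeA nd
          ... | t , t∈ , t∉ | a , ca = t∉ (proj₁ (proj₂ (proj₂ w)) ! (bwd same ! ext-∈))
            where
            t∉S : t ∉ₛ S
            t∉S p = t∉ (P⊆T₂ ! (S⊆P ! p))
            W : Vtx
            W = ext S t t∉S
            W⊆T₁ : W ⊆ T₁
            W⊆T₁ = ext-least (⊆-trans S⊆P P⊆T₁) t∈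
            ndW : ND J W
            ndW = ND-mono ext-⊆ nd
            fW∈b₂ : f W ∈B b₂
            fW∈b₂ = B-uniq (B-adj v₁ (c₁ P⊆T₁ ndP) v≭) v₁ (c₁ P⊆T₁ ndP) v₂ (c₂ P⊆T₂ ndP) (c₁ W⊆T₁ ndW)
            w : ∃ λ W′ → (S ⊆ W′) × (W′ ⊆ T₂) × f W′ ≐ f W
            w = preimage nd (⊆-trans S⊆P P⊆T₂) ca c₂ (ca ext-⊆ ndW) fW∈b₂
            same : proj₁ w ≐ W
            same = f-star {S = S} (proj₁ (proj₂ w)) ext-⊆ (ND-mono (proj₁ (proj₂ w)) nd) ndW (proj₂ (proj₂ (proj₂ w)))

      opaque
        -- U₀, S₁ + ⟨t⟩ and S₂ + ⟨t⟩ form a triangle in T. Because `sep` keeps the A-blocks of S₁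
        -- and S₂ apart, its image fixes a B-block that contains everything adjacent to all three.
        -- The last component, about an arbitrary v, later gives uniqueness of the extension.
        capB : ∀ {S₁ S₂ : Edge} {U₀ : Vtx} {T : Cap} → ND J S₁ → ND J S₂ → S₁ ⊆ U₀ → S₂ ⊆ U₀ → S₂ ⊈ S₁ → U₀ ⊆ T →
          ∃ λ b → CovB b T × (∀ v → (∀ P → P ⊆ T → ND J P → v ~ f P) → v ∈B b)
        capB {S₁} {S₂} {U₀} {T} nd₁ nd₂ s₁ s₂ S₂⊈S₁ U₀⊆T with outside ℕₚ.≤-refl U₀ T | edgeA nd₁ | edgeA nd₂
        ... | t , t∈ , t∉ | a₁ , c₁ | a₂ , c₂ = b , cov , strong
          where
          nd₀ : ND J U₀
          nd₀ = ND-mono s₁ nd₁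
          Q₁ Q₂ : Vtx
          Q₁ = ext S₁ t (λ p → t∉ (s₁ ! p))
          Q₂ = ext S₂ t (λ p → t∉ (s₂ ! p))
          q₁ : Q₁ ⊆ T
          q₁ = ext-least (⊆-trans s₁ U₀⊆T) t∈
          q₂ : Q₂ ⊆ T
          q₂ = ext-least (⊆-trans s₂ U₀⊆T) t∈
          ndq₁ : ND J Q₁
          ndq₁ = ND-mono ext-⊆ nd₁
          ndq₂ : ND J Q₂
          ndq₂ = ND-mono ext-⊆ nd₂
          0≭1 : ¬ U₀ ≐ Q₁
          0≭1 e = t∉ (bwd e ! ext-∈)
          0≭2 : ¬ U₀ ≐ Q₂
          0≭2 e = t∉ (bwd e ! ext-∈)
          1≭2 : ¬ Q₁ ≐ Q₂
          1≭2 e = t∉ (bwd (edges-span S₂⊈S₁ s₁ s₂ ext-⊆ (⊆-trans ext-⊆ (bwd e))) ! ext-∈)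
          0~1 : f U₀ ~ f Q₁
          0~1 = hom nd₀ ndq₁ (top-adj U₀⊆T q₁ 0≭1)
          0~2 : f U₀ ~ f Q₂
          0~2 = hom nd₀ ndq₂ (top-adj U₀⊆T q₂ 0≭2)
          1~2 : f Q₁ ~ f Q₂
          1~2 = hom ndq₁ ndq₂ (top-adj q₁ q₂ 1≭2)
          b : B
          b = proj₁ (B-join 0~1)
          b0 : f U₀ ∈B b
          b0 = proj₁ (proj₂ (B-join 0~1))
          b1 : f Q₁ ∈B b
          b1 = proj₂ (proj₂ (B-join 0~1))
          not-both : ∀ {v} → v ~ f U₀ → v ∈A a₁ → v ∈A a₂ → ⊥
          not-both v~ p p′ = sep nd₁ nd₂ s₁ s₂ S₂⊈S₁ c₁ c₂ v~ p (c₁ s₁ nd₀) p′ (c₂ s₂ nd₀)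
          b2 : f Q₂ ∈B b
          b2 with clique 0~1 0~2 1~2 (c₁ s₁ nd₀) (c₁ ext-⊆ ndq₁) b0 b1
          ... | inj₁ p = ⊥-elim (not-both (~-sym 0~2) p (c₂ ext-⊆ ndq₂))
          ... | inj₂ p = p
          three : ∀ {v} → v ~ f U₀ → v ~ f Q₁ → v ~ f Q₂ → v ∈B b
          three v0 v1 v2 with clique 0~1 (~-sym v0) (~-sym v1) (c₁ s₁ nd₀) (c₁ ext-⊆ ndq₁) b0 b1
          ... | inj₂ p = p
          ... | inj₁ p with clique 0~2 (~-sym v0) (~-sym v2) (c₂ s₂ nd₀) (c₂ ext-⊆ ndq₂) b0 b2
          ...   | inj₂ p′ = p′
          ...   | inj₁ p′ = ⊥-elim (not-both v0 p p′)
          cov : CovB b T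
          cov {U} U⊆T nd with U ≐? U₀ | U ≐? Q₁ | U ≐? Q₂
          ... | yes e | _ | _ = B-resp (≐-sym (resp nd e)) b0
          ... | no _ | yes e | _ = B-resp (≐-sym (resp nd e)) b1
          ... | no _ | no _ | yes e = B-resp (≐-sym (resp nd e)) b2
          ... | no x | no y | no z = three (hom nd nd₀ (top-adj U⊆T U₀⊆T x)) (hom nd ndq₁ (top-adj U⊆T q₁ y)) (hom nd ndq₂ (top-adj U⊆T q₂ z))
          strong : ∀ v → (∀ P → P ⊆ T → ND J P → v ~ f P) → v ∈B b
          strong v h = three (h U₀ U₀⊆T nd₀) (h Q₁ q₁ ndq₁) (h Q₂ q₂ ndq₂)

      opaque
        -- Being adjacent to f P and f P₁, the vertex v is in their A-block or in b₁; in the latter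
        -- case it is common to b₁ and b₂, hence equal to f P by `caps-share`.
        same-A : ∀ {S₀ : Edge} {P P₁ : Vtx} {T₁ T₂ : Cap} {b₁ b₂ a v} → ND J S₀ → S₀ ⊆ P → P ⊆ T₁ → P ⊆ T₂ → T₁ ⊈ T₂ →
          CovB b₁ T₁ → CovB b₂ T₂ → ND J P₁ → P₁ ⊆ T₁ → ¬ P ≐ P₁ → v ∈B b₂ → v ~ f P → v ~ f P₁ → f P ∈A a → f P₁ ∈A a → v ∈A a
        same-A nd s t₁ t₂ T≭ c₁ c₂ nd₁ p₁ P≭ vb vP vP₁ aP aP₁
          with clique (hom (ND-mono s nd) nd₁ (top-adj t₁ p₁ P≭)) (~-sym vP) (~-sym vP₁) aP aP₁ (c₁ t₁ (ND-mono s nd)) (c₁ p₁ nd₁)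
        ... | inj₁ p = p
        ... | inj₂ p = ⊥-elim (~⇒≭ vP (caps-share nd s t₁ t₂ T≭ c₁ c₂ p vb))

      -- Finds the vertex that should be the image of U. For i = 1, 2 let a_i be the A-block joining
      -- f(S_i + ⟨x⟩) and f(S_i + ⟨y⟩). These images show that each a_i meets `bx` and `by`, so
      -- `cross` yields a common vertex once a₁ ≠ a₂ and `bx` ≠ `by`.
      module Construct {U : Vtx} {X : Pre} {S₁ S₂ : Edge} {x y : Vect}
        (X⊆S₁ : X ⊆ S₁) (X⊆S₂ : X ⊆ S₂) (S₁⊆U : S₁ ⊆ U) (S₂⊆U : S₂ ⊆ U) (S₂⊈S₁ : S₂ ⊈ S₁)
        (x∉U : x ∉ₛ U) (y∉U+x : y ∉ₛ ext U x x∉U) (y∉U : y ∉ₛ U)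
        (x∉X : x ∉ₛ X) (y∉X : y ∉ₛ X) (ndx : ND J (ext X x x∉X)) (ndy : ND J (ext X y y∉X))
        {bx by : B} (covx : CovB bx (ext U x x∉U)) (covy : CovB by (ext U y y∉U)) where

        private
          module One (S : Edge) (X⊆S : X ⊆ S) (S⊆U : S ⊆ U) where
            x∉ : x ∉ₛ S
            x∉ p = x∉U (S⊆U ! p)
            y∉ : y ∉ₛ S
            y∉ p = y∉U (S⊆U ! p)
            Px Py : Vtx
            Px = ext S x x∉
            Py = ext S y y∉
            opaque
              y∉Px : y ∉ₛ Px
              y∉Px p = y∉U+x (ext-least (⊆-trans S⊆U ext-⊆) ext-∈ ! p)
              x∉Py : x ∉ₛ Py
              x∉Py p with ext-inv p
              ... | α , s , s∈ , e with α ≟ 0#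
              ...   | no α≉0 = y∉U+x (IsSub.uncomb (isSub (ext U x x∉U)) α≉0 e ext-∈ (ext-⊆ ! (S⊆U ! s∈)))
              ...   | yes α≈0 = x∉ (IsSub.resp (isSub S) {s} (λ i → sym (trans (e i) (trans (+-congʳ (trans (*-congʳ α≈0) (zeroˡ _))) (+-identityˡ _)))) s∈)
            T : Cap
            T = ext Px y y∉Px
            opaque
              X+x⊆Px : ext X x x∉X ⊆ Px
              X+x⊆Px = ext-least (⊆-trans X⊆S ext-⊆) ext-∈
              X+y⊆Py : ext X y y∉X ⊆ Py
              X+y⊆Py = ext-least (⊆-trans X⊆S ext-⊆) ext-∈
              Px⊆T : Px ⊆ T
              Px⊆T = ext-⊆
              Py⊆T : Py ⊆ T
              Py⊆T = ext-least (⊆-trans ext-⊆ Px⊆T) ext-∈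
              ndPx : ND J Px
              ndPx = ND-mono X+x⊆Px ndx
              ndPy : ND J Py
              ndPy = ND-mono X+y⊆Py ndy
              Px≭Py : ¬ Px ≐ Py
              Px≭Py e = x∉Py (fwd e ! ext-∈)
              fxy : f Px ~ f Py
              fxy = hom ndPx ndPy (star-adj {S = S} ext-⊆ ext-⊆ Px≭Py)

          opaque
            y∉X+x : y ∉ₛ ext X x x∉X
            y∉X+x p = y∉U+x (ext-least (⊆-trans X⊆S₁ (⊆-trans S₁⊆U ext-⊆)) ext-∈ ! p)
          Q : Vtx
          Q = ext (ext X x x∉X) y y∉X+x
          opaque
            X+y⊆Q : ext X y y∉X ⊆ Q
            X+y⊆Q = ext-least (⊆-trans ext-⊆ ext-⊆) ext-∈
            X+y⊈X+x : ext X y y∉X ⊈ ext X x x∉X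
            X+y⊈X+x h = y∉X+x (h ! ext-∈)

          module Two (S : Edge) (X⊆S : X ⊆ S) (S⊆U : S ⊆ U) where
            open One S X⊆S S⊆U public
            opaque
              Q⊆T : Q ⊆ T
              Q⊆T = ext-least (⊆-trans X+x⊆Px Px⊆T) ext-∈
            capT : ∃ λ b → CovB b T × (∀ v → (∀ P → P ⊆ T → ND J P → v ~ f P) → v ∈B b)
            capT = capB ndx ndy ext-⊆ X+y⊆Q X+y⊈X+x Q⊆T
            opaque
              -- Otherwise `preimage` gives a vertex of T over X + ⟨x⟩ with the same image as S +
              -- ⟨y⟩, and so S + ⟨y⟩ would contain x.
              Py∉ : ∀ {a} → CovA a (ext X x x∉X) → ¬ f Py ∈A a
              Py∉ ca p with preimage ndx (⊆-trans X+x⊆Px Px⊆T) ca (proj₁ (proj₂ capT)) p (proj₁ (proj₂ capT) Py⊆T ndPy)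
              ... | W , X+x⊆W , W⊆T , e = x∉Py (fwd (f-top W⊆T Py⊆T (ND-mono X+x⊆W ndx) ndPy e) ! (X+x⊆W ! ext-∈))
          module M₁ = Two S₁ X⊆S₁ S₁⊆U
          module M₂ = Two S₂ X⊆S₂ S₂⊆U

          opaque
            Px₁≭Px₂ : ¬ M₁.Px ≐ M₂.Px
            Px₁≭Px₂ e with ⊈-witness S₂⊈S₁
            ... | s , s∈ , s∉ = x∉U (bwd (edges-span S₂⊈S₁ S₁⊆U S₂⊆U ext-⊆ (⊆-trans ext-⊆ (bwd e))) ! ext-∈)
            T₂⊈T₁ : M₂.T ⊈ M₁.T
            T₂⊈T₁ h = S₂⊈S₁ (incl (λ p → in-base S₁⊆U x∉U y∉U+x (h ! (M₂.Px⊆T ! (ext-⊆ ! p))) (S₂⊆U ! p)))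
            Px₁≭Q : ¬ M₁.Px ≐ Q
            Px₁≭Q e = M₁.y∉Px (bwd e ! ext-∈)

        opaque
          Px-⊆ : ∀ {S : Edge} (x∉ : x ∉ₛ S) → S ⊆ U → ext S x x∉ ⊆ ext U x x∉U
          Px-⊆ x∉ h = ext-least (⊆-trans h ext-⊆) ext-∈
          Py-⊆ : ∀ {S : Edge} (y∉ : y ∉ₛ S) → S ⊆ U → ext S y y∉ ⊆ ext U y y∉U
          Py-⊆ y∉ h = ext-least (⊆-trans h ext-⊆) ext-∈

          -- If a₁ = a₂, this block contains f(S₁ + ⟨x⟩) and f(S₂ + ⟨x⟩), so it is the block of X +
          -- ⟨x⟩, which `Py∉` forbids.
          A≢ : ∀ {a₁ a₂} → f M₁.Px ∈A a₁ → f M₁.Py ∈A a₁ → f M₂.Px ∈A a₂ → f M₂.Py ∈A a₂ → ¬ (∀ {Z} → Z ∈A a₁ → Z ∈A a₂)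
          A≢ {a₁} {a₂} p₁ p₁′ p₂ p₂′ h with edgeA ndx
          ... | a , ca = M₂.Py∉ ca (A-uniq (hom M₁.ndPx M₂.ndPx (star-adj {S = ext X x x∉X} M₁.X+x⊆Px M₂.X+x⊆Px Px₁≭Px₂))
                  (h p₁) p₂ (ca M₁.X+x⊆Px M₁.ndPx) (ca M₂.X+x⊆Px M₂.ndPx) p₂′)

          -- If `bx` = `by`, then f(S₁ + ⟨x⟩) lies in the blocks of both S_i + ⟨x, y⟩, which share
          -- only the image of X + ⟨x, y⟩.
          B≢ : ¬ (∀ {Z} → Z ∈B bx → Z ∈B by)
          B≢ h = ~⇒≭ (hom M₁.ndPx (ND-mono ext-⊆ ndx) (star-adj {S = ext X x x∉X} M₁.X+x⊆Px ext-⊆ Px₁≭Q))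
              (caps-share ndx ext-⊆ M₂.Q⊆T M₁.Q⊆T T₂⊈T₁ (proj₁ (proj₂ M₂.capT)) (proj₁ (proj₂ M₁.capT)) in₂ (proj₁ (proj₂ M₁.capT) M₁.Px⊆T M₁.ndPx))
            where
            in₂ : f M₁.Px ∈B proj₁ M₂.capT
            in₂ = B-uniq M₂.fxy (h (covx (Px-⊆ M₂.x∉ S₂⊆U) M₂.ndPx)) (covy (Py-⊆ M₂.y∉ S₂⊆U) M₂.ndPy)
              (proj₁ (proj₂ M₂.capT) M₂.Px⊆T M₂.ndPx) (proj₁ (proj₂ M₂.capT) M₂.Py⊆T M₂.ndPy) (h (covx (Px-⊆ M₁.x∉ S₁⊆U) M₁.ndPx))

          unique : ∀ {v w} → v ∈B bx → v ∈B by → w ∈B bx → w ∈B by → v ≐ w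
          unique {v} {w} p p′ r r′ = decidable-stable (v ≐? w) (λ h → B≢ (B-uniq (B-adj p r h) p r p′ r′))

          exists : ∀ {a₁ a₂} → f M₁.Px ∈A a₁ → f M₁.Py ∈A a₁ → f M₂.Px ∈A a₂ → f M₂.Py ∈A a₂ →
            ∃ λ v → v ∈A a₁ × v ∈A a₂ × v ∈B bx × v ∈B by
          exists p₁ p₁′ p₂ p₂′ = cross (A≢ p₁ p₁′ p₂ p₂′) B≢
            (_ , p₁ , covx (Px-⊆ M₁.x∉ S₁⊆U) M₁.ndPx) (_ , p₁′ , covy (Py-⊆ M₁.y∉ S₁⊆U) M₁.ndPy)
            (_ , p₂ , covx (Px-⊆ M₂.x∉ S₂⊆U) M₂.ndPx) (_ , p₂′ , covy (Py-⊆ M₂.y∉ S₂⊆U) M₂.ndPy)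

          built : (∃ λ v → v ∈B bx × v ∈B by × (∀ {a} → f M₁.Px ∈A a → f M₁.Py ∈A a → v ∈A a) × (∀ {a} → f M₂.Px ∈A a → f M₂.Py ∈A a → v ∈A a)) ×
            (∀ {v w} → v ∈B bx → v ∈B by → w ∈B bx → w ∈B by → v ≐ w) ×
            (∀ {a₁ a₂} → f M₁.Px ∈A a₁ → f M₁.Py ∈A a₁ → f M₂.Px ∈A a₂ → f M₂.Py ∈A a₂ → ∀ {v w} → v ∈A a₁ → w ∈A a₁ → v ∈A a₂ → w ∈A a₂ → v ≐ w)
          built with A-join M₁.fxy | A-join M₂.fxy
          ... | a₁ , p₁ , p₁′ | a₂ , p₂ , p₂′ with exists p₁ p₁′ p₂ p₂′
          ...   | v , v₁ , v₂ , p , p′ = (v , p , p′ , (λ r r′ → A-uniq M₁.fxy p₁ p₁′ r r′ v₁) , (λ r r′ → A-uniq M₂.fxy p₂ p₂′ r r′ v₂)) , unique ,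
                  λ r₁ r₁′ r₂ r₂′ {w} {w′} w₁ w₁′ w₂ w₂′ → decidable-stable (w ≐? w′) (λ h → A≢ r₁ r₁′ r₂ r₂′ (A-uniq (A-adj w₁ w₁′ h) w₁ w₁′ w₂ w₂′))

      opaque
        construct : ∀ {U : Vtx} {X : Pre} {S₁ S₂ : Edge} {x y : Vect}
          (X⊆S₁ : X ⊆ S₁) (X⊆S₂ : X ⊆ S₂) (S₁⊆U : S₁ ⊆ U) (S₂⊆U : S₂ ⊆ U) (S₂⊈S₁ : S₂ ⊈ S₁)
          (x∉U : x ∉ₛ U) (y∉U+x : y ∉ₛ ext U x x∉U) (y∉U : y ∉ₛ U)
          (x∉X : x ∉ₛ X) (y∉X : y ∉ₛ X) (ndx : ND J (ext X x x∉X)) (ndy : ND J (ext X y y∉X))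
          {bx by : B} (covx : CovB bx (ext U x x∉U)) (covy : CovB by (ext U y y∉U)) →
          let Px = λ {S : Edge} (h : S ⊆ U) → f (ext S x (λ p → x∉U (h ! p))) ; Py = λ {S : Edge} (h : S ⊆ U) → f (ext S y (λ p → y∉U (h ! p))) in
          (∃ λ v → v ∈B bx × v ∈B by × (∀ {a} → Px S₁⊆U ∈A a → Py S₁⊆U ∈A a → v ∈A a) × (∀ {a} → Px S₂⊆U ∈A a → Py S₂⊆U ∈A a → v ∈A a)) ×
          (∀ {v w} → v ∈B bx → v ∈B by → w ∈B bx → w ∈B by → v ≐ w) ×
          (∀ {a₁ a₂} → Px S₁⊆U ∈A a₁ → Py S₁⊆U ∈A a₁ → Px S₂⊆U ∈A a₂ → Py S₂⊆U ∈A a₂ → ∀ {v w} → v ∈A a₁ → w ∈A a₁ → v ∈A a₂ → w ∈A a₂ → v ≐ w)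
        construct X⊆S₁ X⊆S₂ S₁⊆U S₂⊆U S₂⊈S₁ x∉U y∉U+x y∉U x∉X y∉X ndx ndy {bx} {by} covx covy =
          Construct.built X⊆S₁ X⊆S₂ S₁⊆U S₂⊆U S₂⊈S₁ x∉U y∉U+x y∉U x∉X y∉X ndx ndy {bx} {by} covx covy

  -- The vector without zero coordinates, and connectedness

  𝟙 : Vect
  𝟙 _ = 1#

  opaque
    𝟙-ND : ∀ {m J} {S : Sp m} → 𝟙 ∈ₛ S → ND J S
    𝟙-ND 𝟙∈ = All.tabulate (λ _ → 𝟙 , 𝟙∈ , λ e → 0≉1 (sym e))

  opaque
    -- A walk from U to W over Z that enlarges the common part Y by one vector w of W at a time; if
    -- w is not in U, one step through a hyperplane of U over Y brings it in.
    connected : ∀ {z M} {Z : Sp z} (Φ : Sp (suc M) → Set) → (∀ {U W} → U ≐ W → Φ U → Φ W) →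
      (∀ (S : Sp M) {U W} → Z ⊆ S → S ⊆ U → S ⊆ W → Φ U → Φ W) →
      ∀ r {j} (Y : Sp j) {U W} → r ℕ.+ j ≡ suc M → Z ⊆ Y → Y ⊆ U → Y ⊆ W → Φ U → Φ W
    connected {M = M} Φ Φ-resp step 0ⁿ Y {U} {W} ≡.refl Z⊆Y Y⊆U Y⊆W = Φ-resp (≐-trans (≐-sym (⊆⇒≐ Y⊆U)) (⊆⇒≐ Y⊆W))
    connected {M = M} Φ Φ-resp step (suc r) {j} Y {U} {W} e Z⊆Y Y⊆U Y⊆W φ
      with outside (ℕₚ.≤-trans (s≤s (ℕₚ.m≤n+m j r)) (ℕₚ.≤-reflexive e)) Y W
    ... | w , w∈ , w∉ with w ∈? U
    ...   | yes w∈U = connected Φ Φ-resp step r (ext Y w w∉) (≡.trans (ℕₚ.+-suc r j) e) (⊆-trans Z⊆Y ext-⊆) (ext-least Y⊆U w∈U) (ext-least Y⊆W w∈) φ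
    ...   | no w∉U with ≡.subst (λ z → Σ (Sp z) λ S → (Y ⊆ S) × (S ⊆ U)) (ℕₚ.suc-injective e) (between r Y⊆U (ℕₚ.<⇒≤ (ℕₚ.≤-reflexive e)))
    ...     | S , Y⊆S , S⊆U = connected Φ Φ-resp step r (ext Y w w∉) {ext S w (λ p → w∉U (S⊆U ! p))} {W} (≡.trans (ℕₚ.+-suc r j) e) (⊆-trans Z⊆Y ext-⊆)
              (ext-least (⊆-trans Y⊆S ext-⊆) ext-∈) (ext-least Y⊆W w∈) (step S (⊆-trans Z⊆Y Y⊆S) S⊆U ext-⊆ φ)

  -- From one star to all stars

  module Start (G : Geo) (J : List (Fin n)) (f : Vtx → Vtx) (emb : Embedding J f) where
    open Embedding emb
    open Geo G
    open Maps G J f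

    opaque
      -- All vertices over S are non-degenerate and f is injective, so their images are as many as
      -- the block can hold.
      onto : ∀ {S a v} → ND J S → CovA a S → v ∈A a → ∃ λ W → (S ⊆ W) × f W ≐ v
      onto {S} {a} {v} nd ca va with Fₚ.any? (λ i → f (StarCode.star {suc k₂} {suc (suc (suc d₂))} S n≡ i) ≐? v)
      ... | yes (i , e) = StarCode.star {suc k₂} {suc (suc (suc d₂))} S n≡ i , ext-⊆ , e
      ... | no ∄ = ⊥-elim (go (A-count {a} h h∈))
        where
        open StarCode {suc k₂} {suc (suc (suc d₂))} S n≡ using (star; point-inj)
        h : Fin (suc (N (suc (suc (suc d₂))))) → Vtx
        h zero = v
        h (suc i) = f (star i)
        nds : ∀ i → ND J (star i)
        nds i = ND-mono ext-⊆ nd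
        h∈ : ∀ i → h i ∈A a
        h∈ zero = va
        h∈ (suc i) = ca ext-⊆ (nds i)
        go : Collide h → ⊥
        go (zero , zero , i≢j , e) = i≢j ≡.refl
        go (zero , suc j , i≢j , e) = ∄ (j , ≐-sym e)
        go (suc i , zero , i≢j , e) = ∄ (i , e)
        go (suc i , suc j , i≢j , e) = i≢j (≡.cong suc (point-inj i j (fwd (inj (nds i) (nds j) e) ! ext-∈)))

    opaque
      -- By `onto` the star of S fills a, so vertices of T not over S have images outside a and
      -- thus, by the clique dichotomy, in b. Vertices over S are then settled by a triangle with W.
      cap-of : ∀ {S a} {T : Cap} {W : Vtx} → ND J S → CovA a S → S ⊆ T → W ⊆ T → ND J W → S ⊈ W → ∃ λ b → CovB b T
      cap-of {S} {a} {T} {W} nd ca S⊆T W⊆T ndW S⊈W with outside (ℕₚ.m<n⇒m<1+n ℕₚ.≤-refl) S T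
      ... | s , s∈ , s∉ with outside ℕₚ.≤-refl (ext S s s∉) T
      ...   | t , t∈ , t∉ = b , cov
        where
        P Q : Vtx
        P = ext S s s∉
        Q = ext S t (λ p → t∉ (ext-⊆ ! p))
        P⊆ : P ⊆ T
        P⊆ = ext-least S⊆T s∈
        Q⊆ : Q ⊆ T
        Q⊆ = ext-least S⊆T t∈
        ndP : ND J P
        ndP = ND-mono ext-⊆ nd
        ndQ : ND J Q
        ndQ = ND-mono ext-⊆ nd
        PQ : f P ~ f Q
        PQ = hom ndP ndQ (star-adj {S = S} ext-⊆ ext-⊆ (λ e → t∉ (bwd e ! ext-∈)))
        b : B
        b = proj₁ (B-join PQ)
        bP : f P ∈B b
        bP = proj₁ (proj₂ (B-join PQ))
        bQ : f Q ∈B b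
        bQ = proj₂ (proj₂ (B-join PQ))
        not-a : ∀ {Z} → ND J Z → S ⊈ Z → ¬ f Z ∈A a
        not-a ndZ S⊈Z p with onto nd ca p
        ... | Z′ , S⊆Z′ , e = S⊈Z (⊆-trans S⊆Z′ (fwd (inj (ND-mono S⊆Z′ nd) ndZ e)))
        outer : ∀ {Z} → Z ⊆ T → ND J Z → S ⊈ Z → f Z ∈B b
        outer Z⊆T ndZ S⊈Z with clique PQ (hom ndP ndZ (top-adj P⊆ Z⊆T (λ e → S⊈Z (⊆-trans ext-⊆ (fwd e)))))
            (hom ndQ ndZ (top-adj Q⊆ Z⊆T (λ e → S⊈Z (⊆-trans ext-⊆ (fwd e))))) (ca ext-⊆ ndP) (ca ext-⊆ ndQ) bP bQ
        ... | inj₁ p = ⊥-elim (not-a ndZ S⊈Z p)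
        ... | inj₂ p = p
        W≭ : ∀ {Z : Vtx} → S ⊆ Z → ¬ W ≐ Z
        W≭ S⊆Z e = S⊈W (⊆-trans S⊆Z (bwd e))
        cov : CovB b T
        cov {Z} Z⊆T ndZ with S ⊆? Z
        ... | no S⊈Z = outer Z⊆T ndZ S⊈Z
        ... | yes S⊆Z with Z ≐? P
        ...   | yes e = B-resp (≐-sym (resp ndZ e)) bP
        ...   | no Z≭P = lemma (A-join PW)
          where
          PW : f P ~ f W
          PW = hom ndP ndW (top-adj P⊆ W⊆T (λ e → W≭ ext-⊆ (≐-sym e)))
          PZ : f P ~ f Z
          PZ = hom ndP ndZ (top-adj P⊆ Z⊆T (λ e → Z≭P (≐-sym e)))
          lemma : (∃ λ a′ → f P ∈A a′ × f W ∈A a′) → f Z ∈B b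
          lemma (a′ , pP , pW) with clique PW PZ (hom ndW ndZ (top-adj W⊆T Z⊆T (W≭ S⊆Z))) pP pW bP (outer W⊆T ndW S⊈W)
          ... | inj₂ p = p
          ... | inj₁ p = ⊥-elim (not-a ndW S⊈W (A-uniq PZ pP p (ca ext-⊆ ndP) (ca S⊆Z ndZ) pW))

    opaque
      -- Otherwise the pencil between S and T₁ and one more vertex over S in T₂ have q + 2 images in
      -- a and b₂.
      caps-differ : ∀ {S a} {T₁ T₂ : Cap} {b₁ b₂} → ND J S → CovA a S → S ⊆ T₁ → S ⊆ T₂ → T₂ ⊈ T₁ → CovB b₁ T₁ → CovB b₂ T₂ → ¬ (∀ {Z} → Z ∈B b₁ → Z ∈B b₂)
      caps-differ {S} {a} {T₁} {T₂} {b₁} {b₂} nd ca S⊆T₁ S⊆T₂ T₂⊈T₁ c₁ c₂ sub with ⊈-witness T₂⊈T₁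
      ... | t , t∈ , t∉ = go (A∩B {a} {b₂} h h∈a h∈b)
        where
        open Pencil S T₁ S⊆T₁ using (pen; pen-⊆; pen-inj)
        W : Vtx
        W = ext S t (λ p → t∉ (S⊆T₁ ! p))
        g : Fin (suc (suc q)) → Vtx
        g zero = W
        g (suc i) = pen i
        h : Fin (suc (suc q)) → Vtx
        h = f ∘ g
        ndg : ∀ i → ND J (g i)
        ndg zero = ND-mono ext-⊆ nd
        ndg (suc i) = ND-mono ext-⊆ nd
        h∈a : ∀ i → h i ∈A a
        h∈a zero = ca ext-⊆ (ndg zero)
        h∈a (suc i) = ca ext-⊆ (ndg (suc i))
        h∈b : ∀ i → h i ∈B b₂
        h∈b zero = c₂ (ext-least S⊆T₂ t∈) (ndg zero)
        h∈b (suc i) = sub (c₁ (pen-⊆ i) (ndg (suc i)))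
        inj′ : ∀ i j → g i ≐ g j → i ≡ j
        inj′ zero zero e = ≡.refl
        inj′ zero (suc j) e = ⊥-elim (t∉ (pen-⊆ j ! (fwd e ! ext-∈)))
        inj′ (suc i) zero e = ⊥-elim (t∉ (pen-⊆ i ! (bwd e ! ext-∈)))
        inj′ (suc i) (suc j) e = ≡.cong suc (pen-inj i j e)
        go : Collide h → ⊥
        go (i , j , i≢j , e) = i≢j (inj′ i j (inj (ndg i) (ndg j) e))

    opaque
      -- S₀ supplies B-blocks for the caps over U, different for different caps. The block of f U
      -- and of a further vertex over S in T₁ therefore contains the image of each vertex over S
      -- outside T₁. A second cap, which exists since k + 1 < n, treats those inside T₁.
      propagate : ∀ {S₀ S : Edge} {U : Vtx} {a₀} → ND J S₀ → CovA a₀ S₀ → ND J S → S₀ ⊆ U → S ⊆ U → S ⊈ S₀ → ∃ λ a → CovA a S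
      propagate {S₀} {S} {U} {a₀} nd₀ c₀ nd S₀⊆U S⊆U S⊈S₀
        with 𝕖-outside (ℕₚ.<-trans ℕₚ.≤-refl k+1<n) U
      ... | i₁ , t₁∉ with 𝕖-outside k+1<n (ext U (𝕖 i₁) t₁∉)
      ...   | i₂ , t₂∉ = a , cov
        where
        ndU : ND J U
        ndU = ND-mono S⊆U nd
        module At (t : Vect) (t∉ : t ∉ₛ U) where
          T : Cap
          T = ext U t t∉
          Q : Vtx
          Q = ext S t (λ p → t∉ (S⊆U ! p))
          ndQ : ND J Q
          ndQ = ND-mono ext-⊆ nd
          Q⊆T : Q ⊆ T
          Q⊆T = ext-least (⊆-trans S⊆U ext-⊆) ext-∈
          U≭Q : ¬ U ≐ Q
          U≭Q e = t∉ (bwd e ! ext-∈)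
          UQ : f U ~ f Q
          UQ = hom ndU ndQ (star-adj {S = S} S⊆U ext-⊆ U≭Q)
          S₀⊈Q : S₀ ⊈ Q
          S₀⊈Q h = U≭Q (edges-span S⊈S₀ S₀⊆U S⊆U h ext-⊆)
          cap : ∃ λ b → CovB b T
          cap = cap-of nd₀ c₀ (⊆-trans S₀⊆U ext-⊆) Q⊆T ndQ S₀⊈Q
        module M₁ = At (𝕖 i₁) t₁∉
        T₁ : Cap
        T₁ = M₁.T
        b₁ : B
        b₁ = proj₁ M₁.cap
        c₁ : CovB b₁ T₁
        c₁ = proj₂ M₁.cap
        a : A
        a = proj₁ (A-join M₁.UQ)
        aU : f U ∈A a
        aU = proj₁ (proj₂ (A-join M₁.UQ))
        aQ : f M₁.Q ∈A a
        aQ = proj₂ (proj₂ (A-join M₁.UQ))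
        differ′ : ∀ z (z∉ : z ∉ₛ U) → z ∉ₛ T₁ → ∀ {v} → v ~ f U → v ∈B b₁ → v ∈B proj₁ (At.cap z z∉) → ⊥
        differ′ z z∉ z∉T₁ v~ p p′ = caps-differ nd₀ c₀ (⊆-trans S₀⊆U ext-⊆) (⊆-trans S₀⊆U ext-⊆) (λ h → z∉T₁ (h ! ext-∈)) c₁ (proj₂ (At.cap z z∉))
          (B-uniq v~ p (c₁ ext-⊆ ndU) p′ (proj₂ (At.cap z z∉) ext-⊆ ndU))
        far : ∀ {Z} → S ⊆ Z → ND J Z → Z ⊈ T₁ → f Z ∈A a
        far {Z} S⊆Z ndZ Z⊈T₁ with ⊈-witness Z⊈T₁
        ... | z , z∈ , z∉T₁ with clique M₁.UQ UZ QZ aU aQ (c₁ ext-⊆ ndU) (c₁ M₁.Q⊆T M₁.ndQ)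
          where
          UZ : f U ~ f Z
          UZ = hom ndU ndZ (star-adj S⊆U S⊆Z (λ e → z∉T₁ (ext-⊆ ! (bwd e ! z∈))))
          QZ : f M₁.Q ~ f Z
          QZ = hom M₁.ndQ ndZ (star-adj {S = S} ext-⊆ S⊆Z (λ e → z∉T₁ (M₁.Q⊆T ! (bwd e ! z∈))))
        ...   | inj₁ p = p
        ...   | inj₂ p = ⊥-elim (differ′ z z∉ z∉T₁ (~-sym (hom ndU ndZ (star-adj S⊆U S⊆Z (λ e → z∉ (bwd e ! z∈))))) p (proj₂ (At.cap z z∉) Z⊆ ndZ))
          where
          z∉ : z ∉ₛ U
          z∉ p = z∉T₁ (ext-⊆ ! p)
          Z⊆ : Z ⊆ ext U z z∉
          Z⊆ = ⊆-trans (ext-hyper {x∉ = λ p → z∉ (S⊆U ! p)} S⊆Z z∈) (ext-least (⊆-trans S⊆U ext-⊆) ext-∈)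
        t₂∉U : 𝕖 i₂ ∉ₛ U
        t₂∉U p = t₂∉ (ext-⊆ ! p)
        module M₂ = At (𝕖 i₂) t₂∉U
        aQ₂ : f M₂.Q ∈A a
        aQ₂ = far ext-⊆ M₂.ndQ (λ h → t₂∉ (h ! ext-∈))
        cov : CovA a S
        cov {Z} S⊆Z ndZ with Z ⊆? T₁
        ... | no Z⊈T₁ = far S⊆Z ndZ Z⊈T₁
        ... | yes Z⊆T₁ with Z ≐? U
        ...   | yes e = A-resp (≐-sym (resp ndZ e)) aU
        ...   | no Z≭U with clique M₂.UQ UZ QZ aU aQ₂ (proj₂ M₂.cap ext-⊆ ndU) (proj₂ M₂.cap M₂.Q⊆T M₂.ndQ)
          where
          UZ : f U ~ f Z
          UZ = hom ndU ndZ (star-adj S⊆U S⊆Z (λ e → Z≭U (≐-sym e)))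
          QZ : f M₂.Q ~ f Z
          QZ = hom M₂.ndQ ndZ (star-adj {S = S} ext-⊆ S⊆Z (λ e → t₂∉ (Z⊆T₁ ! (fwd e ! ext-∈))))
        ...     | inj₁ p = p
        ...     | inj₂ p = ⊥-elim (differ′ (𝕖 i₂) t₂∉U t₂∉ (hom ndZ ndU (star-adj S⊆Z S⊆U Z≭U)) (c₁ Z⊆T₁ ndZ) p)

    opaque
      step𝟙 : ∀ {S₀ S : Edge} {X : Pre} → ND J S₀ → ND J S → X ⊆ S₀ → X ⊆ S → (∃ λ a → CovA a S₀) → ∃ λ a → CovA a S
      step𝟙 {S₀} {S} {X} nd₀ nd X⊆S₀ X⊆S (a₀ , c₀) with S ⊆? S₀
      ... | yes S⊆S₀ = a₀ , λ h → c₀ (⊆-trans (eqdim S⊆S₀) h)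
      ... | no S⊈S₀ with ⊈-witness S⊈S₀
      ...   | s , s∈ , s∉ = propagate {U = ext S₀ s s∉} nd₀ c₀ nd ext-⊆
                (⊆-trans (ext-hyper {x∉ = λ p → s∉ (X⊆S₀ ! p)} X⊆S s∈) (ext-least (⊆-trans X⊆S₀ ext-⊆) ext-∈)) S⊈S₀

    𝟙-edge : (S : Edge) → Σ Edge λ S′ → Σ Pre λ X → (𝟙 ∈ₛ S′) × (X ⊆ S) × (X ⊆ S′)
    𝟙-edge S with 𝟙 ∈? S
    ... | yes p = S , tailSp S , p , tailSp-⊆ , tailSp-⊆
    ... | no 𝟙∉ = ext (tailSp S) 𝟙 (λ p → 𝟙∉ (tailSp-⊆ ! p)) , tailSp S , ext-∈ , tailSp-⊆ , ext-⊆

    opaque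
      -- Edges through 𝟙 are non-degenerate and connected among themselves over ⟨𝟙⟩, and every edge
      -- shares a (k - 2)-space with one of them.
      all-edges : ∀ {S₀ : Edge} → ND J S₀ → (∃ λ a → CovA a S₀) → ∀ {S : Edge} → ND J S → ∃ λ a → CovA a S
      all-edges {S₀} nd₀ c₀ {S} nd with 𝟙-edge S₀ | 𝟙-edge S
      ... | S₁ , X₁ , 𝟙∈₁ , p₁ , p₁′ | S₂ , X₂ , 𝟙∈₂ , p₂ , p₂′ = step𝟙 (𝟙-ND 𝟙∈₂) nd p₂′ p₂ c₂
        where
        c₁ : ∃ λ a → CovA a S₁
        c₁ = step𝟙 nd₀ (𝟙-ND 𝟙∈₁) p₁ p₁′ c₀
        𝟙∉0 : 𝟙 ∉ₛ nilSp
        𝟙∉0 p = nonzero (un p)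
          where
          nonzero : ¬ 𝟙 ∈Span []
          nonzero ⟪ _ , e ⟫ = 0≉1 (sym (e (≡.subst Fin n≡ zero)))
        Z : Sp 1
        Z = ext nilSp 𝟙 𝟙∉0
        Z⊆ : ∀ {m} {S : Sp m} → 𝟙 ∈ₛ S → Z ⊆ S
        Z⊆ {S = S} 𝟙∈ = ext-least (incl (nilSp-least (isSub S) _)) 𝟙∈
        c₂ : ∃ λ a → CovA a S₂
        c₂ = connected {Z = Z} (λ S → ∃ λ a → CovA a S) (λ e (a , c) → a , λ h → c (⊆-trans (fwd e) h))
          (λ X Z⊆X X⊆U X⊆W → step𝟙 (𝟙-ND (X⊆U ! (Z⊆X ! ext-∈))) (𝟙-ND (X⊆W ! (Z⊆X ! ext-∈))) X⊆U X⊆W)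
          k₂ Z (ℕₚ.+-comm k₂ 1) ⊆-refl (Z⊆ 𝟙∈₁) (Z⊆ 𝟙∈₂) c₁

    opaque
      start : ∀ {S₀ : Edge} → ND J S₀ → (∃ λ a → CovA a S₀) → Inv
      start nd₀ c₀ = record { resp = resp ; hom = hom ; edgeA = all-edges nd₀ c₀ ; sep = sep }
        where
        sep : ∀ {S₁ S₂ : Edge} {U₀ : Vtx} {a₁ a₂} → ND J S₁ → ND J S₂ → S₁ ⊆ U₀ → S₂ ⊆ U₀ → S₂ ⊈ S₁ → CovA a₁ S₁ → CovA a₂ S₂ →
          ∀ {v w} → v ~ w → v ∈A a₁ → w ∈A a₁ → v ∈A a₂ → w ∈A a₂ → ⊥
        sep {S₁} {S₂} {U₀} nd₁ nd₂ s₁ s₂ S₂⊈S₁ c₁ c₂ v~w v₁ w₁ v₂ w₂ with 𝕖-outside (ℕₚ.<-trans ℕₚ.≤-refl k+1<n) U₀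
        ... | i , t∉ with onto nd₂ c₂ (A-uniq v~w v₁ w₁ v₂ w₂ (c₁ {ext S₁ (𝕖 i) (λ p → t∉ (s₁ ! p))} ext-⊆ (ND-mono ext-⊆ nd₁)))
        ...   | Z , S₂⊆Z , e = t∉ (bwd (edges-span S₂⊈S₁ s₁ s₂ ext-⊆ (⊆-trans S₂⊆Z (fwd (inj (ND-mono S₂⊆Z nd₂) (ND-mono ext-⊆ nd₁) e)))) ! ext-∈)

  -- Sizes, and the type of the image of a clique

  opaque
    2≤q : 2 ≤ q
    2≤q = go enum enum-surjective
      where
      go : ∀ {r} (h : Fin r → Carrier) → (∀ x → ∃ λ i → h i ≈ x) → 2 ≤ r
      go {0ⁿ} h surj with surj 0#
      ... | () , _
      go {suc 0ⁿ} h surj with surj 0# | surj 1#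
      ... | zero , e | zero , e′ = ⊥-elim (0≉1 (trans (sym e) e′))
      go {suc (suc r)} h surj = s≤s (s≤s z≤n)

  opaque
    1≤q^ : ∀ m → 1 ≤ q ^ m
    1≤q^ m = ℕₚ.m^n>0 q {{ℕ.>-nonZero (ℕₚ.<-trans ℕₚ.≤-refl 2≤q)}} m

    N-≤ : ∀ m → N m ≤ q ^ m
    N-≤ 0ⁿ = z≤n
    N-≤ (suc m) = ℕₚ.≤-trans (ℕₚ.+-monoʳ-≤ (q ^ m) (N-≤ m))
      (ℕₚ.≤-trans (ℕₚ.≤-reflexive (≡.cong (q ^ m ℕ.+_) (≡.sym (ℕₚ.+-identityʳ (q ^ m))))) (ℕₚ.*-monoˡ-≤ (q ^ m) 2≤q))

    N-< : ∀ {l m} → l < m → N l < N m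
    N-< {l} {suc m} (s≤s l≤m) with ℕₚ.m≤n⇒m<n∨m≡n l≤m
    ... | inj₁ l<m = ℕₚ.<-≤-trans (N-< l<m) (ℕₚ.m≤n+m (N m) (q ^ m))
    ... | inj₂ ≡.refl = ℕₚ.+-monoˡ-≤ (N m) (1≤q^ m)

  opaque
    δ : ∀ {m} → Fin m → Fin m → Carrier
    δ i j with i Fₚ.≟ j
    ... | yes _ = 1#
    ... | no _ = 0#

    δ-refl : ∀ {m} (i : Fin m) → δ i i ≈ 1#
    δ-refl i with i Fₚ.≟ i
    ... | yes _ = refl
    ... | no h = ⊥-elim (h ≡.refl)

    δ-≢ : ∀ {m} {i j : Fin m} → ¬ i ≡ j → δ i j ≈ 0#
    δ-≢ {i = i} {j} h with i Fₚ.≟ j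
    ... | yes e = ⊥-elim (h e)
    ... | no _ = refl

  module Classes {m} (cl : Fin n → Fin m) (σ : Fin m → Fin n) (sec : ∀ j → cl (σ j) ≡ j) where
    ind-vec : Fam m
    ind-vec j i = δ (cl i) j

    opaque
      ind-vec-Ind : Ind ind-vec
      ind-vec-Ind = LinIndep⇒Ind (λ c e j → trans (sym (at c j)) (e (σ j)))
        where
        at : ∀ (c : Fin m → Carrier) j → lincomb c ind-vec (σ j) ≈ c j
        at c j = trans (∑-single _ j (λ l l≢j → trans (*-congˡ (δ-≢ (λ e → l≢j (≡.trans (≡.sym e) (sec j))))) (zeroʳ _)))
          (trans (*-congˡ (≡.subst (λ z → δ z j ≈ 1#) (≡.sym (sec j)) (δ-refl j))) (*-identityʳ _))

    clSp : Sp m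
    clSp = sp ind-vec ind-vec-Ind

    opaque
      cl-const : ∀ {i i′} → cl i ≡ cl i′ → ∀ {x} → x ∈ₛ clSp → x i ≈ x i′
      cl-const {i} {i′} e = least clSp (record
        { resp = λ h p → trans (sym (h i)) (trans p (h i′)) ; nil = refl ; add = +-cong ; scale = λ α → *-congˡ })
        (λ j → reflexive (≡.cong (λ z → δ z j) e))

      clSp-ND : ∀ {J} → ND J clSp
      clSp-ND = All.tabulate (λ {i} _ → ind-vec (cl i) , gen clSp (cl i) , λ e → 0≉1 (trans (sym e) (δ-refl (cl i))))

  opaque
    -- The generator with index j is 1 on class j + 1 and -c_j on class zero, so one nonzero c_j
    -- makes every coordinate occur.
    hyp-ND : ∀ {m J} (cl : Fin n → Fin (suc m)) σ sec (c : Fin m → Carrier) → ¬ (∀ j → c j ≈ 0#) → ND J (hypSp (Classes.clSp cl σ sec) c)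
    hyp-ND {m} cl σ sec c c≉0 = All.tabulate (λ {i} _ → hit i)
      where
      open Classes cl σ sec
      hit : ∀ i → Hits i (hypSp clSp c)
      hit i with cl i in eq
      ... | suc j = _ , gen (hypSp clSp c) j , λ e → 0≉1 (sym (trans (sym (begin-eq j eq)) e))
        where
        begin-eq : ∀ j → cl i ≡ suc j → δ (cl i) (suc j) + - (c j * δ (cl i) zero) ≈ 1#
        begin-eq j e rewrite e = trans (+-cong (δ-refl (suc j)) (-‿cong (trans (*-congˡ (δ-≢ (λ ()))) (zeroʳ _))))
          (solve 0 (con (+ 1) :- con (+ 0) := con (+ 1)) refl)
      ... | zero with Fₚ.any? (λ j → ¬? (c j ≟ 0#))
      ...   | no ∄ = ⊥-elim (c≉0 (λ j → decidable-stable (c j ≟ 0#) (λ h → ∄ (j , h))))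
      ...   | yes (j , cj≉0) = _ , gen (hypSp clSp c) j , λ e → cj≉0 (trans (neg eq) (trans (-‿cong e) (solve 0 (:- con (+ 0) := con (+ 0)) refl)))
        where
        neg : cl i ≡ zero → c j ≈ - (δ (cl i) (suc j) + - (c j * δ (cl i) zero))
        neg e rewrite e = sym (trans (-‿cong (+-cong (δ-≢ (λ ())) (-‿cong (*-congˡ (δ-refl zero)))))
          (solve 1 (λ a → :- (con (+ 0) :- a :* con (+ 1)) := a) refl (c j)))

  opaque
    hyp-inj : ∀ {m} (T : Sp (suc m)) c c′ → hypSp T c ≐ hypSp T c′ → ∀ j → c j ≈ c′ j
    hyp-inj T c c′ e j = decidable-stable (c j ≟ c′ j) (λ ne → hypSp-∉ T c (IsSub.uncomb (isSub (hypSp T c)) {c′ j + - c j} {fam T zero} {0ᵥ}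
        {(fam T (suc j) -ᵥ c j · fam T zero) -ᵥ (fam T (suc j) -ᵥ c′ j · fam T zero)}
        (λ h → ne (sym (x-y≈0⇒x≈y h)))
        (λ i → solve 4 (λ a b v t → (t :- a :* v) :- (t :- b :* v) := (b :- a) :* v :+ con (+ 0)) refl (c j) (c′ j) (fam T zero i) (fam T (suc j) i))
        (IsSub.sub (isSub (hypSp T c)) (gen (hypSp T c) j) (bwd e ! gen (hypSp T c′) j)) (IsSub.nil (isSub (hypSp T c)))))

    hyp-cong : ∀ {m} (T : Sp (suc m)) {c c′} → (∀ j → c j ≈ c′ j) → hypSp T c ≐ hypSp T c′
    hyp-cong T {c} {c′} e = ⊆⇒≐ (incl (least (hypSp T c) (isSub (hypSp T c′))
      (λ j → IsSub.resp (isSub (hypSp T c′)) (λ i → +-congˡ (-‿cong (*-congʳ (sym (e j))))) (gen (hypSp T c′) j))))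

  module _ where
    open Geo star-top

    opaque
      -- Suppose z leaves the A-block a of the first pair. A member outside b would lie in a and in
      -- the A-block of `h i₀` and `h z`; these blocks would then coincide and contain `h z`.
      family-type : ∀ {M} (h : Fin M → Vtx) → (∀ i j → ¬ h i ≐ h j → h i ~ h j) → ∀ i₀ j₀ → h i₀ ~ h j₀ →
        (∃ λ a → ∀ i → h i ∈A a) ⊎ (∃ λ b → ∀ i → h i ∈B b)
      family-type {M} h adjacent i₀ j₀ 0~ with Fₚ.any? (λ i → ¬? (A? (h i) (proj₁ (A-join 0~))))
      ... | no ∄ = inj₁ (proj₁ (A-join 0~) , λ i → decidable-stable (A? (h i) (proj₁ (A-join 0~))) (λ p → ∄ (i , p)))
      ... | yes (z , z∉) = inj₂ (b , inB)
        where
        a : A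
        a = proj₁ (A-join 0~)
        b : B
        b = proj₁ (B-join 0~)
        ai : h i₀ ∈A a
        ai = proj₁ (proj₂ (A-join 0~))
        aj : h j₀ ∈A a
        aj = proj₂ (proj₂ (A-join 0~))
        bi : h i₀ ∈B b
        bi = proj₁ (proj₂ (B-join 0~))
        bj : h j₀ ∈B b
        bj = proj₂ (proj₂ (B-join 0~))
        either : ∀ l → (h l ∈A a) ⊎ (h l ∈B b)
        either l with h i₀ ≐? h l | h j₀ ≐? h l
        ... | yes e | _ = inj₁ (A-resp {a = a} e ai)
        ... | no _ | yes e = inj₁ (A-resp {a = a} e aj)
        ... | no p | no p′ = clique 0~ (adjacent i₀ l p) (adjacent j₀ l p′) ai aj bi bj
        bz : h z ∈B b
        bz with either z
        ... | inj₁ p = ⊥-elim (z∉ p)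
        ... | inj₂ p = p
        i~z : h i₀ ~ h z
        i~z = adjacent i₀ z (λ e → z∉ (A-resp {a = a} e ai))
        a′ : A
        a′ = proj₁ (A-join i~z)
        inB : ∀ l → h l ∈B b
        inB l with h i₀ ≐? h l | h z ≐? h l
        ... | yes e | _ = B-resp {b = b} e bi
        ... | no _ | yes e = B-resp {b = b} e bz
        ... | no p | no p′ with clique i~z (adjacent i₀ l p) (adjacent z l p′) (proj₁ (proj₂ (A-join i~z))) (proj₂ (proj₂ (A-join i~z))) bi bz
        ...   | inj₂ r = r
        ...   | inj₁ r with either l
        ...     | inj₂ s = s
        ...     | inj₁ s = ⊥-elim (z∉ (A-uniq {a = a′} {a′ = a} (adjacent i₀ l p) (proj₁ (proj₂ (A-join i~z))) r ai s (proj₂ (proj₂ (A-join i~z)))))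

  module Search (J : List (Fin n)) (f : Vtx → Vtx) (emb : Embedding J f) where
    open Embedding emb
    open Geo star-top

    opaque
      edge-type : ∀ {S : Edge} → ND J S → (∃ λ a → ∀ {U} → S ⊆ U → f U ∈A a) ⊎ (∃ λ b → ∀ {U} → S ⊆ U → f U ∈B b)
      edge-type {S} nd = finish (family-type (f ∘ star) adjacent i₀ j₀ (adjacent i₀ j₀ (λ e → i₀≢j₀ (inj′ i₀ j₀ e))))
        where
        open StarCode {suc k₂} {suc (suc (suc d₂))} S n≡ using (star; point-inj; star-code; point-∉)
        nds : ∀ i → ND J (star i)
        nds i = ND-mono ext-⊆ nd
        adjacent : ∀ i j → ¬ f (star i) ≐ f (star j) → f (star i) ~ f (star j)
        adjacent i j h = hom (nds i) (nds j) (star-adj {S = S} ext-⊆ ext-⊆ (λ e → h (resp (nds i) e)))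
        inj′ : ∀ i j → f (star i) ≐ f (star j) → i ≡ j
        inj′ i j e = point-inj i j (fwd (inj (nds i) (nds j) e) ! ext-∈)
        2≤N : 2 ≤ N (suc (suc (suc d₂)))
        2≤N = ℕₚ.+-mono-≤ (1≤q^ (suc (suc d₂))) (ℕₚ.≤-trans (1≤q^ (suc d₂)) (ℕₚ.m≤m+n _ _))
        i₀ j₀ : Fin (N (suc (suc (suc d₂))))
        i₀ = Fin.inject≤ zero 2≤N
        j₀ = Fin.inject≤ (suc zero) 2≤N
        i₀≢j₀ : ¬ i₀ ≡ j₀
        i₀≢j₀ e = Fₚ.0≢1+n (Fₚ.inject≤-injective 2≤N 2≤N zero (suc zero) e)
        named : ∀ {U} → S ⊆ U → ∃ λ i → f (star i) ≐ f U
        named {U} S⊆U with star-code U S⊆U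
        ... | i , p = i , resp (nds i) (⊆⇒≐ (ext-least S⊆U p))
        finish : (∃ λ a → ∀ i → f (star i) ∈A a) ⊎ (∃ λ b → ∀ i → f (star i) ∈B b) → (∃ λ a → ∀ {U} → S ⊆ U → f U ∈A a) ⊎ (∃ λ b → ∀ {U} → S ⊆ U → f U ∈B b)
        finish (inj₁ (a , h)) = inj₁ (a , λ S⊆U → A-resp {a = a} (proj₂ (named S⊆U)) (h (proj₁ (named S⊆U))))
        finish (inj₂ (b , h)) = inj₂ (b , λ S⊆U → B-resp {b = b} (proj₂ (named S⊆U)) (h (proj₁ (named S⊆U))))

    Result : Set₁
    Result = Σ Geo λ G → Σ Edge λ S → ND J S × ∃ λ a → Maps.CovA G J f a S

    private
      𝟙∉0 : 𝟙 ∉ₛ nilSp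
      𝟙∉0 p = nonzero (un p)
        where
        nonzero : ¬ 𝟙 ∈Span []
        nonzero ⟪ _ , e ⟫ = 0≉1 (sym (e (≡.subst Fin n≡ zero)))

      S𝟙 : Σ Edge λ S → 𝟙 ∈ₛ S
      S𝟙 with between k₂ {Y = ext nilSp 𝟙 𝟙∉0} {U = 𝕖-basis} (incl (λ {x} _ → 𝕖-spans (isSub 𝕖-basis) (gen 𝕖-basis) x))
        (ℕₚ.≤-trans (ℕₚ.≤-reflexive (ℕₚ.+-comm k₂ 1)) (ℕₚ.<⇒≤ (ℕₚ.<-trans ℕₚ.≤-refl (ℕₚ.<-trans ℕₚ.≤-refl k+1<n))))
      ... | S , Z⊆S , _ = ≡.subst (λ z → Σ (Sp z) λ S → 𝟙 ∈ₛ S) (ℕₚ.+-comm k₂ 1) (S , Z⊆S ! ext-∈)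

      S₀ : Edge
      S₀ = proj₁ S𝟙
      nd₀ : ND J S₀
      nd₀ = 𝟙-ND (proj₂ S𝟙)

    opaque
      -- Here n > 2k: a star has more vertices than a top, so its injective image does not fit into
      -- one.
      k<d : k₂ < d₂ → Result
      k<d k₂<d₂ with edge-type nd₀
      ... | inj₁ (a , h) = star-top , S₀ , nd₀ , a , λ S⊆U _ → h S⊆U
      ... | inj₂ (b , h) = ⊥-elim (go (B-count {b} g (λ i → h ext-⊆)))
        where
        open StarCode {suc k₂} {suc (suc (suc d₂))} S₀ n≡ using (star; point-inj)
        le : suc (N (suc (suc (suc k₂)))) ≤ N (suc (suc (suc d₂)))
        le = N-< (s≤s (s≤s (s≤s k₂<d₂)))
        g : Fin (suc (N (suc (suc (suc k₂))))) → Vtx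
        g i = f (star (Fin.inject≤ i le))
        go : Collide g → ⊥
        go (i , j , i≢j , e) = i≢j (Fₚ.inject≤-injective le le i j (point-inj _ _ (fwd (inj (ND-mono ext-⊆ nd₀) (ND-mono ext-⊆ nd₀) e) ! ext-∈)))

    opaque
      k≡d : d₂ ≡ k₂ → Result
      k≡d e with edge-type nd₀
      ... | inj₁ (a , h) = star-top , S₀ , nd₀ , a , λ S⊆U _ → h S⊆U
      ... | inj₂ (b , h) = top-star e , S₀ , nd₀ , b , λ S⊆U _ → h S⊆U

  -- Extension over fields with at least three elements

  record Extension (G : Geo) (J J′ : List (Fin n)) (f : Vtx → Vtx) : Set where
    field
      g : Vtx → Vtx
      invariant : Maps.Inv G J′ g
      agree : ∀ {U} → ND J U → g U ≐ f U
      -- Stated for every adjacency-preserving h, so that uniqueness passes along a chain of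
      -- extensions.
      uniq : ∀ (h : Vtx → Vtx) → (∀ {U W} → U ~ W → h U ~ h W) → (∀ {U} → ND J U → h U ≐ f U) → ∀ {U} → ND J′ U → h U ≐ g U

  opaque
    in-hyperplane : ∀ {m J} {S : Sp m} → ¬ ND J S → ∃ λ i → ∀ {x} → x ∈ₛ S → x i ≈ 0#
    in-hyperplane {J = J} {S} h with satisfied (¬All⇒Any¬ (λ j → Hits? j S) J h)
    ... | i , p = i , ¬Hits p

    second-edge : ∀ {S : Edge} {U : Vtx} → S ⊆ U → Σ Edge λ S′ → (S′ ⊆ U) × (S′ ⊈ S) × (tailSp S ⊆ S′)
    second-edge {S} {U} S⊆U with outside ℕₚ.≤-refl S U
    ... | t , t∈ , t∉ = ext (tailSp S) t (λ p → t∉ (tailSp-⊆ ! p)) , ext-least (⊆-trans tailSp-⊆ S⊆U) t∈ , (λ h → t∉ (h ! ext-∈)) , ext-⊆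

  module LargeField (ω : Carrier) (ω≉0 : ¬ ω ≈ 0#) (ω≉1 : ¬ ω ≈ 1#) (G : Geo) (J : List (Fin n)) (f : Vtx → Vtx) (inv₀ : Maps.Inv G J f) where
    open Geo G
    open Maps G J f
    open Core inv₀

    Full : Vect → Set
    Full y = ∀ i → ¬ y i ≈ 0#

    opaque
      full-ND : ∀ {m} {S : Sp m} {y} → Full y → y ∈ₛ S → ND J S
      full-ND {y = y} F-y y∈ = All.tabulate (λ {i} _ → y , y∈ , F-y i)

      update : Vect → Fin n → Carrier → Vect
      update x i c j with i Fₚ.≟ j
      ... | yes _ = c
      ... | no _ = x j

      update-at : ∀ x i c → update x i c i ≈ c
      update-at x i c with i Fₚ.≟ i
      ... | yes _ = refl
      ... | no h = ⊥-elim (h ≡.refl)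

      update-off : ∀ x {i j} c → ¬ i ≡ j → update x i c j ≈ x j
      update-off x {i} {j} c h with i Fₚ.≟ j
      ... | yes e = ⊥-elim (h e)
      ... | no _ = refl

      update-diff : ∀ x i c j → update x i c j + - x j ≈ (c + - x i) * 𝕖 i j + 0#
      update-diff x i c j with i Fₚ.≟ j
      ... | yes ≡.refl = trans (solve 2 (λ c x → c :- x := (c :- x) :* con (+ 1) :+ con (+ 0)) refl c (x i)) (+-congʳ (*-congˡ (sym (𝕖-diag i))))
      ... | no h = trans (solve 3 (λ c x y → x :- x := (c :- y) :* con (+ 0) :+ con (+ 0)) refl c (x j) (x i)) (+-congʳ (*-congˡ (sym (𝕖-off h))))

      update-full : ∀ {x i c} → Full x → ¬ c ≈ 0# → Full (update x i c)
      update-full {x} {i} {c} F-x c≉0 j with i Fₚ.≟ j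
      ... | yes _ = c≉0
      ... | no _ = F-x j

    opaque
      update-∉ : ∀ {m} {S : Sp m} {x i c} → x ∈ₛ S → 𝕖 i ∉ₛ S → ¬ c ≈ x i → update x i c ∉ₛ S
      update-∉ {S = S} {x} {i} {c} x∈ e∉ c≉ p = e∉ (IsSub.uncomb (isSub S) {c + - x i} {𝕖 i} {0ᵥ} {update x i c -ᵥ x} (λ z → c≉ (x-y≈0⇒x≈y z))
        (update-diff x i c) (IsSub.sub (isSub S) p x∈) (IsSub.nil (isSub S)))

      𝟙-full : Full 𝟙
      𝟙-full i e = 0≉1 (sym e)

      full-outside : ∀ {m} → m < n → (S : Sp m) → ∃ λ y → Full y × y ∉ₛ S
      full-outside m<n S with 𝟙 ∈? S
      ... | no 𝟙∉ = 𝟙 , 𝟙-full , 𝟙∉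
      ... | yes 𝟙∈ with 𝕖-outside m<n S
      ...   | i , e∉ = update 𝟙 i ω , update-full 𝟙-full ω≉0 , update-∉ 𝟙∈ e∉ ω≉1

      safe : ∀ s → ∃ λ y → ¬ y ≈ 0# × ¬ y + s ≈ 0#
      safe s with (1# + s) ≟ 0#
      ... | no h = 1# , (λ e → 0≉1 (sym e)) , h
      ... | yes h = ω , ω≉0 , λ e → ω≉1 (x-y≈0⇒x≈y (trans (solve 2 (λ w s → w :- con (+ 1) := (w :+ s) :- (con (+ 1) :+ s)) refl ω s)
                (trans (+-cong e (-‿cong h)) (solve 0 (con (+ 0) :- con (+ 0) := con (+ 0)) refl))))

      -- Each coordinate has to avoid 0 and -s_i only, which three field elements allow.
      full-pair : ∀ s → ∃ λ y → Full y × Full (y +ᵥ s)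
      full-pair s = (λ i → proj₁ (safe (s i))) , (λ i → proj₁ (proj₂ (safe (s i)))) , (λ i → proj₂ (proj₂ (safe (s i))))

      third : ∀ x → ∃ λ y → ¬ y ≈ 0# × ¬ y ≈ x
      third x with 1# ≟ x
      ... | no h = 1# , (λ e → 0≉1 (sym e)) , h
      ... | yes h = ω , ω≉0 , λ e → ω≉1 (trans e (sym h))

    Cap-cover : Cap → Set
    Cap-cover T = ∃ λ b → CovB b T × (∀ v → (∀ P → P ⊆ T → ND J P → v ~ f P) → v ∈B b)

    opaque
      add-∉ : ∀ {m} {X : Sp m} {s y} (y∉X : y ∉ₛ X) (s∉ : s ∉ₛ X) → y ∉ₛ ext X s s∉ → (y +ᵥ s) ∉ₛ ext X y y∉X
      add-∉ {X = X} {s} {y} y∉X s∉ y∉ p = y∉ (shift (ext-inv p′))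
        where
        p′ : s ∈ₛ ext X y y∉X
        p′ = IsSub.resp (isSub (ext X y y∉X)) {(y +ᵥ s) -ᵥ y} (λ i → solve 2 (λ y s → (y :+ s) :- y := s) refl _ _) (IsSub.sub (isSub (ext X y y∉X)) p ext-∈)
        shift : (∃ λ α → ∃ λ t → t ∈ₛ X × (∀ i → s i ≈ α * y i + t i)) → y ∈ₛ ext X s s∉
        shift (α , t , t∈ , e) with α ≟ 0#
        ... | no α≉0 = IsSub.uncomb (isSub (ext X s s∉)) α≉0 e ext-∈ (ext-⊆ ! t∈)
        ... | yes α≈0 = ⊥-elim (s∉ (IsSub.resp (isSub X) {t} (λ i → sym (trans (e i) (trans (+-congʳ (trans (*-congʳ α≈0) (zeroˡ _))) (+-identityˡ _)))) t∈))

      -- X + ⟨y⟩ and X + ⟨y + s⟩ contain full vectors and lie in the common vertex X + ⟨y, s⟩, as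
      -- `capB` requires.
      full-cap : ∀ {X : Pre} {T : Cap} {s y} → X ⊆ T → (s∉ : s ∉ₛ X) → y ∉ₛ ext X s s∉ → Full y → Full (y +ᵥ s) → y ∈ₛ T → s ∈ₛ T → Cap-cover T
      full-cap {X} {T} {s} {y} X⊆T s∉ y∉ F-y F-ys y∈ s∈ = capB {S₁ = ext X y y∉X} {S₂ = ext X (y +ᵥ s) ys∉X} {U₀ = U₀}
          (full-ND F-y ext-∈) (full-ND F-ys ext-∈) ext-⊆ (ext-least (⊆-trans ext-⊆ ext-⊆) ext-∈)
          (λ h → add-∉ y∉X s∉ y∉ (h ! ext-∈)) (ext-least (ext-least X⊆T y∈) (IsSub.add (isSub T) y∈ s∈))
        where
        y∉X : y ∉ₛ X
        y∉X p = y∉ (ext-⊆ ! p)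
        ys∉X : (y +ᵥ s) ∉ₛ X
        ys∉X p = add-∉ y∉X s∉ y∉ (ext-⊆ ! p)
        U₀ : Vtx
        U₀ = ext (ext X y y∉X) (y +ᵥ s) (add-∉ y∉X s∉ y∉)

      full-cap₂ : ∀ {X : Pre} {T : Cap} {x y} (x∉ : x ∉ₛ X) → y ∉ₛ ext X x x∉ → Full x → Full y → X ⊆ T → x ∈ₛ T → y ∈ₛ T → Cap-cover T
      full-cap₂ {X} {T} {x} {y} x∉ y∉ F-x F-y X⊆T x∈ y∈ = capB {S₁ = ext X x x∉} {S₂ = ext X y (λ p → y∉ (ext-⊆ ! p))} {U₀ = ext (ext X x x∉) y y∉}
        (full-ND F-x ext-∈) (full-ND F-y ext-∈) ext-⊆ (ext-least (⊆-trans ext-⊆ ext-⊆) ext-∈) (λ h → y∉ (h ! ext-∈)) (ext-least (ext-least X⊆T x∈) y∈)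

    k<n : 2 ℕ.+ k₂ < n
    k<n = ℕₚ.<-trans ℕₚ.≤-refl k+1<n

    opaque
      -- For degenerate S let P = S + ⟨y⟩, where y and y + s are full for some s in S; then every
      -- cap over P has a B-block. By `same-A` the block of f P and f(S + ⟨y₂⟩) takes in every W
      -- over S not inside P + ⟨y₂⟩; the others are treated with y₃, and P alone lies in both caps.
      edge-cover : (S : Edge) → ∃ λ a → CovA a S
      edge-cover S with ND? J S
      ... | yes nd = edgeA nd
      ... | no ¬nd with in-hyperplane ¬nd | full-pair (fam S zero)
      ...   | m , S⊂ | y , F-y , F-ys with full-outside k<n (ext S y (λ p → F-y m (S⊂ p)))
      ...     | y₂ , F-y₂ , y₂∉ with full-outside k+1<n (ext (ext S y (λ p → F-y m (S⊂ p))) y₂ y₂∉)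
      ...       | y₃ , F-y₃ , y₃∉ = a , cov
        where
        s : Vect
        s = fam S zero
        X : Pre
        X = tailSp S
        y∉ : y ∉ₛ S
        y∉ p = F-y m (S⊂ p)
        P : Vtx
        P = ext S y y∉
        T₁ : Cap
        T₁ = ext P y₂ y₂∉
        y₃∉P : y₃ ∉ₛ P
        y₃∉P p = y₃∉ (ext-⊆ ! p)
        T₃ : Cap
        T₃ = ext P y₃ y₃∉P
        ext-S : ext X s (head-∉ S) ⊆ S
        ext-S = ext-least tailSp-⊆ (gen S zero)
        cap : (T : Cap) → P ⊆ T → Cap-cover T
        cap T P⊆T = full-cap {X} (⊆-trans tailSp-⊆ (⊆-trans ext-⊆ P⊆T)) (head-∉ S) (λ p → y∉ (ext-S ! p)) F-y F-ys (P⊆T ! ext-∈) (P⊆T ! (ext-⊆ ! gen S zero))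
        S₀ : Edge
        S₀ = ext X y (λ p → y∉ (tailSp-⊆ ! p))
        nd₀ : ND J S₀
        nd₀ = full-ND F-y ext-∈
        S₀⊆P : S₀ ⊆ P
        S₀⊆P = ext-least (⊆-trans tailSp-⊆ ext-⊆) ext-∈
        ndP : ND J P
        ndP = full-ND F-y ext-∈
        module At (z : Vect) (F-z : Full z) (z∉P : z ∉ₛ P) where
          Q : Vtx
          Q = ext S z (λ p → z∉P (ext-⊆ ! p))
          ndQ : ND J Q
          ndQ = full-ND F-z ext-∈
          P≭Q : ¬ P ≐ Q
          P≭Q e = z∉P (bwd e ! ext-∈)
          PQ : f P ~ f Q
          PQ = hom ndP ndQ (star-adj {S = S} ext-⊆ ext-⊆ P≭Q)
          Q⊆ : Q ⊆ ext P z z∉P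
          Q⊆ = ext-least (⊆-trans ext-⊆ ext-⊆) ext-∈
        module Y₂ = At y₂ F-y₂ y₂∉
        module Y₃ = At y₃ F-y₃ y₃∉P
        a : A
        a = proj₁ (A-join Y₂.PQ)
        aP : f P ∈A a
        aP = proj₁ (proj₂ (A-join Y₂.PQ))
        aQ₂ : f Y₂.Q ∈A a
        aQ₂ = proj₂ (proj₂ (A-join Y₂.PQ))
        far : ∀ {z} (F-z : Full z) (z∉P : z ∉ₛ P) → f (At.Q z F-z z∉P) ∈A a → ∀ {W w} → S ⊆ W → ND J W → w ∈ₛ W → w ∉ₛ ext P z z∉P → f W ∈A a
        far {z} F-z z∉P aQ {W} {w} S⊆W ndW w∈ w∉ = same-A nd₀ S₀⊆P ext-⊆ ext-⊆ (λ h → w∉ (eqdim h ! ext-∈))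
            (proj₁ (proj₂ (cap (ext P z z∉P) ext-⊆))) (proj₁ (proj₂ (cap (ext P w w∉P) ext-⊆))) ndQ Q⊆ P≭Q
            (proj₁ (proj₂ (cap (ext P w w∉P) ext-⊆)) W⊆ ndW) (hom ndW ndP (star-adj {S = S} S⊆W ext-⊆ (λ e → w∉P (fwd e ! w∈))))
            (hom ndW ndQ (star-adj {S = S} S⊆W ext-⊆ (λ e → w∉ (Q⊆ ! (fwd e ! w∈))))) aP aQ
          where
          open At z F-z z∉P
          w∉P : w ∉ₛ P
          w∉P p = w∉ (ext-⊆ ! p)
          W⊆ : W ⊆ ext P w w∉P
          W⊆ = ⊆-trans (ext-hyper {x∉ = λ p → w∉P (ext-⊆ ! p)} S⊆W w∈) (ext-least (⊆-trans ext-⊆ ext-⊆) ext-∈)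
        aQ₃ : f Y₃.Q ∈A a
        aQ₃ = far F-y₂ y₂∉ aQ₂ ext-⊆ Y₃.ndQ ext-∈ y₃∉
        cov : CovA a S
        cov {W} S⊆W ndW with W ⊆? T₁
        ... | no W⊈ with ⊈-witness W⊈
        ...   | w , w∈ , w∉ = far F-y₂ y₂∉ aQ₂ S⊆W ndW w∈ w∉
        cov {W} S⊆W ndW | yes W⊆ with W ⊆? T₃
        ... | no W⊈ with ⊈-witness W⊈
        ...   | w , w∈ , w∉ = far F-y₃ y₃∉P aQ₃ S⊆W ndW w∈ w∉
        cov {W} S⊆W ndW | yes W⊆ | yes W⊆′ with W ⊆? P
        ... | yes W⊆P = A-resp (≐-sym (resp ndW (⊆⇒≐ W⊆P))) aP
        ... | no W⊈P = ⊥-elim (y₃∉ (bwd (caps-meet W⊈P ext-⊆ W⊆ ext-⊆ W⊆′) ! ext-∈))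

    opaque
      avoid : ∀ {X : Pre} {S : Edge} {x y a} → X ⊆ S → (x∉ : x ∉ₛ S) (x∉X : x ∉ₛ X) (y∉S : y ∉ₛ S) → y ∉ₛ ext S x x∉ → Full x → Full y →
        CovA a (ext X x x∉X) → ¬ f (ext S y y∉S) ∈A a
      avoid {X} {S} {x} {y} X⊆S x∉ x∉X y∉S y∉ F-x F-y ca p
        with full-cap₂ {X} {ext (ext S x x∉) y y∉} x∉X (λ h → y∉ (ext-least (⊆-trans X⊆S ext-⊆) ext-∈ ! h)) F-x F-y (⊆-trans X⊆S (⊆-trans ext-⊆ ext-⊆)) (ext-⊆ ! ext-∈) ext-∈
      ... | b , cb , _ with preimage (full-ND F-x ext-∈) (ext-least (⊆-trans X⊆S (⊆-trans ext-⊆ ext-⊆)) (ext-⊆ ! ext-∈)) ca cb p (cb (ext-least (⊆-trans ext-⊆ ext-⊆) ext-∈) (full-ND F-y ext-∈))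
      ...   | W , X+x⊆W , W⊆T , e = y∉ (swap-∈ (fwd (f-top W⊆T (ext-least (⊆-trans ext-⊆ ext-⊆) ext-∈) (full-ND F-x (X+x⊆W ! ext-∈)) (full-ND F-y ext-∈) e) ! (X+x⊆W ! ext-∈)))
        where
        swap-∈ : x ∈ₛ ext S y y∉S → y ∈ₛ ext S x x∉
        swap-∈ h = eqdim (ext-least {x∉ = x∉} {U = ext S y y∉S} ext-⊆ h) ! ext-∈

      -- Let X = S₁ ∩ S₂ and x be full. If the blocks coincided, they would contain f(S₁ + ⟨x⟩) and
      -- f(S₂ + ⟨x⟩) and so be the block of X + ⟨x⟩, against `avoid`.
      sep-all : ∀ {S₁ S₂ : Edge} {U₀ : Vtx} {a₁ a₂} → S₁ ⊆ U₀ → S₂ ⊆ U₀ → S₂ ⊈ S₁ → CovA a₁ S₁ → CovA a₂ S₂ →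
        ∀ {v w} → v ~ w → v ∈A a₁ → w ∈A a₁ → v ∈A a₂ → w ∈A a₂ → ⊥
      sep-all {S₁} {S₂} {U₀} {a₁} {a₂} s₁ s₂ S₂⊈S₁ c₁ c₂ v~w v₁ w₁ v₂ w₂ with meet s₁ s₂ S₂⊈S₁ | full-outside k<n U₀
      ... | X , X⊆S₁ , X⊆S₂ | x , F-x , x∉ with full-outside k<n (ext S₂ x (λ p → x∉ (s₂ ! p))) | edgeA (full-ND {S = ext X x (λ p → x∉ (s₁ ! (X⊆S₁ ! p)))} F-x ext-∈)
      ...   | y , F-y , y∉ | a , ca = avoid X⊆S₂ (λ p → x∉ (s₂ ! p)) _ (λ p → y∉ (ext-⊆ ! p)) y∉ F-x F-y ca
              (A-uniq (hom ndP₁ ndP₂ (star-adj {S = X+x} X⊆P₁ X⊆P₂ P₁≭P₂)) (A-uniq v~w v₁ w₁ v₂ w₂ (c₁ ext-⊆ ndP₁)) (c₂ ext-⊆ ndP₂) (ca X⊆P₁ ndP₁) (ca X⊆P₂ ndP₂) (c₂ ext-⊆ (full-ND F-y ext-∈)))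
        where
        X+x : Edge
        X+x = ext X x (λ p → x∉ (s₁ ! (X⊆S₁ ! p)))
        P₁ P₂ : Vtx
        P₁ = ext S₁ x (λ p → x∉ (s₁ ! p))
        P₂ = ext S₂ x (λ p → x∉ (s₂ ! p))
        ndP₁ : ND J P₁
        ndP₁ = full-ND F-x ext-∈
        ndP₂ : ND J P₂
        ndP₂ = full-ND F-x ext-∈
        X⊆P₁ : X+x ⊆ P₁
        X⊆P₁ = ext-least (⊆-trans X⊆S₁ ext-⊆) ext-∈
        X⊆P₂ : X+x ⊆ P₂
        X⊆P₂ = ext-least (⊆-trans X⊆S₂ ext-⊆) ext-∈
        P₁≭P₂ : ¬ P₁ ≐ P₂
        P₁≭P₂ e = x∉ (bwd (edges-span S₂⊈S₁ s₁ s₂ ext-⊆ (⊆-trans ext-⊆ (bwd e))) ! ext-∈)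

    -- Describes the value at U without the auxiliary vectors that produce it, so that it depends on
    -- U as a subspace only.
    Spec : Vtx → Vtx → Set
    Spec U v = ∀ {S a} → S ⊆ U → CovA a S → v ∈A a

    opaque
      spec-unique : ∀ {U v w} → Spec U v → Spec U w → v ≐ w
      spec-unique {U} {v} {w} p p′ with second-edge {tailSp U} {U} tailSp-⊆
      ... | S′ , S′⊆U , S′⊈ , _ with edge-cover (tailSp U) | edge-cover S′
      ...   | a₁ , c₁ | a₂ , c₂ = decidable-stable (v ≐? w) (λ h → sep-all tailSp-⊆ S′⊆U S′⊈ c₁ c₂
              (A-adj (p tailSp-⊆ c₁) (p′ tailSp-⊆ c₁) h) (p tailSp-⊆ c₁) (p′ tailSp-⊆ c₁) (p S′⊆U c₂) (p′ S′⊆U c₂))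

    Determined : Vtx → Vtx → Set
    Determined U v = ∀ w → (∀ {T : Cap} → U ⊆ T → ∀ P → P ⊆ T → ND J P → w ~ f P) → w ≐ v

    opaque
      -- Since u vanishes at i, a full x with x + u full may be changed at i to any other nonzero
      -- entry and x + u stays full.
      vanishing : (U : Vtx) (i : Fin n) → Σ Pre λ X → (X ⊆ U) × ∃ λ u → u ∈ₛ U × u ∉ₛ X × u i ≈ 0#
      vanishing U i with fam U zero i ≟ 0#
      ... | yes a≈0 = tailSp (tailSp U) , ⊆-trans tailSp-⊆ tailSp-⊆ , fam U zero , gen U zero , (λ p → head-∉ U (tailSp-⊆ ! p)) , a≈0
      ... | no a≉0 = X , ⊆-trans tailSp-⊆ tailSp-⊆ , u , IsSub.sub (isSub U) (gen U (suc zero)) (IsSub.scale (isSub U) c (gen U zero)) , u∉ , u≈0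
        where
        X : Pre
        X = tailSp (tailSp U)
        c : Carrier
        c = fam U (suc zero) i * inv (fam U zero i) a≉0
        u : Vect
        u = fam U (suc zero) -ᵥ c · fam U zero
        u≈0 : u i ≈ 0#
        u≈0 = trans (+-congˡ (-‿cong (trans (*-assoc _ _ _) (trans (*-congˡ (inv-* _ a≉0)) (*-identityʳ _))))) (-‿inverseʳ _)
        u∉ : u ∉ₛ X
        u∉ p with c ≟ 0#
        ... | yes c≈0 = head-∉ (tailSp U) (IsSub.resp (isSub X) {u} (λ l → trans (+-congˡ (-‿cong (*-congʳ c≈0))) (solve 2 (λ x v → x :- con (+ 0) :* v := x) refl _ _)) p)
        ... | no c≉0 = head-∉ U (IsSub.uncomb (isSub (tailSp U)) {c} {fam U zero} {0ᵥ} {fam U (suc zero) -ᵥ u} c≉0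
                (λ l → solve 3 (λ b c a → b :- (b :- c :* a) := c :* a :+ con (+ 0)) refl _ _ _) (IsSub.sub (isSub (tailSp U)) (gen (tailSp U) zero) (tailSp-⊆ ! p)) (IsSub.nil (isSub (tailSp U))))

    opaque
      -- U lies in some C_m, which contains no full vector. The vectors x and y differ at i alone,
      -- where 𝕖 i is outside U + ⟨𝕖 m⟩. Of U, 𝕖 i and x only x is nonzero at m, so 𝕖 i, and hence
      -- y, is outside U + ⟨x⟩.
      degenerate : ∀ U → ¬ ND J U → ∃ λ v → Spec U v × Determined U v
      degenerate U ¬nd with in-hyperplane ¬nd
      ... | m , U⊂ with 𝕖-outside k+1<n (ext U (𝕖 m) (λ p → 0≉1 (trans (sym (U⊂ p)) (𝕖-diag m))))
      ...   | i , e∉ with vanishing U i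
      ...     | X , X⊆U , u , u∈ , u∉ , uᵢ≈0 with full-pair u
      ...       | x , F-x , F-xu with third (x i)
      ...         | c , c≉0 , c≉xᵢ = v , spec , determined
        where
        y : Vect
        y = update x i c
        F-y : Full y
        F-y = update-full F-x c≉0
        i≢m : ¬ i ≡ m
        i≢m ≡.refl = e∉ ext-∈
        F-yu : Full (y +ᵥ u)
        F-yu j e with i Fₚ.≟ j
        ... | yes ≡.refl = c≉0 (trans (sym (trans (+-cong (update-at x i c) uᵢ≈0) (+-identityʳ c))) e)
        ... | no i≢j = F-xu j (trans (+-congʳ (sym (update-off x c i≢j))) e)
        x∉ : x ∉ₛ U
        x∉ p = F-x m (U⊂ p)
        y∉ : y ∉ₛ U
        y∉ p = F-y m (U⊂ p)
        y∉U+x : y ∉ₛ ext U x x∉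
        y∉U+x = update-∉ ext-∈ e∉U+x c≉xᵢ
          where
          e∉U+x : 𝕖 i ∉ₛ ext U x x∉
          e∉U+x p with ext-inv p
          ... | α , s , s∈ , e with α ≟ 0#
          ...   | yes α≈0 = e∉ (ext-⊆ ! IsSub.resp (isSub U) {s} (λ l → sym (trans (e l) (trans (+-congʳ (trans (*-congʳ α≈0) (zeroˡ _))) (+-identityˡ _)))) s∈)
          ...   | no α≉0 = *-≉0 α≉0 (F-x m) (trans (sym (trans (e m) (trans (+-congˡ (U⊂ s∈)) (+-identityʳ _)))) (𝕖-off i≢m))
        Tx Ty : Cap
        Tx = ext U x x∉
        Ty = ext U y y∉
        X+u⊆U : ext X u u∉ ⊆ U
        X+u⊆U = ext-least X⊆U u∈
        capx : Cap-cover Tx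
        capx = full-cap {X} (⊆-trans X⊆U ext-⊆) u∉ (λ p → x∉ (X+u⊆U ! p)) F-x F-xu ext-∈ (ext-⊆ ! u∈)
        capy : Cap-cover Ty
        capy = full-cap {X} (⊆-trans X⊆U ext-⊆) u∉ (λ p → y∉ (X+u⊆U ! p)) F-y F-yu ext-∈ (ext-⊆ ! u∈)
        via : (S : Edge) (S⊆U : S ⊆ U) →
          (∃ λ v → v ∈B proj₁ capx × v ∈B proj₁ capy × (∀ {a} → f (ext S x (λ p → x∉ (S⊆U ! p))) ∈A a → f (ext S y (λ p → y∉ (S⊆U ! p))) ∈A a → v ∈A a)) ×
          (∀ {v w} → v ∈B proj₁ capx → v ∈B proj₁ capy → w ∈B proj₁ capx → w ∈B proj₁ capy → v ≐ w)
        via S S⊆U with second-edge S⊆U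
        ... | S′ , S′⊆U , S′⊈S , X⊆S′ = forget (construct {X = tailSp S} tailSp-⊆ X⊆S′ S⊆U S′⊆U S′⊈S
            x∉ y∉U+x y∉ (λ p → x∉ (S⊆U ! (tailSp-⊆ ! p))) (λ p → y∉ (S⊆U ! (tailSp-⊆ ! p))) (full-ND F-x ext-∈) (full-ND F-y ext-∈)
            (proj₁ (proj₂ capx)) (proj₁ (proj₂ capy)))
          where
          forget : ∀ {A₁ A₂ A₃ : Vtx → Set} {A₄ : Vtx → Set} {B₁ B₂ : Set} → (∃ λ v → A₁ v × A₂ v × A₃ v × A₄ v) × B₁ × B₂ → (∃ λ v → A₁ v × A₂ v × A₃ v) × B₁
          forget ((v , p , p′ , r , _) , s , _) = (v , p , p′ , r) , s
        v : Vtx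
        v = proj₁ (proj₁ (via (tailSp U) tailSp-⊆))
        vx : v ∈B proj₁ capx
        vx = proj₁ (proj₂ (proj₁ (via (tailSp U) tailSp-⊆)))
        vy : v ∈B proj₁ capy
        vy = proj₁ (proj₂ (proj₂ (proj₁ (via (tailSp U) tailSp-⊆))))
        unique : ∀ {v w} → v ∈B proj₁ capx → v ∈B proj₁ capy → w ∈B proj₁ capx → w ∈B proj₁ capy → v ≐ w
        unique = proj₂ (via (tailSp U) tailSp-⊆)
        spec : Spec U v
        spec {S} {a} S⊆U ca with via S S⊆U
        ... | (w , wx , wy , wA) , _ = A-resp (unique wx wy vx vy) (wA (ca ext-⊆ (full-ND F-x ext-∈)) (ca ext-⊆ (full-ND F-y ext-∈)))
        determined : Determined U v
        determined w h = unique (proj₂ (proj₂ capx) w (h ext-⊆)) (proj₂ (proj₂ capy) w (h ext-⊆)) vx vy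

    value : ∀ U → Dec (ND J U) → Vtx
    value U (yes _) = f U
    value U (no h) = proj₁ (degenerate U h)

    g : Vtx → Vtx
    g U = value U (ND? J U)

    opaque
      g-spec : ∀ U → Spec U (g U)
      g-spec U = go (ND? J U)
        where
        go : ∀ d → Spec U (value U d)
        go (yes nd) S⊆U ca = ca S⊆U nd
        go (no h) = proj₁ (proj₂ (degenerate U h))

      agree : ∀ {U} → ND J U → g U ≐ f U
      agree {U} nd = spec-unique (g-spec U) (λ S⊆U ca → ca S⊆U nd)

      g-resp : ∀ {U W} → U ≐ W → g U ≐ g W
      g-resp {U} {W} e = spec-unique (g-spec U) (λ S⊆U ca → g-spec W (⊆-trans S⊆U (fwd e)) ca)

    opaque
      -- Suppose both values are v. Take q + 2 vertices over X + ⟨x⟩: the pencil in U + ⟨x⟩ and one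
      -- that meets W in an edge. Each contains an edge of U or W, so v is in an A-block with its
      -- image. As v is not in the A-block a of X + ⟨x⟩, all the images lie in one B-block, which
      -- meets a in at most q + 1 vertices.
      g-strict : ∀ {U W} → U ~ W → ¬ g U ≐ g W
      g-strict {U} {W} (adj S S⊆U S⊆W U⊈W) same with span-of (adj S S⊆U S⊆W U⊈W)
      ... | T , U⊆T , W⊆T with full-outside k+1<n T
      ...   | x , F-x , x∉T with edgeA (full-ND {S = ext (tailSp S) x (λ p → x∉T (U⊆T ! (S⊆U ! (tailSp-⊆ ! p))))} F-x ext-∈) | ⊈-witness {S = W} {U} (λ h → U⊈W (eqdim h))
      ...     | a , ca | w , w∈ , w∉ = collide (A∩B {a} {β} (f ∘ c) c∈a c∈β)
        where
        v : Vtx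
        v = g U
        X : Pre
        X = tailSp S
        X⊆U : X ⊆ U
        X⊆U = ⊆-trans tailSp-⊆ S⊆U
        x∉U : x ∉ₛ U
        x∉U p = x∉T (U⊆T ! p)
        X+x : Edge
        X+x = ext X x (λ p → x∉T (U⊆T ! (S⊆U ! (tailSp-⊆ ! p))))
        C : Cap
        C = ext U x x∉U
        X+x⊆C : X+x ⊆ C
        X+x⊆C = ext-least (⊆-trans X⊆U ext-⊆) ext-∈
        open Pencil X+x C X+x⊆C using (pen; pen-⊆; pen-inj)
        w∉X+x : w ∉ₛ X+x
        w∉X+x p with ext-inv p
        ... | α , s , s∈ , e with α ≟ 0#
        ...   | yes α≈0 = w∉ (X⊆U ! IsSub.resp (isSub X) {s} (λ l → sym (trans (e l) (trans (+-congʳ (trans (*-congʳ α≈0) (zeroˡ _))) (+-identityˡ _)))) s∈)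
        ...   | no α≉0 = x∉T (IsSub.uncomb (isSub T) α≉0 e (W⊆T ! w∈) (U⊆T ! (X⊆U ! s∈)))
        c : Fin (suc (suc q)) → Vtx
        c zero = ext X+x w w∉X+x
        c (suc i) = pen i
        X+x⊆ : ∀ i → X+x ⊆ c i
        X+x⊆ zero = ext-⊆
        X+x⊆ (suc i) = ext-⊆
        ndc : ∀ i → ND J (c i)
        ndc i = full-ND F-x (X+x⊆ i ! ext-∈)
        w∉C : w ∉ₛ C
        w∉C p with ext-inv p
        ... | α , s , s∈ , e with α ≟ 0#
        ...   | yes α≈0 = w∉ (IsSub.resp (isSub U) {s} (λ l → sym (trans (e l) (trans (+-congʳ (trans (*-congʳ α≈0) (zeroˡ _))) (+-identityˡ _)))) s∈)
        ...   | no α≉0 = x∉T (IsSub.uncomb (isSub T) α≉0 e (W⊆T ! w∈) (U⊆T ! s∈))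
        c-inj : ∀ i j → c i ≐ c j → i ≡ j
        c-inj zero zero e = ≡.refl
        c-inj zero (suc j) e = ⊥-elim (w∉C (pen-⊆ j ! (fwd e ! ext-∈)))
        c-inj (suc i) zero e = ⊥-elim (w∉C (pen-⊆ i ! (bwd e ! ext-∈)))
        c-inj (suc i) (suc j) e = ≡.cong suc (pen-inj i j e)
        fc~ : ∀ i j → ¬ i ≡ j → f (c i) ~ f (c j)
        fc~ i j h = hom (ndc i) (ndc j) (star-adj (X+x⊆ i) (X+x⊆ j) (λ e → h (c-inj i j e)))
        link : ∀ i → Σ Edge λ B → (B ⊆ c i) × (x ∉ₛ B) × (∀ {a′} → CovA a′ B → v ∈A a′)
        link zero = ext X w (λ p → w∉ (X⊆U ! p)) , ext-least (⊆-trans ext-⊆ ext-⊆) ext-∈ , (λ p → x∉T (W⊆T ! (B⊆W ! p))) , λ cb → A-resp (≐-sym same) (g-spec W B⊆W cb)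
          where
          B⊆W : ext X w (λ p → w∉ (X⊆U ! p)) ⊆ W
          B⊆W = ext-least (⊆-trans tailSp-⊆ S⊆W) w∈
        link (suc i) with meet {U = pen i} {W = U} {T = C} (pen-⊆ i) ext-⊆ (λ h → x∉U (eqdim h ! (X+x⊆ (suc i) ! ext-∈)))
        ... | B , B⊆pen , B⊆U = B , B⊆pen , (λ p → x∉U (B⊆U ! p)) , λ cb → g-spec U B⊆U cb
        v-or : ∀ i → ¬ v ≐ f (c i) → v ~ f (c i)
        v-or i h with link i
        ... | B , B⊆ , _ , vB with edge-cover B
        ...   | a′ , cb = A-adj (vB cb) (cb B⊆ (ndc i)) h
        c∈a : ∀ i → f (c i) ∈A a
        c∈a i = ca (X+x⊆ i) (ndc i)
        v∈a⇒ : v ∈A a → ∀ i → v ≐ f (c i)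
        v∈a⇒ va i = decidable-stable (v ≐? f (c i)) contra
          where
          contra : ¬ ¬ v ≐ f (c i)
          contra h with link i
          ... | B , B⊆ , x∉B , vB with edge-cover B
          ...   | a′ , cb = sep-all {S₁ = B} {S₂ = X+x} B⊆ (X+x⊆ i) (λ k → x∉B (k ! ext-∈)) cb ca (A-adj (vB cb) (cb B⊆ (ndc i)) h) (vB cb) (cb B⊆ (ndc i)) va (c∈a i)
        v∉a : ¬ v ∈A a
        v∉a va = ~⇒≭ (fc~ zero (suc zero) (λ ())) (≐-trans (≐-sym (v∈a⇒ va zero)) (v∈a⇒ va (suc zero)))
        v~ : ∀ i → v ~ f (c i)
        v~ i = v-or i (λ e → v∉a (A-resp (≐-sym e) (c∈a i)))
        β : B
        β = proj₁ (B-join (v~ zero))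
        c∈β : ∀ i → f (c i) ∈B β
        c∈β i = [ (λ { ≡.refl → proj₂ (proj₂ (B-join (v~ zero))) }) , (λ r → joined r (B-join r)) ]′ (same-or-adjacent (i Fₚ.≟ zero))
          where
          same-or-adjacent : Dec (i ≡ zero) → (i ≡ zero) ⊎ (f (c zero) ~ f (c i))
          same-or-adjacent (yes e) = inj₁ e
          same-or-adjacent (no i≢0) = inj₂ (fc~ zero i (λ e → i≢0 (≡.sym e)))
          joined : f (c zero) ~ f (c i) → (∃ λ b → f (c zero) ∈B b × f (c i) ∈B b) → f (c i) ∈B β
          joined r (b , p , p′) = [ (λ va → ⊥-elim (v∉a va))
            , (λ vb → B-uniq (v~ zero) vb p (proj₁ (proj₂ (B-join (v~ zero)))) (proj₂ (proj₂ (B-join (v~ zero)))) p′) ]′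
            (clique r (~-sym (v~ zero)) (~-sym (v~ i)) (c∈a zero) (c∈a i) p p′)
        collide : Collide (f ∘ c) → ⊥
        collide (i , j , i≢j , e) = ~⇒≭ (fc~ i j i≢j) e

    extension : Extension G J List.[] f
    extension = record
      { g = g
      ; invariant = record
        { resp = λ _ → g-resp
        ; hom = λ {U} {W} _ _ U~W → hom′ U~W
        ; edgeA = λ {S} _ → proj₁ (edge-cover S) , λ {U} S⊆U _ → g-spec U S⊆U (proj₂ (edge-cover S))
        ; sep = λ _ _ s₁ s₂ ns c₁ c₂ → sep-all s₁ s₂ ns (λ h nd → A-resp (agree nd) (c₁ h All.[])) (λ h nd → A-resp (agree nd) (c₂ h All.[])) }
      ; agree = agree
      ; uniq = λ h h-hom h≐f {U} _ → uniq′ h h-hom h≐f U (ND? J U) }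
      where
      hom′ : ∀ {U W} → U ~ W → g U ~ g W
      hom′ {U} {W} U~W with edge-cover (core U~W)
      ... | a , ca = A-adj (g-spec U (core-l U~W) ca) (g-spec W (core-r U~W) ca) (g-strict U~W)
      uniq′ : ∀ (h : Vtx → Vtx) → (∀ {U W} → U ~ W → h U ~ h W) → (∀ {U} → ND J U → h U ≐ f U) → ∀ U d → h U ≐ value U d
      uniq′ h h-hom h≐f U (yes nd) = h≐f nd
      uniq′ h h-hom h≐f U (no ¬nd) = proj₂ (proj₂ (degenerate U ¬nd)) (h U) (λ U⊆T P P⊆T ndP →
        ~-resp ≐-refl (h≐f ndP) (h-hom (top-adj U⊆T P⊆T (λ e → ¬nd (ND-mono (bwd e) ndP)))))

  compose : ∀ {G m J′ f} (e : Extension G (m List.∷ J′) J′ f) → Extension G J′ List.[] (Extension.g e) → Extension G (m List.∷ J′) List.[] f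
  compose e e′ = record
    { g = E′.g
    ; invariant = E′.invariant
    ; agree = λ nd → ≐-trans (E′.agree (All.tail nd)) (E.agree nd)
    ; uniq = λ h h-hom h≐f _ → E′.uniq h h-hom (λ nd → E.uniq h h-hom h≐f nd) All.[] }
    where
    module E = Extension e
    module E′ = Extension e′

  -- Finiteness: surjective maps of vertices are injective

  bit : ∀ {X : Set} → Dec X → Fin 2
  bit (yes _) = suc zero
  bit (no _) = zero

  char : Vtx → Fin (2 ^ (q ^ n))
  char U = funToFin (λ i → bit (scalars n i ∈? U))

  opaque
    bit-same : ∀ {X Y : Set} (d : Dec X) (d′ : Dec Y) → bit d ≡ bit d′ → X → Y
    bit-same (yes _) (yes y) _ _ = y
    bit-same (no h) _ _ x = ⊥-elim (h x)

    char-inj : ∀ U W → char U ≡ char W → U ≐ W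
    char-inj U W e = ⊆⇒≐ (incl go)
      where
      bits : ∀ i → bit (scalars n i ∈? U) ≡ bit (scalars n i ∈? W)
      bits i = ≡.trans (≡.sym (Fₚ.finToFun-funToFin (λ i → bit (scalars n i ∈? U)) i))
        (≡.trans (≡.cong (λ z → finToFun z i) e) (Fₚ.finToFun-funToFin (λ i → bit (scalars n i ∈? W)) i))
      go : ∀ {x} → x ∈ₛ U → x ∈ₛ W
      go {x} x∈ with scalars-surj {n} x
      ... | i , e′ = IsSub.resp (isSub W) e′ (bit-same (scalars n i ∈? U) (scalars n i ∈? W) (bits i) (IsSub.resp (isSub U) (λ j → sym (e′ j)) x∈))

  iter : (Vtx → Vtx) → ℕ → Vtx → Vtx
  iter h 0ⁿ U = U
  iter h (suc i) U = h (iter h i U)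

  module Iterates (g : Vtx → Vtx) (g-resp : ∀ {U W} → U ≐ W → g U ≐ g W) where
    opaque
      iter-resp : ∀ i {U W} → U ≐ W → iter g i U ≐ iter g i W
      iter-resp 0ⁿ h = h
      iter-resp (suc i) h = g-resp (iter-resp i h)

      iter-comm : ∀ i U → iter g i (g U) ≐ iter g (suc i) U
      iter-comm 0ⁿ U = ≐-refl
      iter-comm (suc i) U = g-resp (iter-comm i U)

      iter-+ : ∀ i j U → iter g (i ℕ.+ j) U ≐ iter g i (iter g j U)
      iter-+ 0ⁿ j U = ≐-refl
      iter-+ (suc i) j U = g-resp (iter-+ i j U)

      iter-* : ∀ i p {U} → iter g p U ≐ U → iter g (i ℕ.* p) U ≐ U
      iter-* 0ⁿ p h = ≐-refl
      iter-* (suc i) p {U} h = ≐-trans (iter-+ p (i ℕ.* p) U) (≐-trans (iter-resp p (iter-* i p h)) h)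

    module _ (surj : ∀ (W : Vtx) → ∃ λ U → g U ≐ W) where
      pre : Vtx → Vtx
      pre W = proj₁ (surj W)

      opaque
        cancel : ∀ i j U → iter g i (iter pre (i ℕ.+ j) U) ≐ iter pre j U
        cancel 0ⁿ j U = ≐-refl
        cancel (suc i) j U = ≐-trans (≐-sym (iter-comm i _)) (≐-trans (iter-resp i (proj₂ (surj _))) (cancel i j U))

        cancel-all : ∀ i U → iter g i (iter pre i U) ≐ U
        cancel-all i U = ≡.subst (λ z → iter g i (iter pre z U) ≐ U) (ℕₚ.+-identityʳ i) (cancel i 0 U)

        -- Two iterated preimages of U coincide, since there are finitely many vertices.
        periodic : ∀ U → ∃ λ p → iter g (suc p) U ≐ U
        periodic U with Fₚ.pigeonhole (ℕₚ.n<1+n (2 ^ (q ^ n))) (λ i → char (iter pre (toℕ i) U))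
        ... | i , j , i<j , eq = r , ≐-trans (iter-resp (suc r) back) (cancel-all (suc r) U)
          where
          r : ℕ
          r = toℕ j ∸ suc (toℕ i)
          j≡ : toℕ i ℕ.+ suc r ≡ toℕ j
          j≡ = ≡.trans (ℕₚ.+-suc (toℕ i) r) (ℕₚ.m+[n∸m]≡n i<j)
          same : iter pre (toℕ i) U ≐ iter pre (toℕ i ℕ.+ suc r) U
          same = ≡.subst (λ z → iter pre (toℕ i) U ≐ iter pre z U) (≡.sym j≡) (char-inj _ _ eq)
          back : U ≐ iter pre (suc r) U
          back = ≐-trans (≐-sym (cancel-all (toℕ i) U)) (≐-trans (iter-resp (toℕ i) same) (cancel (toℕ i) (suc r) U))

        -- If U and W have periods p + 1 and r + 1, the iterate of order (p + 1)(r + 1) fixes both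
        -- and also identifies them.
        surjective⇒injective : ∀ {U W} → g U ≐ g W → U ≐ W
        surjective⇒injective {U} {W} e = conclude (periodic U) (periodic W)
          where
          both : ∀ i → iter g (suc i) U ≐ iter g (suc i) W
          both i = ≐-trans (≐-sym (iter-comm i U)) (≐-trans (iter-resp i e) (iter-comm i W))
          conclude : (∃ λ p → iter g (suc p) U ≐ U) → (∃ λ r → iter g (suc r) W ≐ W) → U ≐ W
          conclude (p , eU) (r , eW) = ≐-trans (≐-sym (iter-* (suc r) (suc p) eU)) (≐-trans (both (p ℕ.+ r ℕ.* suc p))
            (≡.subst (λ z → iter g z W ≐ W) (ℕₚ.*-comm (suc p) (suc r)) (iter-* (suc p) (suc r) eW)))

  -- Bijectivity of the extended map

  module Final (G : Geo) (g : Vtx → Vtx) (inv₀ : Maps.Inv G List.[] g) where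
    open Geo G
    open Maps G List.[] g
    open Core inv₀

    opaque
      onto-star : ∀ {S : Edge} {a v} → CovA a S → v ∈A a → ∃ λ W → (S ⊆ W) × g W ≐ v
      onto-star {S} {a} {v} ca va with Fₚ.any? (λ i → g (StarCode.star {suc k₂} {suc (suc (suc d₂))} S n≡ i) ≐? v)
      ... | yes (i , e) = StarCode.star {suc k₂} {suc (suc (suc d₂))} S n≡ i , ext-⊆ , e
      ... | no ∄ = ⊥-elim (go (A-count {a} h h∈))
        where
        open StarCode {suc k₂} {suc (suc (suc d₂))} S n≡ using (star; point-inj)
        h : Fin (suc (N (suc (suc (suc d₂))))) → Vtx
        h zero = v
        h (suc i) = g (star i)
        h∈ : ∀ i → h i ∈A a
        h∈ zero = va
        h∈ (suc i) = ca ext-⊆ All.[]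
        go : Collide h → ⊥
        go (zero , zero , i≢j , e) = i≢j ≡.refl
        go (zero , suc j , i≢j , e) = ∄ (j , ≐-sym e)
        go (suc i , zero , i≢j , e) = ∄ (i , e)
        go (suc i , suc j , i≢j , e) = i≢j (≡.cong suc (point-inj i j (fwd (f-star {S = S} ext-⊆ ext-⊆ All.[] All.[] e) ! ext-∈)))

      onto-top : ∀ {T : Cap} {b v} → CovB b T → v ∈B b → ∃ λ W → (W ⊆ T) × g W ≐ v
      onto-top {T} {b} {v} cb vb with Fₚ.any? (λ i → g (top T i) ≐? v)
      ... | yes (i , e) = top T i , proj₁ (proj₂ (hyper T i)) , e
      ... | no ∄ = ⊥-elim (go (B-count {b} h h∈))
        where
        h : Fin (suc (N (suc (suc (suc k₂))))) → Vtx
        h zero = v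
        h (suc i) = g (top T i)
        h∈ : ∀ i → h i ∈B b
        h∈ zero = vb
        h∈ (suc i) = cb (proj₁ (proj₂ (hyper T i))) All.[]
        go : Collide h → ⊥
        go (zero , zero , i≢j , e) = i≢j ≡.refl
        go (zero , suc j , i≢j , e) = ∄ (j , ≐-sym e)
        go (suc i , zero , i≢j , e) = ∄ (i , e)
        go (suc i , suc j , i≢j , e) = i≢j (≡.cong suc (top-inj T i j (f-top (proj₁ (proj₂ (hyper T i))) (proj₁ (proj₂ (hyper T j))) All.[] All.[] e)))

      -- Let b be the B-block of g U and v. A further vertex of b in the block of an edge of U is
      -- some g W with W over that edge. The top of U + W maps onto its block, which shares g U and
      -- g W with b and so equals b.
      nbr-onto : ∀ {U v} → g U ~ v → ∃ λ Z → U ~ Z × g Z ≐ v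
      nbr-onto {U} {v} U~v with edgeA {tailSp U} All.[] | B-join U~v | second-edge {tailSp U} {U} tailSp-⊆
      ... | a , ca | b , bU , bv | S′ , S′⊆U , S′⊈ , _ with another (ca tailSp-⊆ All.[]) bU
      ...   | w , wa , wb , U~w with onto-star ca wa
      ...     | W , S⊆W , e with span-of {U} {W} (star-adj tailSp-⊆ S⊆W (λ h → ~⇒≭ U~w (≐-trans (resp All.[] h) e)))
      ...       | T , U⊆T , W⊆T with capB {S₁ = tailSp U} {S₂ = S′} {U₀ = U} {T = T} All.[] All.[] tailSp-⊆ S′⊆U S′⊈ U⊆T
      ...         | b′ , cb , _ with onto-top cb (B-uniq U~w bU wb (cb U⊆T All.[]) (B-resp e (cb W⊆T All.[])) bv)
      ...           | Z , Z⊆T , e′ = Z , top-adj U⊆T Z⊆T (λ h → ~⇒≭ U~v (≐-trans (resp All.[] h) e′)) , e′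

      -- Walk from g W, which is in the image, to W; `nbr-onto` keeps every step in the image.
      g-onto : ∀ (W : Vtx) → ∃ λ U → g U ≐ W
      g-onto W = connected {Z = nilSp} (λ (W : Vtx) → ∃ λ U → g U ≐ W) (λ e (U , p) → U , ≐-trans p e) step (suc (suc k₂)) nilSp {g W} {W} (ℕₚ.+-identityʳ _) ⊆-refl (⊆0 (g W)) (⊆0 W) (W , ≐-refl)
        where
        ⊆0 : (U : Vtx) → nilSp ⊆ U
        ⊆0 U = incl (nilSp-least (isSub U) _)
        step : ∀ (S : Edge) {U W : Vtx} → nilSp ⊆ S → S ⊆ U → S ⊆ W → (∃ λ V → g V ≐ U) → ∃ λ V → g V ≐ W
        step S {U} {W} _ S⊆U S⊆W (V , e) = go (U ≐? W)
          where
          go : Dec (U ≐ W) → ∃ λ V → g V ≐ W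
          go (yes e′) = V , ≐-trans e e′
          go (no ne) = let Z , _ , e′ = nbr-onto {V} {W} (~-resp (≐-sym e) ≐-refl (star-adj S⊆U S⊆W ne)) in Z , e′

      g-inj : ∀ {U W} → g U ≐ g W → U ≐ W
      g-inj = Iterates.surjective⇒injective g (resp All.[]) g-onto

      g-reflects : ∀ {U W} → g U ~ g W → U ~ W
      g-reflects {U} {W} h = go (nbr-onto h)
        where
        go : (∃ λ Z → U ~ Z × g Z ≐ g W) → U ~ W
        go (Z , U~Z , e) = ~-resp ≐-refl (g-inj e) U~Z

  -- Translation to the definitions of the theorem; field elements and q

  module Gn = Grassmann F n (suc (suc k₂))

  J₀ : List (Fin n)
  J₀ = List.allFin n

  opaque
    toSp : Gn.Gr → Vtx
    toSp U = sp (Gn.Gr.basis U) (LinIndep⇒Ind {vs = Gn.Gr.basis U} (Gn.Gr.indep U))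

    toGr : Vtx → Gn.Gr
    toGr U = Gn.gr (fam U) (Ind⇒LinIndep {vs = fam U} (ind U))

    ≐⇒≈ : ∀ U W → toSp U ≐ toSp W → U Gn.≈ₛ W
    ≐⇒≈ U W e x = (λ p → coeffs (un (fwd e ! ⟨ ⟪ p ⟫ ⟩))) , (λ p → coeffs (un (bwd e ! ⟨ ⟪ p ⟫ ⟩)))

    ≈⇒≐ : ∀ U W → U Gn.≈ₛ W → toSp U ≐ toSp W
    ≈⇒≐ U W e = incl (λ {x} p → ⟨ ⟪ proj₁ (e x) (coeffs (un p)) ⟫ ⟩) , incl (λ {x} p → ⟨ ⟪ proj₂ (e x) (coeffs (un p)) ⟫ ⟩)

    to-from : ∀ U → toSp (toGr U) ≐ U
    to-from U = incl (λ p → ⟨ un p ⟩) , incl (λ p → ⟨ un p ⟩)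

    ~⇒Adj : ∀ U W → toSp U ~ toSp W → Gn.Adj U W
    ~⇒Adj U W (adj S a b c) = fam S , Ind⇒LinIndep {vs = fam S} (ind S) , (λ j → coeffs (un (a ! gen S j)) , coeffs (un (b ! gen S j))) , spans
      where
      spans : ∀ x → x Gn.∈ U × x Gn.∈ W → x Gn.∈Span fam S
      spans x (p , p′) = coeffs (un (decidable-stable (x ∈? S) (λ x∉ → c (⊆-trans (ext-hyper {x∉ = x∉} a ⟨ ⟪ p ⟫ ⟩) (ext-least b ⟨ ⟪ p′ ⟫ ⟩)))))

    Adj⇒~ : ∀ U W → Gn.Adj U W → toSp U ~ toSp W
    Adj⇒~ U W (vs , li , inside , spans) = adj S (incl (least S (isSub (toSp U)) (λ j → ⟨ ⟪ proj₁ (inside j) ⟫ ⟩))) (incl (least S (isSub (toSp W)) (λ j → ⟨ ⟪ proj₂ (inside j) ⟫ ⟩)))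
        (λ h → ℕₚ.<⇒≱ ℕₚ.≤-refl (⊆-dim {S = toSp U} {S} (incl (λ {x} p → ⟨ ⟪ spans x (coeffs (un p) , coeffs (un (h ! p))) ⟫ ⟩))))
      where
      S : Edge
      S = sp vs (LinIndep⇒Ind {vs = vs} li)

    ND⇒NonDeg : ∀ U → ND J₀ (toSp U) → Gn.NonDegenerate U
    ND⇒NonDeg U nd i deg with All.lookup nd (∈-allFin i)
    ... | x , x∈ , x≉ = x≉ (deg x (coeffs (un x∈)))

    NonDeg⇒ND : ∀ U → Gn.NonDegenerate U → ND J₀ (toSp U)
    NonDeg⇒ND U nd = All.tabulate (λ {i} _ → decidable-stable (Hits? i (toSp U)) (λ ¬h → nd i (λ x p → ¬Hits {S = toSp U} ¬h ⟨ ⟪ p ⟫ ⟩)))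

  three : Carrier → Fin 3 → Carrier
  three ω zero = 0#
  three ω (suc zero) = 1#
  three ω (suc (suc zero)) = ω

  opaque
    third-or-binary : (∃ λ ω → ¬ ω ≈ 0# × ¬ ω ≈ 1#) ⊎ (∀ x → (x ≈ 0#) ⊎ (x ≈ 1#))
    third-or-binary with searchᶜ {λ ω → ¬ ω ≈ 0# × ¬ ω ≈ 1#} (λ e (p , p′) → (λ h → p (trans e h)) , (λ h → p′ (trans e h))) (λ x → ¬? (x ≟ 0#) ×-dec ¬? (x ≟ 1#))
    ... | yes r = inj₁ r
    ... | no ∄ = inj₂ go
      where
      go : ∀ x → (x ≈ 0#) ⊎ (x ≈ 1#)
      go x with x ≟ 0# | x ≟ 1#
      ... | yes p | _ = inj₁ p
      ... | no _ | yes p = inj₂ p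
      ... | no p | no p′ = ⊥-elim (∄ (x , p , p′))

    binary⇒q≤2 : (∀ x → (x ≈ 0#) ⊎ (x ≈ 1#)) → ¬ 3 ≤ q
    binary⇒q≤2 bin 3≤q with Fₚ.pigeonhole 3≤q (λ i → code (bin (enum i)))
      where
      code : ∀ {x} → (x ≈ 0#) ⊎ (x ≈ 1#) → Fin 2
      code (inj₁ _) = zero
      code (inj₂ _) = suc zero
    ... | i , j , i<j , e with bin (enum i) | bin (enum j)
    ...   | inj₁ p | inj₁ p′ = Fₚ.<⇒≢ i<j (enum-injective i j (trans p (sym p′)))
    ...   | inj₂ p | inj₂ p′ = Fₚ.<⇒≢ i<j (enum-injective i j (trans p (sym p′)))
    binary⇒q≤2 bin 3≤q | i , j , i<j , () | inj₁ p | inj₂ p′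
    binary⇒q≤2 bin 3≤q | i , j , i<j , () | inj₂ p | inj₁ p′

    q≡2⇒binary : q ≡ 2 → ∀ x → (x ≈ 0#) ⊎ (x ≈ 1#)
    q≡2⇒binary q≡2 with third-or-binary
    ... | inj₂ b = b
    ... | inj₁ (ω , ω≉0 , ω≉1) with Fₚ.pigeonhole (ℕₚ.≤-reflexive (≡.cong suc q≡2)) (λ i → proj₁ (enum-surjective (three ω i)))
    ...   | i , j , i<j , e = ⊥-elim (clash i j i<j (trans (sym (proj₂ (enum-surjective _))) (trans (reflexive (≡.cong enum e)) (proj₂ (enum-surjective _)))))
      where
      clash : ∀ i j → i Fin.< j → ¬ three ω i ≈ three ω j
      clash zero (suc zero) _ h = 0≉1 h
      clash zero (suc (suc zero)) _ h = ω≉0 (sym h)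
      clash (suc zero) (suc (suc zero)) _ h = ω≉1 (sym h)
      clash (suc zero) (suc zero) (s≤s ())
      clash (suc (suc zero)) (suc zero) (s≤s ())
      clash (suc (suc zero)) (suc (suc zero)) (s≤s (s≤s ()))

-- The first star when n < 2k

module FirstEdgeLarge (F : Field) (q : ℕ) (hs : HasSize F q) (n k₃ d₂ : ℕ) (n≡ : suc (suc (suc d₂)) ℕ.+ suc (suc k₃) ≡ n)
  (d₂<k₂ : d₂ < suc k₃) (tp : TwoPartitions n k₃) where
  open Grassmannian F q hs n (suc k₃) d₂ n≡
  open Geo star-top
  open TwoPartitions tp

  K : ℕ
  K = suc (suc (suc k₃))

  0≢1+ : ∀ {m} {j : Fin m} → ¬ zero ≡ suc j
  0≢1+ ()

  -- Besides the hyperplanes not containing the first class vector there are at least two more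
  -- non-degenerate ones.
  module Family (cl : Fin n → Fin (suc K)) (σ : Fin (suc K) → Fin n) (sec : ∀ j → cl (σ j) ≡ j) (J : List (Fin n)) where
    open Classes cl σ sec public

    T : Cap
    T = clSp

    swap : Fin (suc K) → Fin (suc K)
    swap zero = suc zero
    swap (suc zero) = zero
    swap (suc (suc j)) = suc (suc j)

    swap² : ∀ j → swap (swap j) ≡ j
    swap² zero = ≡.refl
    swap² (suc zero) = ≡.refl
    swap² (suc (suc j)) = ≡.refl

    module C′ = Classes (swap ∘ cl) (σ ∘ swap) (λ j → ≡.trans (≡.cong swap (sec (swap j))) (swap² j))

    opaque
      δ-swap : ∀ i j → δ (swap i) j ≈ δ i (swap j)
      δ-swap i j with i Fₚ.≟ swap j
      ... | yes ≡.refl = trans (≡.subst (λ z → δ z j ≈ 1#) (≡.sym (swap² j)) (δ-refl j)) (sym (δ-refl (swap j)))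
      ... | no h = trans (δ-≢ (λ e → h (≡.trans (≡.sym (swap² i)) (≡.cong swap e)))) (sym (δ-≢ h))

      C′⊆T : C′.clSp ⊆ T
      C′⊆T = incl (least C′.clSp (isSub T) (λ j → IsSub.resp (isSub T) (λ i → sym (δ-swap (cl i) j)) (gen T (swap j))))

    unit : Fin K → Fin K → Carrier
    unit = δ

    -- With the first two class vectors exchanged, a hyperplane missing t₁ may contain t₀, and does
    -- for j ≠ 0. Two of these raise the count from the q^K - 1 given by c ≠ 0 to q^K + 1.
    Extra : Fin K → Vtx
    Extra j = hypSp C′.clSp (unit j)

    opaque
      t₀∈Extra : ∀ j → ¬ j ≡ zero → fam T zero ∈ₛ Extra j
      t₀∈Extra j j≢0 = IsSub.resp (isSub (Extra j)) {hyp C′.ind-vec (unit j) zero}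
        (λ i → trans (+-cong (δ-swap (cl i) (suc zero)) (-‿cong (*-congʳ (δ-≢ j≢0)))) (solve 2 (λ a b → a :- con (+ 0) :* b := a) refl _ _))
        (gen (Extra j) zero)

      Extra-ND : ∀ j → ND J (Extra j)
      Extra-ND j = hyp-ND (swap ∘ cl) (σ ∘ swap) _ (unit j) (λ h → 0≉1 (trans (sym (h j)) (δ-refl j)))

    all0? : (c : Fin K → Carrier) → Dec (∀ j → c j ≈ 0#)
    all0? c = Fₚ.all? (λ j → c j ≟ 0#)

    pick : (c : Fin K → Carrier) → Dec (∀ j → c j ≈ 0#) → Vtx
    -- For c = 0 the hyperplane vanishes on class zero, so its index is reused.
    pick c (yes _) = Extra (suc zero)
    pick c (no _) = hypSp T c

    member : Fin (suc (q ^ K)) → Vtx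
    member zero = Extra (suc (suc zero))
    member (suc i) = pick (scalars K i) (all0? (scalars K i))

    opaque
      Extra-⊆ : ∀ j → Extra j ⊆ T
      Extra-⊆ j = ⊆-trans (hypSp-⊆ C′.clSp (unit j)) C′⊆T

      pick-⊆ : ∀ c d → pick c d ⊆ T
      pick-⊆ c (yes _) = Extra-⊆ (suc zero)
      pick-⊆ c (no _) = hypSp-⊆ T c

      member-⊆ : ∀ i → member i ⊆ T
      member-⊆ zero = Extra-⊆ (suc (suc zero))
      member-⊆ (suc i) = pick-⊆ (scalars K i) (all0? (scalars K i))

      pick-ND : ∀ c d → ND J (pick c d)
      pick-ND c (yes _) = Extra-ND (suc zero)
      pick-ND c (no h) = hyp-ND cl σ sec c h

      member-ND : ∀ i → ND J (member i)
      member-ND zero = Extra-ND (suc (suc zero))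
      member-ND (suc i) = pick-ND (scalars K i) (all0? (scalars K i))

    opaque
      no-t₀ : ∀ c → fam T zero ∉ₛ hypSp T c
      no-t₀ c = hypSp-∉ T c

      pick-inj : ∀ c c′ d d′ → pick c d ≐ pick c′ d′ → ∀ j → c j ≈ c′ j
      pick-inj c c′ (yes p) (yes p′) e j = trans (p j) (sym (p′ j))
      pick-inj c c′ (yes p) (no p′) e j = ⊥-elim (no-t₀ c′ (fwd e ! t₀∈Extra (suc zero) (λ ())))
      pick-inj c c′ (no p) (yes p′) e j = ⊥-elim (no-t₀ c (bwd e ! t₀∈Extra (suc zero) (λ ())))
      pick-inj c c′ (no p) (no p′) e = hyp-inj T c c′ e

      Extra≢pick : ∀ c d → ¬ Extra (suc (suc zero)) ≐ pick c d
      Extra≢pick c (yes p) e = 0≉1 (trans (sym (δ-≢ (λ ()))) (trans (sym (hyp-inj C′.clSp (unit (suc (suc zero))) (unit (suc zero)) e (suc (suc zero)))) (δ-refl (suc (suc zero)))))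
      Extra≢pick c (no p) e = no-t₀ c (fwd e ! t₀∈Extra (suc (suc zero)) (λ ()))

      member-inj : ∀ i j → member i ≐ member j → i ≡ j
      member-inj zero zero e = ≡.refl
      member-inj zero (suc j) e = ⊥-elim (Extra≢pick _ _ e)
      member-inj (suc i) zero e = ⊥-elim (Extra≢pick _ _ (≐-sym e))
      member-inj (suc i) (suc j) e = ≡.cong suc (scalars-inj i j (pick-inj _ _ (all0? (scalars K i)) (all0? (scalars K j)) e))

      member-hits : ∀ c → ¬ (∀ j → c j ≈ 0#) → ∃ λ i → member i ≐ hypSp T c
      member-hits c c≉0 with scalars-surj c
      ... | i , e = suc i , go (all0? (scalars K i))
        where
        go : ∀ d → pick (scalars K i) d ≐ hypSp T c
        go (yes p) = ⊥-elim (c≉0 (λ j → trans (sym (e j)) (p j)))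
        go (no p) = hyp-cong T e

  opaque
    δ-merge : ∀ (z : Fin (suc K)) → δ (merge z) zero ≈ δ z zero + (δ z (suc zero) + δ z (suc (suc zero)))
    δ-merge zero = trans (δ-refl zero) (sym (trans (+-cong (δ-refl zero) (+-cong (δ-≢ (λ ())) (δ-≢ (λ ())))) (solve 0 (con (+ 1) :+ (con (+ 0) :+ con (+ 0)) := con (+ 1)) refl)))
    δ-merge (suc zero) = trans (δ-refl zero) (sym (trans (+-cong (δ-≢ (λ ())) (+-cong (δ-refl (suc zero)) (δ-≢ (λ ())))) (solve 0 (con (+ 0) :+ (con (+ 1) :+ con (+ 0)) := con (+ 1)) refl)))
    δ-merge (suc (suc zero)) = trans (δ-refl zero) (sym (trans (+-cong (δ-≢ (λ ())) (+-cong (δ-≢ (λ ())) (δ-refl (suc (suc zero))))) (solve 0 (con (+ 0) :+ (con (+ 0) :+ con (+ 1)) := con (+ 1)) refl)))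
    δ-merge (suc (suc (suc j))) = trans (δ-≢ (λ ())) (sym (trans (+-cong (δ-≢ (λ ())) (+-cong (δ-≢ (λ ())) (δ-≢ (λ ())))) (solve 0 (con (+ 0) :+ (con (+ 0) :+ con (+ 0)) := con (+ 0)) refl)))

    δ-merge′ : ∀ (z : Fin (suc K)) j → δ (merge z) (suc j) ≈ δ z (suc (suc (suc j)))
    δ-merge′ zero j = trans (δ-≢ (λ ())) (sym (δ-≢ (λ ())))
    δ-merge′ (suc zero) j = trans (δ-≢ (λ ())) (sym (δ-≢ (λ ())))
    δ-merge′ (suc (suc zero)) j = trans (δ-≢ (λ ())) (sym (δ-≢ (λ ())))
    δ-merge′ (suc (suc (suc i))) j with i Fₚ.≟ j
    ... | yes ≡.refl = trans (δ-refl (suc i)) (sym (δ-refl (suc (suc (suc i)))))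
    ... | no h = trans (δ-≢ (λ e → h (Fₚ.suc-injective e))) (sym (δ-≢ (λ e → h (Fₚ.suc-injective (Fₚ.suc-injective (Fₚ.suc-injective e))))))

  mergeσ : Fin (suc (suc k₃)) → Fin (suc K)
  mergeσ zero = zero
  mergeσ (suc j) = suc (suc (suc j))

  merge-mergeσ : ∀ j → merge (mergeσ j) ≡ j
  merge-mergeσ zero = ≡.refl
  merge-mergeσ (suc j) = ≡.refl

  module Coarse = Classes (merge ∘ cl₀) (σ₀ ∘ mergeσ) (λ j → ≡.trans (≡.cong merge (sec₀ (mergeσ j))) (merge-mergeσ j))

  S₁ : Edge
  S₁ = Coarse.clSp

  -- With this c the generators are the later class vectors, except that t₀ is added to number l +
  -- 1. For l = 0, 1 the hyperplane contains t₀ + t₁ + t₂, hence S₁.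
  minus : Fin K → Fin K → Carrier
  minus l j = - δ l j

  opaque
    minus≉0 : ∀ l → ¬ (∀ j → minus l j ≈ 0#)
    minus≉0 l h = 0≉1 (trans (trans (solve 0 (con (+ 0) := :- con (+ 0)) refl) (-‿cong (sym (h l)))) (trans (solve 1 (λ a → :- (:- a) := a) refl _) (δ-refl l)))

  module Sub (cl : Fin n → Fin (suc K)) (σ : Fin (suc K) → Fin n) (sec : ∀ j → cl (σ j) ≡ j) (agree : ∀ i → merge (cl₀ i) ≡ merge (cl i)) where
    open Classes cl σ sec

    private
      opaque
        coarse₀ : ∀ i → δ (merge (cl₀ i)) zero ≈ δ (cl i) zero + (δ (cl i) (suc zero) + δ (cl i) (suc (suc zero)))
        coarse₀ i = trans (reflexive (≡.cong (λ z → δ z zero) (agree i))) (δ-merge (cl i))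
        coarse′ : ∀ i j → δ (merge (cl₀ i)) (suc j) ≈ δ (cl i) (suc (suc (suc j)))
        coarse′ i j = trans (reflexive (≡.cong (λ z → δ z (suc j)) (agree i))) (δ-merge′ (cl i) j)

    opaque
      in₁ : S₁ ⊆ hypSp clSp (minus zero)
      in₁ = incl (least S₁ (isSub W) gens)
        where
        W : Vtx
        W = hypSp clSp (minus zero)
        gens : ∀ j → fam S₁ j ∈ₛ W
        gens zero = IsSub.resp (isSub W) (λ i → trans (+-cong (+-congˡ (-‿cong (*-congʳ (-‿cong (δ-refl zero))))) (+-congˡ (-‿cong (*-congʳ (-‿cong (δ-≢ (λ ())))))))
            (trans (solve 3 (λ a b c → (b :- (:- con (+ 1)) :* a) :+ (c :- (:- con (+ 0)) :* a) := a :+ (b :+ c)) refl _ _ _) (sym (coarse₀ i))))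
          (IsSub.add (isSub W) (gen W zero) (gen W (suc zero)))
        gens (suc j) = IsSub.resp (isSub W) (λ i → trans (+-congˡ (-‿cong (*-congʳ (-‿cong (δ-≢ (λ ()))))))
            (trans (solve 2 (λ a b → b :- (:- con (+ 0)) :* a := b) refl _ _) (sym (coarse′ i j)))) (gen W (suc (suc j)))

      in₂ : S₁ ⊆ hypSp clSp (minus (suc zero))
      in₂ = incl (least S₁ (isSub W) gens)
        where
        W : Vtx
        W = hypSp clSp (minus (suc zero))
        gens : ∀ j → fam S₁ j ∈ₛ W
        gens zero = IsSub.resp (isSub W) (λ i → trans (+-cong (+-congˡ (-‿cong (*-congʳ (-‿cong (δ-≢ (λ ())))))) (+-congˡ (-‿cong (*-congʳ (-‿cong (δ-refl (suc zero)))))))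
            (trans (solve 3 (λ a b c → (b :- (:- con (+ 0)) :* a) :+ (c :- (:- con (+ 1)) :* a) := a :+ (b :+ c)) refl _ _ _) (sym (coarse₀ i))))
          (IsSub.add (isSub W) (gen W zero) (gen W (suc zero)))
        gens (suc j) = IsSub.resp (isSub W) (λ i → trans (+-congˡ (-‿cong (*-congʳ (-‿cong (δ-≢ (λ ()))))))
            (trans (solve 2 (λ a b → b :- (:- con (+ 0)) :* a := b) refl _ _) (sym (coarse′ i j)))) (gen W (suc (suc j)))

  module Go (J : List (Fin n)) (f : Vtx → Vtx) (emb : Embedding J f) where
    open Embedding emb
    open Search J f emb

    module M₀ = Family cl₀ σ₀ sec₀ J
    module M₁ = Family cl₁ σ₁ sec₁ J

    module Type (cl : Fin n → Fin (suc K)) (σ : Fin (suc K) → Fin n) (sec : ∀ j → cl (σ j) ≡ j) where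
      open Family cl σ sec J
      opaque
        le : suc (N (suc (suc (suc d₂)))) ≤ suc (q ^ K)
        le = s≤s (ℕₚ.≤-trans N≤N (N-≤ K))
          where
          N≤N : N (suc (suc (suc d₂))) ≤ N K
          N≤N with ℕₚ.m≤n⇒m<n∨m≡n d₂<k₂
          ... | inj₁ l = ℕₚ.<⇒≤ (N-< (s≤s (s≤s l)))
          ... | inj₂ ≡.refl = ℕₚ.≤-refl

        -- The q^K + 1 members are too many for a star, since d₂ + 3 ≤ K gives N (d₂ + 3) ≤ N K ≤
        -- q^K.
        capType : ∃ λ b → ∀ i → f (member i) ∈B b
        capType with family-type (f ∘ member) (λ i j h → hom (member-ND i) (member-ND j) (top-adj (member-⊆ i) (member-⊆ j) (λ e → h (resp (member-ND i) e))))
            zero (suc i₀) (hom (member-ND zero) (member-ND (suc i₀)) (top-adj (member-⊆ zero) (member-⊆ (suc i₀)) (λ e → 0≢1+ (member-inj zero (suc i₀) e))))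
          where
          i₀ : Fin (q ^ K)
          i₀ = Fin.inject≤ zero (1≤q^ K)
        ... | inj₂ r = r
        ... | inj₁ (a , h) = ⊥-elim (go (A-count {a} (λ i → f (member (Fin.inject≤ i le))) (λ i → h (Fin.inject≤ i le))))
          where
          go : Collide (λ i → f (member (Fin.inject≤ i le))) → ⊥
          go (i , j , i≢j , e) = i≢j (Fₚ.inject≤-injective le le i j (member-inj _ _ (inj (member-ND (Fin.inject≤ i le)) (member-ND (Fin.inject≤ j le)) e)))

        capType′ : ∀ c → ¬ (∀ j → c j ≈ 0#) → f (hypSp T c) ∈B proj₁ capType
        capType′ c c≉0 with member-hits c c≉0
        ... | i , e = B-resp {b = proj₁ capType} (resp (member-ND i) e) (proj₂ capType i)

    module Y₀ = Type cl₀ σ₀ sec₀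
    module Y₁ = Type cl₁ σ₁ sec₁
    b₀ b₁ : Cap
    b₀ = proj₁ Y₀.capType
    b₁ = proj₁ Y₁.capType

    hypND₀ : ∀ c → ¬ (∀ j → c j ≈ 0#) → ND J (hypSp M₀.T c)
    hypND₀ = hyp-ND cl₀ σ₀ sec₀
    hypND₁ : ∀ c → ¬ (∀ j → c j ≈ 0#) → ND J (hypSp M₁.T c)
    hypND₁ = hyp-ND cl₁ σ₁ sec₁

    opaque
      -- Vectors of the first cap agree at p and p′, while the first generator is 1 at p and 0 at
      -- p′.
      hyp₁⊈T₀ : ∀ c → hypSp M₁.T c ⊈ M₀.T
      hyp₁⊈T₀ c h = 0≉1 (sym (trans (sym at-p) (trans (M₀.cl-const together (h ! gen (hypSp M₁.T c) zero)) at-p′)))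
        where
        at-p : δ (cl₁ p) (suc zero) + - (c zero * δ (cl₁ p) zero) ≈ 1#
        at-p rewrite p-cl = trans (+-cong (δ-refl (suc zero)) (-‿cong (*-congˡ (δ-≢ (λ ()))))) (solve 1 (λ a → con (+ 1) :- a :* con (+ 0) := con (+ 1)) refl _)
        at-p′ : δ (cl₁ p′) (suc zero) + - (c zero * δ (cl₁ p′) zero) ≈ 0#
        at-p′ rewrite p′-cl = trans (+-cong (δ-≢ (λ ())) (-‿cong (*-congˡ (δ-≢ (λ ()))))) (solve 1 (λ a → con (+ 0) :- a :* con (+ 0) := con (+ 0)) refl _)

    opaque
      -- The two caps together have more non-degenerate hyperplanes than one B-block can hold.
      too-many : ¬ (∀ {Z} → Z ∈B b₁ → Z ∈B b₀)
      too-many sub = go (B-count {b₀} (λ i → f (g i)) in-b)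
        where
        g⊎ : Fin (suc (q ^ K)) ⊎ Fin (N K) → Vtx
        g⊎ (inj₁ i) = M₀.member i
        g⊎ (inj₂ j) = hypSp M₁.T (pt K j)
        g : Fin (suc (q ^ K) ℕ.+ N K) → Vtx
        g i = g⊎ (splitAt (suc (q ^ K)) i)
        nd⊎ : ∀ z → ND J (g⊎ z)
        nd⊎ (inj₁ i) = M₀.member-ND i
        nd⊎ (inj₂ j) = hypND₁ (pt K j) (pt-nonzero K j)
        in⊎ : ∀ z → f (g⊎ z) ∈B b₀
        in⊎ (inj₁ i) = proj₂ Y₀.capType i
        in⊎ (inj₂ j) = sub (Y₁.capType′ (pt K j) (pt-nonzero K j))
        in-b : ∀ i → f (g i) ∈B b₀
        in-b i = in⊎ (splitAt (suc (q ^ K)) i)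
        inj⊎ : ∀ y z → g⊎ y ≐ g⊎ z → y ≡ z
        inj⊎ (inj₁ i) (inj₁ j) e = ≡.cong inj₁ (M₀.member-inj i j e)
        inj⊎ (inj₁ i) (inj₂ j) e = ⊥-elim (hyp₁⊈T₀ (pt K j) (⊆-trans (bwd e) (M₀.member-⊆ i)))
        inj⊎ (inj₂ i) (inj₁ j) e = ⊥-elim (hyp₁⊈T₀ (pt K i) (⊆-trans (fwd e) (M₀.member-⊆ j)))
        inj⊎ (inj₂ i) (inj₂ j) e = ≡.cong inj₂ (pt-inj K i j 1# (λ l → trans (hyp-inj M₁.T (pt K i) (pt K j) e l) (sym (*-identityˡ _))))
        go : Collide (λ i → f (g i)) → ⊥
        go (i , j , i≢j , e) = i≢j (≡.trans (≡.sym (Fₚ.join-splitAt (suc (q ^ K)) (N K) i))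
          (≡.trans (≡.cong (Fin.join (suc (q ^ K)) (N K)) (inj⊎ (splitAt (suc (q ^ K)) i) (splitAt (suc (q ^ K)) j) (inj (nd⊎ (splitAt (suc (q ^ K)) i)) (nd⊎ (splitAt (suc (q ^ K)) j)) e))) (Fₚ.join-splitAt (suc (q ^ K)) (N K) j)))

    module Sub₀ = Sub cl₀ σ₀ sec₀ (λ _ → ≡.refl)
    module Sub₁ = Sub cl₁ σ₁ sec₁ merged

    opaque
      -- If the star of S₁ went into a top b, the two hyperplanes over S₁ in each cap would force b₀
      -- = b = b₁, against `too-many`.
      result : Result
      result with edge-type {S₁} Coarse.clSp-ND
      ... | inj₁ (a , h) = star-top , S₁ , Coarse.clSp-ND , a , λ S⊆U _ → h S⊆U
      ... | inj₂ (b , h) = ⊥-elim (too-many (λ p → B-uniq {b = b} {b′ = b₀} pq₀ (h Sub₀.in₁) (h Sub₀.in₂) (Y₀.capType′ _ (minus≉0 _)) (Y₀.capType′ _ (minus≉0 _))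
              (B-uniq {b = b₁} {b′ = b} pq₁ (Y₁.capType′ _ (minus≉0 _)) (Y₁.capType′ _ (minus≉0 _)) (h Sub₁.in₁) (h Sub₁.in₂) p)))
        where
        distinct : ∀ (T : Cap) → ¬ hypSp T (minus zero) ≐ hypSp T (minus (suc zero))
        distinct T e = 0≉1 (trans (sym (δ-≢ {i = suc zero} {zero} (λ ()))) (trans (trans (trans (solve 1 (λ a → a := :- (:- a)) refl _) (-‿cong (sym (hyp-inj T (minus zero) (minus (suc zero)) e zero)))) (solve 1 (λ a → :- (:- a) := a) refl _)) (δ-refl zero)))
        pq₀ : f (hypSp M₀.T (minus zero)) ~ f (hypSp M₀.T (minus (suc zero)))
        pq₀ = hom (hypND₀ _ (minus≉0 _)) (hypND₀ _ (minus≉0 _)) (top-adj (hypSp-⊆ M₀.T _) (hypSp-⊆ M₀.T _) (distinct M₀.T))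
        pq₁ : f (hypSp M₁.T (minus zero)) ~ f (hypSp M₁.T (minus (suc zero)))
        pq₁ = hom (hypND₁ _ (minus≉0 _)) (hypND₁ _ (minus≉0 _)) (top-adj (hypSp-⊆ M₁.T _) (hypSp-⊆ M₁.T _) (distinct M₁.T))

module FirstEdgeAll (F : Field) (q : ℕ) (hs : HasSize F q) where
  first-edge : ∀ n k₂ d₂ (n≡ : suc (suc (suc d₂)) ℕ.+ suc k₂ ≡ n) →
    ∀ J f emb → Grassmannian.Search.Result F q hs n k₂ d₂ n≡ J f emb
  first-edge n k₂ d₂ n≡ J f emb with ℕₚ.<-cmp k₂ d₂
  ... | tri< k<d _ _ = Grassmannian.Search.k<d F q hs n k₂ d₂ n≡ J f emb k<d
  ... | tri≈ _ e _ = Grassmannian.Search.k≡d F q hs n k₂ d₂ n≡ J f emb (≡.sym e)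
  first-edge n (suc k₃) d₂ n≡ J f emb | tri> _ _ d<k = FirstEdgeLarge.Go.result F q hs n k₃ d₂ n≡ d<k tp J f emb
    where
    tp : TwoPartitions n k₃
    tp = ≡.subst (λ z → TwoPartitions z k₃) (≡.trans eq n≡) (twoPartitions d₂ k₃)
      where
      eq : 4 ℕ.+ (suc k₃ ℕ.+ d₂) ≡ suc (suc (suc d₂)) ℕ.+ suc (suc k₃)
      eq = ≡.cong (3 ℕ.+_) (≡.trans (≡.cong suc (ℕₚ.+-comm (suc k₃) d₂)) (≡.sym (ℕₚ.+-suc d₂ (suc k₃))))

-- Extension over the binary field: dropping one hyperplane

module BinaryStep (F : Field) (q : ℕ) (hs : HasSize F q) (n k₃ d₂ : ℕ) (n≡ : suc (suc (suc d₂)) ℕ.+ suc (suc k₃) ≡ n) where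
  open Grassmannian F q hs n (suc k₃) d₂ n≡

  k<n : 3 ℕ.+ k₃ < n
  k<n = ℕₚ.<-trans ℕₚ.≤-refl k+1<n

  opaque
    coord-in : ∀ {m} (S : Sp m) x → (∀ j → (x j ≈ 0#) ⊎ (𝕖 j ∈ₛ S)) → x ∈ₛ S
    coord-in S x h = IsSub.resp (isSub S) (lincomb-𝕖 x) (sum x 𝕖 h)
      where
      sum : ∀ {r} (c : Fin r → Carrier) (R : Fam r) → (∀ j → (c j ≈ 0#) ⊎ (R j ∈ₛ S)) → lincomb c R ∈ₛ S
      sum {0ⁿ} c R h = IsSub.nil (isSub S)
      sum {suc r} c R h with h zero
      ... | inj₂ p = IsSub.add (isSub S) (IsSub.scale (isSub S) (c zero) p) (sum (c ∘ suc) (R ∘ suc) (h ∘ suc))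
      ... | inj₁ e = IsSub.resp (isSub S) (λ i → sym (trans (+-congʳ (trans (*-congʳ e) (zeroˡ _))) (+-identityˡ _))) (sum (c ∘ suc) (R ∘ suc) (h ∘ suc))

  module Binary (bin : ∀ x → (x ≈ 0#) ⊎ (x ≈ 1#)) (G : Geo) (m : Fin n) (J′ : List (Fin n)) (f : Vtx → Vtx) (inv₀ : Maps.Inv G (m List.∷ J′) f) where
    J : List (Fin n)
    J = m List.∷ J′
    open Geo G
    open Maps G J f
    open Core inv₀
    open DecMembership (Fₚ._≟_ {n}) using () renaming (_∈?_ to _∈ᴸ?_)

    1≉0 : ¬ 1# ≈ 0#
    1≉0 e = 0≉1 (sym e)

    opaque
      1+1 : 1# + 1# ≈ 0#
      1+1 with bin (1# + 1#)
      ... | inj₁ e = e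
      ... | inj₂ e = ⊥-elim (1≉0 (trans (solve 0 (con (+ 1) := (con (+ 1) :+ con (+ 1)) :- con (+ 1)) refl) (trans (+-congʳ e) (-‿inverseʳ 1#))))

      ≉0⇒1 : ∀ {x} → ¬ x ≈ 0# → x ≈ 1#
      ≉0⇒1 {x} h with bin x
      ... | inj₁ e = ⊥-elim (h e)
      ... | inj₂ e = e

    y : Fin n → Vect
    y b = 𝟙 +ᵥ 𝕖 b

    opaque
      y-off : ∀ {b j} → ¬ b ≡ j → y b j ≈ 1#
      y-off h = trans (+-congˡ (𝕖-off h)) (+-identityʳ 1#)

      y⇒𝕖 : ∀ {r b} {S : Sp r} → y b ∈ₛ S → 𝟙 ∈ₛ S → 𝕖 b ∈ₛ S
      y⇒𝕖 {S = S} p p′ = IsSub.resp (isSub S) (λ i → solve 1 (λ e → (con (+ 1) :+ e) :- con (+ 1) := e) refl _) (IsSub.sub (isSub S) p p′)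

    Deg : ∀ {r} → Sp r → Set
    Deg S = ∀ {x} → x ∈ₛ S → x m ≈ 0#

    opaque
      𝟙∉ : ∀ {r} {S : Sp r} → Deg S → 𝟙 ∉ₛ S
      𝟙∉ d p = 1≉0 (d p)

      y∉ : ∀ {r b} {S : Sp r} → Deg S → ¬ b ≡ m → y b ∉ₛ S
      y∉ d b≢m p = 1≉0 (trans (sym (y-off b≢m)) (d p))

      -- At coordinate m both S and 𝕖 b vanish and 𝟙 does not, so 𝟙 would have coefficient zero.
      𝕖∉+𝟙 : ∀ {r b} {S : Sp r} {h : 𝟙 ∉ₛ S} → Deg S → ¬ b ≡ m → 𝕖 b ∉ₛ S → 𝕖 b ∉ₛ ext S 𝟙 h
      𝕖∉+𝟙 {S = S} d b≢m e∉ p with ext-inv p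
      ... | α , s , s∈ , e = e∉ (IsSub.resp (isSub S) {s} (λ i → sym (trans (e i) (trans (+-congʳ (trans (*-congʳ α≈0) (zeroˡ _))) (+-identityˡ _)))) s∈)
        where
        α≈0 : α ≈ 0#
        α≈0 = trans (sym (*-identityʳ α)) (trans (sym (+-identityʳ _)) (trans (+-congˡ (sym (d s∈))) (trans (sym (e m)) (𝕖-off b≢m))))

      y∉+𝟙 : ∀ {r b} {S : Sp r} {h : 𝟙 ∉ₛ S} → Deg S → ¬ b ≡ m → 𝕖 b ∉ₛ S → y b ∉ₛ ext S 𝟙 h
      y∉+𝟙 d b≢m e∉ p = 𝕖∉+𝟙 d b≢m e∉ (y⇒𝕖 p ext-∈)

      𝟙∉+y : ∀ {r b} {S : Sp r} {h : y b ∉ₛ S} → Deg S → ¬ b ≡ m → 𝕖 b ∉ₛ S → 𝟙 ∉ₛ ext S (y b) h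
      𝟙∉+y {S = S} {h} d b≢m e∉ p = y∉+𝟙 {h = 𝟙∉ d} d b≢m e∉ (eqdim (ext-least {x∉ = 𝟙∉ d} {U = ext S _ h} ext-⊆ p) ! ext-∈)

    -- Only the hyperplanes still in J′ have to be avoided.
    Ok : ∀ {r} → Fin n → Sp r → Set
    Ok b S = b ∈ᴸ J′ → Hits b S

    opaque
      Ok? : ∀ {r} b (S : Sp r) → Dec (Ok b S)
      Ok? b S = (b ∈ᴸ? J′) →-dec Hits? b S

      Ok-mono : ∀ {r p b} {S : Sp r} {U : Sp p} → S ⊆ U → Ok b S → Ok b U
      Ok-mono h ok b∈ = Hits-mono h (ok b∈)

      ND⇒Ok : ∀ {r b} {S : Sp r} → ND J′ S → Ok b S
      ND⇒Ok nd b∈ = All.lookup nd b∈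

      y-ND : ∀ {r b} {S : Sp r} → ¬ b ≡ m → y b ∈ₛ S → Ok b S → ND J S
      y-ND {b = b} {S} b≢m y∈ ok = All.tabulate hit
        where
        hit : ∀ {j} → j ∈ᴸ J → Hits j S
        hit {j} j∈ with b Fₚ.≟ j
        ... | no b≢j = y b , y∈ , λ e → 1≉0 (trans (sym (y-off b≢j)) e)
        hit {j} (here j≡m) | yes b≡j = ⊥-elim (b≢m (≡.trans b≡j j≡m))
        hit {j} (there j∈) | yes ≡.refl = ok j∈

    HitsIf : Fin n → Vect → Set
    HitsIf b s = b ∈ᴸ J′ → ¬ s b ≈ 0#

    opaque
      pick : ∀ {i p b} {X : Sp i} {T : Sp p} → i < p → X ⊆ T → Ok b T → ∃ λ s → s ∈ₛ T × s ∉ₛ X × HitsIf b s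
      pick {b = b} {X} {T} i<p X⊆T ok with outside i<p X T | b ∈ᴸ? J′
      ... | s , s∈ , s∉ | no b∉ = s , s∈ , s∉ , λ b∈ → ⊥-elim (b∉ b∈)
      ... | s , s∈ , s∉ | yes b∈ with s b ≟ 0# | ok b∈
      ...   | no sb | _ = s , s∈ , s∉ , λ _ → sb
      ...   | yes sb≈0 | t , t∈ , tb with t ∈? X
      ...     | no t∉ = t , t∈ , t∉ , λ _ → tb
      ...     | yes t∈X = s +ᵥ t , IsSub.add (isSub T) s∈ t∈ , (λ p → s∉ (IsSub.resp (isSub X) {(s +ᵥ t) -ᵥ t} (λ l → solve 2 (λ s t → (s :+ t) :- t := s) refl _ _) (IsSub.sub (isSub X) p t∈X))) ,
                  λ _ e → tb (trans (sym (+-identityˡ _)) (trans (+-congʳ (sym sb≈0)) e))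

      both : ∀ {i b b′} {S : Sp i} → Ok b S → Ok b′ S → ∃ λ s → s ∈ₛ S × HitsIf b s × HitsIf b′ s
      both {b = b} {b′} {S} ok ok′ with b ∈ᴸ? J′ | b′ ∈ᴸ? J′
      ... | no b∉ | no b′∉ = 0ᵥ , IsSub.nil (isSub S) , (λ b∈ → ⊥-elim (b∉ b∈)) , (λ b∈ → ⊥-elim (b′∉ b∈))
      ... | yes b∈ | no b′∉ = let s , s∈ , sb = ok b∈ in s , s∈ , (λ _ → sb) , (λ b∈ → ⊥-elim (b′∉ b∈))
      ... | no b∉ | yes b′∈ = let s , s∈ , sb = ok′ b′∈ in s , s∈ , (λ b∈ → ⊥-elim (b∉ b∈)) , (λ _ → sb)
      ... | yes b∈ | yes b′∈ with ok b∈ | ok′ b′∈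
      ...   | s , s∈ , sb | t , t∈ , tb′ with s b′ ≟ 0# | t b ≟ 0#
      ...     | no sb′ | _ = s , s∈ , (λ _ → sb) , (λ _ → sb′)
      ...     | yes _ | no tb = t , t∈ , (λ _ → tb) , (λ _ → tb′)
      ...     | yes sb′≈0 | yes tb≈0 = s +ᵥ t , IsSub.add (isSub S) s∈ t∈ , (λ _ e → sb (trans (sym (+-identityʳ _)) (trans (+-congˡ (sym tb≈0)) e))) ,
                  (λ _ e → tb′ (trans (sym (+-identityˡ _)) (trans (+-congʳ (sym sb′≈0)) e)))

      -- By `both` a single vector meets both conditions, so X has only to contain it. X must have
      -- dimension at least one; for X of dimension k - 2 this is k ≥ 3.
      shrink : ∀ {i b b′} {S : Sp (suc (suc i))} → Ok b S → Ok b′ S → Σ (Sp (suc i)) λ X → (X ⊆ S) × Ok b X × Ok b′ X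
      shrink {i} {b} {b′} {S} ok ok′ with both {S = S} ok ok′
      ... | s , s∈ , sb , sb′ with s ∈? nilSp
      -- Here neither b nor b′ is in J′, and both conditions are void.
      ...   | yes s≈0 = tailSp S , tailSp-⊆ , (λ b∈ → ⊥-elim (sb b∈ (least nilSp (coord-sub b) (λ ()) s≈0))) , (λ b∈ → ⊥-elim (sb′ b∈ (least nilSp (coord-sub b′) (λ ()) s≈0)))
      ...   | no s∉ with ≡.subst (λ z → Σ (Sp z) λ X → (ext nilSp s s∉ ⊆ X) × (X ⊆ S)) (ℕₚ.+-comm i 1)
                  (between i {Y = ext nilSp s s∉} {U = S} (ext-least (incl (nilSp-least (isSub S) _)) s∈) (ℕₚ.≤-trans (ℕₚ.≤-reflexive (ℕₚ.+-comm i 1)) (ℕₚ.n≤1+n _)))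
      ...     | X , s⊆X , X⊆S = X , X⊆S , (λ b∈ → s , s⊆X ! ext-∈ , sb b∈) , (λ b∈ → s , s⊆X ! ext-∈ , sb′ b∈)

    record Cover (T : Cap) : Set where
      field
        blk : B
        cov : CovB blk T
        strong : ∀ v → (∀ P → P ⊆ T → ND J P → v ~ f P) → v ∈B blk
        same : ∀ {T′ β} → T ≐ T′ → CovB β T′ → ∀ {v} → v ∈B blk → v ∈B β

    opaque
      cover : ∀ {X : Pre} {T : Cap} {s t} → X ⊆ T → (s∉ : s ∉ₛ X) (t∉X : t ∉ₛ X) → t ∉ₛ ext X s s∉ → s ∈ₛ T → t ∈ₛ T → ND J (ext X s s∉) → ND J (ext X t t∉X) → Cover T
      cover {X} {T} {s} {t} X⊆T s∉ t∉X t∉ s∈ t∈ nds ndt with capB {S₁ = ext X s s∉} {S₂ = ext X t t∉X} {U₀ = ext (ext X s s∉) t t∉} {T = T} nds ndt ext-⊆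
            (ext-least (⊆-trans ext-⊆ ext-⊆) ext-∈) (λ h → t∉ (h ! ext-∈)) (ext-least (ext-least X⊆T s∈) t∈) | outside ℕₚ.≤-refl (ext (ext X s s∉) t t∉) T
      ... | b , c , st | r , r∈ , r∉ = record { blk = b ; cov = c ; strong = st ; same = λ e c′ → B-uniq PQ (c P⊆ ndP) (c Q⊆ ndQ) (c′ (⊆-trans P⊆ (fwd e)) ndP) (c′ (⊆-trans Q⊆ (fwd e)) ndQ) }
        where
        P Q : Vtx
        P = ext (ext X s s∉) t t∉
        Q = ext (ext X s s∉) r (λ p → r∉ (ext-⊆ ! p))
        P⊆ : P ⊆ T
        P⊆ = ext-least (ext-least X⊆T s∈) t∈
        Q⊆ : Q ⊆ T
        Q⊆ = ext-least (ext-least X⊆T s∈) r∈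
        ndP : ND J P
        ndP = ND-mono ext-⊆ nds
        ndQ : ND J Q
        ndQ = ND-mono ext-⊆ nds
        PQ : f P ~ f Q
        PQ = hom ndP ndQ (star-adj {S = ext X s s∉} ext-⊆ ext-⊆ (λ e → r∉ (bwd e ! ext-∈)))

      nonzero : ∀ {x j} → ¬ x j ≈ 0# → x ∉ₛ nilSp
      nonzero {x} {j} h p = h (least nilSp (coord-sub j) (λ ()) p)

      line-to : ∀ {x j} {T : Cap} → ¬ x j ≈ 0# → x ∈ₛ T → Σ Pre λ X → (x ∈ₛ X) × (X ⊆ T)
      line-to {x} {j} {T} h x∈ with ≡.subst (λ z → Σ (Sp z) λ X → (ext nilSp x (nonzero {x} {j} h) ⊆ X) × (X ⊆ T)) (ℕₚ.+-comm k₃ 1)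
          (between k₃ {Y = ext nilSp x (nonzero {x} {j} h)} {U = T} (ext-least (incl (nilSp-least (isSub T) _)) x∈) (ℕₚ.≤-trans (ℕₚ.≤-reflexive (ℕₚ.+-comm k₃ 1)) (s≤s (ℕₚ.m≤n+m k₃ 3))))
      ... | X , l , X⊆T = X , l ! ext-∈ , X⊆T

      cap𝟙 : ∀ {T : Cap} → 𝟙 ∈ₛ T → Cover T
      cap𝟙 {T} 𝟙∈ with line-to {𝟙} {m} {T} 1≉0 𝟙∈
      ... | X , 𝟙∈X , X⊆T with outside (s≤s (s≤s (ℕₚ.m≤n+m k₃ 2))) X T
      ...   | s , s∈ , s∉ with outside (s≤s (s≤s (s≤s (ℕₚ.m≤n+m k₃ 1)))) (ext X s s∉) T
      ...     | t , t∈ , t∉ = cover X⊆T s∉ (λ p → t∉ (ext-⊆ ! p)) t∉ s∈ t∈ (𝟙-ND (ext-⊆ ! 𝟙∈X)) (𝟙-ND (ext-⊆ ! 𝟙∈X))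

      -- Every edge over a (k - 2)-space through `y b` is nonzero at all coordinates of J but
      -- possibly b; `pick` chooses s and t to take care of b.
      capy : ∀ {b} {T : Cap} → ¬ b ≡ m → y b ∈ₛ T → Ok b T → Cover T
      capy {b} {T} b≢m y∈ ok with line-to {y b} {m} {T} (λ e → 1≉0 (trans (sym (y-off b≢m)) e)) y∈
      ... | X , y∈X , X⊆T with pick {b = b} {X} {T} (s≤s (s≤s (ℕₚ.m≤n+m k₃ 2))) X⊆T ok
      ...   | s , s∈ , s∉ , sb with pick {b = b} {ext X s s∉} {T} (s≤s (s≤s (s≤s (ℕₚ.m≤n+m k₃ 1)))) (ext-least X⊆T s∈) ok
      ...     | t , t∈ , t∉ , tb = cover X⊆T s∉ (λ p → t∉ (ext-⊆ ! p)) t∉ s∈ t∈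
                  (y-ND b≢m (ext-⊆ ! y∈X) (λ b∈ → s , ext-∈ , sb b∈)) (y-ND b≢m (ext-⊆ ! y∈X) (λ b∈ → t , ext-∈ , tb b∈))

    -- Guarantees that S + ⟨y b⟩ is a non-degenerate neighbour of S + ⟨𝟙⟩.
    record Adm {r} (b : Fin n) (S : Sp r) : Set where
      constructor mkAdm
      field
        deg : Deg S
        b≢m : ¬ b ≡ m
        e∉ : 𝕖 b ∉ₛ S
        ok : Ok b S
    open Adm

    P𝟙 : (S : Edge) → Deg S → Vtx
    P𝟙 S d = ext S 𝟙 (𝟙∉ d)

    Py : ∀ {b} (S : Edge) → Adm b S → Vtx
    Py {b} S A = ext S (y b) (y∉ (deg A) (b≢m A))

    opaque
      ndP𝟙 : ∀ {S} (d : Deg S) → ND J (P𝟙 S d)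
      ndP𝟙 d = 𝟙-ND ext-∈

      ndPy : ∀ {b S} (A : Adm b S) → ND J (Py S A)
      ndPy A = y-ND (b≢m A) ext-∈ (Ok-mono ext-⊆ (ok A))

      P𝟙≭Py : ∀ {b S} (A : Adm b S) → ¬ P𝟙 S (deg A) ≐ Py S A
      P𝟙≭Py A e = 𝟙∉+y {h = y∉ (deg A) (b≢m A)} (deg A) (b≢m A) (e∉ A) (fwd e ! ext-∈)

      fP~ : ∀ {b S} (A : Adm b S) → f (P𝟙 S (deg A)) ~ f (Py S A)
      fP~ {S = S} A = hom (ndP𝟙 (deg A)) (ndPy A) (star-adj {S = S} ext-⊆ ext-⊆ (P𝟙≭Py A))

      avoid𝟙 : ∀ {b S a} {X : Pre} (A : Adm b S) (X⊆S : X ⊆ S) {h : 𝟙 ∉ₛ X} → CovA a (ext X 𝟙 h) → ¬ f (Py S A) ∈A a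
      avoid𝟙 {b} {S} {a} {X} A X⊆S {h} ca p with cap𝟙 {ext (P𝟙 S (deg A)) (y b) (y∉+𝟙 (deg A) (b≢m A) (e∉ A))} (ext-⊆ ! ext-∈)
      ... | c with preimage {S = ext X 𝟙 h} {T = ext (P𝟙 S (deg A)) (y b) (y∉+𝟙 (deg A) (b≢m A) (e∉ A))} (𝟙-ND ext-∈) (ext-least (⊆-trans X⊆S (⊆-trans ext-⊆ ext-⊆)) (ext-⊆ ! ext-∈)) ca (Cover.cov c) p (Cover.cov c (ext-least (⊆-trans ext-⊆ ext-⊆) ext-∈) (ndPy A))
      ...   | W , X⊆W , W⊆T , e = 𝟙∉+y {h = y∉ (deg A) (b≢m A)} (deg A) (b≢m A) (e∉ A) (fwd (f-top W⊆T (ext-least (⊆-trans ext-⊆ ext-⊆) ext-∈) (𝟙-ND (X⊆W ! ext-∈)) (ndPy A) e) ! (X⊆W ! ext-∈))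

      avoidy : ∀ {b S a} {X : Pre} (A : Adm b S) (X⊆S : X ⊆ S) {h : y b ∉ₛ X} → Ok b X → CovA a (ext X (y b) h) → ¬ f (P𝟙 S (deg A)) ∈A a
      avoidy {b} {S} {a} {X} A X⊆S {h} okX ca p with cap𝟙 {ext (P𝟙 S (deg A)) (y b) (y∉+𝟙 (deg A) (b≢m A) (e∉ A))} (ext-⊆ ! ext-∈)
      ... | c with preimage {S = ext X (y b) h} {T = ext (P𝟙 S (deg A)) (y b) (y∉+𝟙 (deg A) (b≢m A) (e∉ A))} (y-ND (b≢m A) ext-∈ (Ok-mono ext-⊆ okX)) (ext-least (⊆-trans X⊆S (⊆-trans ext-⊆ ext-⊆)) ext-∈) ca (Cover.cov c) p (Cover.cov c ext-⊆ (ndP𝟙 (deg A)))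
      ...   | W , X⊆W , W⊆T , e = y∉+𝟙 {h = 𝟙∉ (deg A)} (deg A) (b≢m A) (e∉ A) (fwd (f-top W⊆T ext-⊆ (y-ND (b≢m A) (X⊆W ! ext-∈) (Ok-mono (⊆-trans ext-⊆ X⊆W) okX)) (ndP𝟙 (deg A)) e) ! (X⊆W ! ext-∈))

      -- Makes the A-block attached to S independent of b. If y b′ = β y b + α 𝟙 + s, coordinate m
      -- gives β + α = 1, so one coefficient vanishes and y b′ lies in S + ⟨𝟙⟩ or S + ⟨y b⟩.
      -- Otherwise S + ⟨𝟙, y b⟩ and S + ⟨𝟙, y b′⟩ differ and `same-A` applies.
      AB : ∀ {b b′ S a} (A : Adm b S) (A′ : Adm b′ S) → f (P𝟙 S (deg A)) ∈A a → f (Py S A) ∈A a → f (Py S A′) ∈A a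
      AB {b} {b′} {S} {a} A A′ p p′ with y b′ ∈? Py S A
      ... | yes y∈ = A-resp (resp (ndPy A) (≐-sym (⊆⇒≐ (ext-least ext-⊆ y∈)))) p′
      ... | no y∉′ = same-A {S₀ = ext (tailSp S) 𝟙 (λ h → 𝟙∉ (deg A) (tailSp-⊆ ! h))} {P = P𝟙 S (deg A)} {P₁ = Py S A} {T₁ = T₁} {T₂ = T₂}
            (𝟙-ND ext-∈) (ext-least (⊆-trans tailSp-⊆ ext-⊆) ext-∈) ext-⊆ ext-⊆ (λ h → y′∉T₁ (eqdim h ! ext-∈))
            (Cover.cov (cap𝟙 {T₁} (ext-⊆ ! ext-∈))) (Cover.cov (cap𝟙 {T₂} (ext-⊆ ! ext-∈))) (ndPy A) (ext-least (⊆-trans ext-⊆ ext-⊆) ext-∈) (P𝟙≭Py A)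
            (Cover.cov (cap𝟙 {T₂} (ext-⊆ ! ext-∈)) (ext-least (⊆-trans ext-⊆ ext-⊆) ext-∈) (ndPy A′))
            (hom (ndPy A′) (ndP𝟙 (deg A)) (star-adj {S = S} ext-⊆ ext-⊆ (λ e → y∉+𝟙 {h = 𝟙∉ (deg A)} (deg A′) (b≢m A′) (e∉ A′) (fwd e ! ext-∈))))
            (hom (ndPy A′) (ndPy A) (star-adj {S = S} ext-⊆ ext-⊆ (λ e → y∉′ (fwd e ! ext-∈)))) p p′
        where
        T₁ T₂ : Cap
        T₁ = ext (P𝟙 S (deg A)) (y b) (y∉+𝟙 (deg A) (b≢m A) (e∉ A))
        T₂ = ext (P𝟙 S (deg A)) (y b′) (y∉+𝟙 {h = 𝟙∉ (deg A)} (deg A′) (b≢m A′) (e∉ A′))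
        y′∉T₁ : y b′ ∉ₛ T₁
        y′∉T₁ h with ext-inv h
        ... | β , r , r∈ , e with ext-inv r∈
        ...   | α , s , s∈ , e′ with bin β | bin α
        ...     | inj₁ β≈0 | _ = y∉+𝟙 {h = 𝟙∉ (deg A)} (deg A′) (b≢m A′) (e∉ A′) (IsSub.resp (isSub (P𝟙 S (deg A))) {r} (λ i → sym (trans (e i) (trans (+-congʳ (trans (*-congʳ β≈0) (zeroˡ _))) (+-identityˡ _)))) r∈)
        ...     | inj₂ β≈1 | inj₁ α≈0 = y∉′ (ext-intro β (λ i → trans (e i) (+-congˡ (trans (e′ i) (trans (+-congʳ (trans (*-congʳ α≈0) (zeroˡ _))) (+-identityˡ _))))) s∈)
        ...     | inj₂ β≈1 | inj₂ α≈1 = 1≉0 (trans (sym (y-off (b≢m A′))) (trans (e m) (trans (+-cong (trans (*-cong β≈1 (y-off (b≢m A))) (*-identityʳ 1#)) (trans (e′ m) (trans (+-cong (trans (*-congʳ α≈1) (*-identityʳ 1#)) (deg A s∈)) (+-identityʳ 1#)))) 1+1)))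

    record New (U : Vtx) : Set where
      constructor mkNew
      field
        degU : Deg U
        ndU : ND J′ U
    open New

    AdmU : ∀ {U b} → New U → ¬ b ≡ m → 𝕖 b ∉ₛ U → Adm b U
    AdmU N b≢m e∉ = mkAdm (degU N) b≢m e∉ (ND⇒Ok (ndU N))

    opaque
      some-b : ∀ {U : Vtx} → Deg U → ∃ λ b → ¬ b ≡ m × 𝕖 b ∉ₛ U
      some-b {U} d with 𝕖-outside k+1<n (ext U (𝕖 m) (λ p → 1≉0 (trans (sym (𝕖-diag m)) (d p))))
      ... | b , h = b , (λ { ≡.refl → h ext-∈ }) , λ p → h (ext-⊆ ! p)

      -- If T contained 𝕖 b for all b ≠ m, it would contain 𝕖 m = 𝟙 minus their sum, hence
      -- everything.
      some-b𝟙 : ∀ {T : Cap} → 𝟙 ∈ₛ T → ∃ λ b → ¬ b ≡ m × 𝕖 b ∉ₛ T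
      some-b𝟙 {T} 𝟙∈ with Fₚ.any? (λ b → ¬? (b Fₚ.≟ m) ×-dec ¬? (𝕖 b ∈? T)) | 𝕖-outside k+1<n T
      ... | yes r | _ = r
      ... | no ∄ | c , c∉ with c Fₚ.≟ m
      ...   | no c≢m = ⊥-elim (∄ (c , c≢m , c∉))
      ...   | yes ≡.refl = ⊥-elim (c∉ (IsSub.resp (isSub T) (λ i → solve 1 (λ e → con (+ 1) :- (con (+ 1) :- e) := e) refl _)
              (IsSub.sub (isSub T) 𝟙∈ (coord-in T (𝟙 -ᵥ 𝕖 c) coord))))
        where
        coord : ∀ j → (1# + - 𝕖 c j ≈ 0#) ⊎ (𝕖 j ∈ₛ T)
        coord j with j Fₚ.≟ c
        ... | yes ≡.refl = inj₁ (trans (+-congˡ (-‿cong (𝕖-diag j))) (-‿inverseʳ 1#))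
        ... | no j≢c = inj₂ (decidable-stable (𝕖 j ∈? T) (λ h → ∄ (j , j≢c , h)))

    U+𝟙 : ∀ {U} → Deg U → Cap
    U+𝟙 {U} d = ext U 𝟙 (𝟙∉ d)

    U+y : ∀ {b U} → Adm b U → Cap
    U+y {b} {U} A = ext U (y b) (y∉ (deg A) (b≢m A))

    opaque
      C𝟙 : ∀ {U} (d : Deg U) → Cover (U+𝟙 d)
      C𝟙 d = cap𝟙 ext-∈

      Cy : ∀ {b U} (A : Adm b U) → Cover (U+y A)
      Cy A = capy (b≢m A) ext-∈ (Ok-mono ext-⊆ (ok A))

      adm-mono : ∀ {r p b} {S : Sp r} {U : Sp p} → S ⊆ U → Adm b U → Ok b S → Adm b S
      adm-mono h A o = mkAdm (λ p → deg A (h ! p)) (b≢m A) (λ p → e∉ A (h ! p)) o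

    record Via (b : Fin n) (U : Vtx) (A : Adm b U) (S₁ S₂ : Edge) : Set where
      field
        S₁⊆U : S₁ ⊆ U
        S₂⊆U : S₂ ⊆ U
        A₁ : Adm b S₁
        A₂ : Adm b S₂
        v : Vtx
        v𝟙 : v ∈B Cover.blk (C𝟙 (deg A))
        vy : v ∈B Cover.blk (Cy A)
        vA₁ : ∀ {a} → f (P𝟙 S₁ (deg A₁)) ∈A a → f (Py S₁ A₁) ∈A a → v ∈A a
        vA₂ : ∀ {a} → f (P𝟙 S₂ (deg A₂)) ∈A a → f (Py S₂ A₂) ∈A a → v ∈A a
        unique : ∀ {v w} → v ∈B Cover.blk (C𝟙 (deg A)) → v ∈B Cover.blk (Cy A) → w ∈B Cover.blk (C𝟙 (deg A)) → w ∈B Cover.blk (Cy A) → v ≐ w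
        sepA : ∀ {a₁ a₂} → f (P𝟙 S₁ (deg A₁)) ∈A a₁ → f (Py S₁ A₁) ∈A a₁ → f (P𝟙 S₂ (deg A₂)) ∈A a₂ → f (Py S₂ A₂) ∈A a₂ →
          ∀ {v w} → v ∈A a₁ → w ∈A a₁ → v ∈A a₂ → w ∈A a₂ → v ≐ w

    opaque
      via : ∀ {b U} (A : Adm b U) {X : Pre} {S₁ S₂ : Edge} → X ⊆ S₁ → X ⊆ S₂ → S₁ ⊆ U → S₂ ⊆ U → S₂ ⊈ S₁ → Ok b X → Via b U A S₁ S₂
      via {b} {U} A {X} {S₁} {S₂} X⊆S₁ X⊆S₂ S₁⊆U S₂⊆U ne okX = make (construct {x = 𝟙} {y = y b} X⊆S₁ X⊆S₂ S₁⊆U S₂⊆U ne (𝟙∉ (deg A)) (y∉+𝟙 (deg A) (b≢m A) (e∉ A)) (y∉ (deg A) (b≢m A))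
          (𝟙∉ (deg AX)) (y∉ (deg AX) (b≢m A)) (𝟙-ND ext-∈) (y-ND (b≢m A) ext-∈ (Ok-mono ext-⊆ okX)) (Cover.cov (C𝟙 (deg A))) (Cover.cov (Cy A)))
        where
        AX : Adm b X
        AX = adm-mono (⊆-trans X⊆S₁ S₁⊆U) A okX
        B₁ : Adm b S₁
        B₁ = adm-mono S₁⊆U A (Ok-mono X⊆S₁ okX)
        B₂ : Adm b S₂
        B₂ = adm-mono S₂⊆U A (Ok-mono X⊆S₂ okX)
        r𝟙 : ∀ {S} (S⊆U : S ⊆ U) (d : Deg S) → f (P𝟙 S d) ≐ f (ext S 𝟙 (λ p → 𝟙∉ (deg A) (S⊆U ! p)))
        r𝟙 S⊆U d = resp (𝟙-ND ext-∈) (⊆⇒≐ (ext-least ext-⊆ ext-∈))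
        ry : ∀ {S} (S⊆U : S ⊆ U) (A′ : Adm b S) → f (Py S A′) ≐ f (ext S (y b) (λ p → y∉ (deg A) (b≢m A) (S⊆U ! p)))
        ry S⊆U A′ = resp (ndPy A′) (⊆⇒≐ (ext-least ext-⊆ ext-∈))
        Px′ Py′ : ∀ {S : Edge} → S ⊆ U → Vtx
        Px′ {S} h = f (ext S 𝟙 (λ p → 𝟙∉ (deg A) (h ! p)))
        Py′ {S} h = f (ext S (y b) (λ p → y∉ (deg A) (b≢m A) (h ! p)))
        make : (∃ λ v → v ∈B Cover.blk (C𝟙 (deg A)) × v ∈B Cover.blk (Cy A) × (∀ {a} → Px′ S₁⊆U ∈A a → Py′ S₁⊆U ∈A a → v ∈A a) × (∀ {a} → Px′ S₂⊆U ∈A a → Py′ S₂⊆U ∈A a → v ∈A a)) ×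
          (∀ {v w} → v ∈B Cover.blk (C𝟙 (deg A)) → v ∈B Cover.blk (Cy A) → w ∈B Cover.blk (C𝟙 (deg A)) → w ∈B Cover.blk (Cy A) → v ≐ w) ×
          (∀ {a₁ a₂} → Px′ S₁⊆U ∈A a₁ → Py′ S₁⊆U ∈A a₁ → Px′ S₂⊆U ∈A a₂ → Py′ S₂⊆U ∈A a₂ → ∀ {v w} → v ∈A a₁ → w ∈A a₁ → v ∈A a₂ → w ∈A a₂ → v ≐ w) → Via b U A S₁ S₂
        make ((v , p , p′ , r₁ , r₂) , u , s) = record
          { S₁⊆U = S₁⊆U ; S₂⊆U = S₂⊆U ; A₁ = B₁ ; A₂ = B₂ ; v = v ; v𝟙 = p ; vy = p′
          ; vA₁ = λ h h′ → r₁ (A-resp (r𝟙 S₁⊆U (deg B₁)) h) (A-resp (ry S₁⊆U B₁) h′)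
          ; vA₂ = λ h h′ → r₂ (A-resp (r𝟙 S₂⊆U (deg B₂)) h) (A-resp (ry S₂⊆U B₂) h′)
          ; unique = u
          ; sepA = λ h₁ h₁′ h₂ h₂′ → s (A-resp (r𝟙 S₁⊆U (deg B₁)) h₁) (A-resp (ry S₁⊆U B₁) h₁′) (A-resp (r𝟙 S₂⊆U (deg B₂)) h₂) (A-resp (ry S₂⊆U B₂) h₂′) }

      via-edge : ∀ {b U} (A : Adm b U) {S : Edge} → S ⊆ U → Ok b S → Σ Edge λ S₂ → Via b U A S S₂
      via-edge {b} {U} A {S} S⊆U okS with shrink {b = b} {b} {S} okS okS | outside ℕₚ.≤-refl S U
      ... | X , X⊆S , okX , _ | t , t∈ , t∉ = ext X t (λ p → t∉ (X⊆S ! p)) , via A X⊆S ext-⊆ S⊆U (ext-least (⊆-trans X⊆S S⊆U) t∈) (λ h → t∉ (h ! ext-∈)) okX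

    -- Quantifies over all admissible b at once, so that the value does not depend on the b used to
    -- find it.
    Spec : Vtx → Vtx → Set
    Spec U v = (∀ {T β} → U ⊆ T → 𝟙 ∈ₛ T → CovB β T → v ∈B β) × (∀ {b T β} → Adm b U → U ⊆ T → y b ∈ₛ T → CovB β T → v ∈B β)

    opaque
      spec-mk : ∀ {U v} (d : Deg U) → v ∈B Cover.blk (C𝟙 d) → (∀ {b} (A : Adm b U) → v ∈B Cover.blk (Cy A)) → Spec U v
      spec-mk {U} {v} d p p′ = (λ U⊆T 𝟙∈ c → Cover.same (C𝟙 d) (⊆⇒≐ (ext-least U⊆T 𝟙∈)) c p) ,
        (λ A U⊆T y∈ c → Cover.same (Cy A) (⊆⇒≐ (ext-least U⊆T y∈)) c (p′ A))

      ok-edge : ∀ {b b′} {U : Vtx} → Ok b U → Ok b′ U → Σ Edge λ S → (S ⊆ U) × Ok b S × Ok b′ S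
      ok-edge = shrink

      -- The values found with b and b′ are computed over the same S and S₂. There the A-blocks
      -- agree by `AB`, and by `sepA` the two blocks have a single common vertex.
      coherent : ∀ {b b′ U} (A : Adm b U) (A′ : Adm b′ U) {v} → v ∈B Cover.blk (C𝟙 (deg A)) → v ∈B Cover.blk (Cy A) → v ∈B Cover.blk (Cy A′)
      coherent {b} {b′} {U} A A′ {v} v𝟙 vy with y b′ ∈? U+y A
      ... | yes y∈ = Cover.same (Cy A) (≐-sym (⊆⇒≐ (ext-least ext-⊆ y∈))) (Cover.cov (Cy A′)) vy
      ... | no _ with ok-edge {b} {b′} {U} (ok A) (ok A′)
      ...   | S , S⊆U , okS , okS′ with shrink {b = b} {b′} {S} okS okS′ | outside ℕₚ.≤-refl S U
      ...     | X , X⊆S , okX , okX′ | t , t∈ , t∉ = final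
        where
        S₂ : Edge
        S₂ = ext X t (λ p → t∉ (X⊆S ! p))
        S₂⊆U : S₂ ⊆ U
        S₂⊆U = ext-least (⊆-trans X⊆S S⊆U) t∈
        V : Via b U A S S₂
        V = via A X⊆S ext-⊆ S⊆U S₂⊆U (λ h → t∉ (h ! ext-∈)) okX
        V′ : Via b′ U A′ S S₂
        V′ = via A′ X⊆S ext-⊆ S⊆U S₂⊆U (λ h → t∉ (h ! ext-∈)) okX′
        module V = Via V
        module V′ = Via V′
        fix : ∀ {S} (d d′ : Deg S) → f (P𝟙 S d) ≐ f (P𝟙 S d′)
        fix d d′ = resp (ndP𝟙 d) (⊆⇒≐ (ext-least ext-⊆ ext-∈))
        same-v : V.v ≐ V′.v
        same-v with A-join (fP~ V.A₁) | A-join (fP~ V.A₂)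
        ... | a₁ , p₁ , p₁′ | a₂ , p₂ , p₂′ = V.sepA p₁ p₁′ p₂ p₂′ (V.vA₁ p₁ p₁′) (V′.vA₁ (A-resp (fix (deg V.A₁) (deg V′.A₁)) p₁) (AB V.A₁ V′.A₁ p₁ p₁′))
                (V.vA₂ p₂ p₂′) (V′.vA₂ (A-resp (fix (deg V.A₂) (deg V′.A₂)) p₂) (AB V.A₂ V′.A₂ p₂ p₂′))
        final : v ∈B Cover.blk (Cy A′)
        final = B-resp (≐-trans (≐-sym same-v) (V.unique V.v𝟙 V.vy v𝟙 vy)) V′.vy

    opaque
      new-value : ∀ {U} → New U → ∃ λ v → Spec U v
      new-value {U} N with some-b (degU N)
      ... | b , b≢m , e∉U with ok-edge {b} {b} {U} (ND⇒Ok (ndU N)) (ND⇒Ok (ndU N))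
      ...   | S , S⊆U , okS , _ with via-edge (AdmU N b≢m e∉U) S⊆U okS
      ...     | S₂ , V = Via.v V , spec-mk (degU N) (Via.v𝟙 V) (λ A → coherent (AdmU N b≢m e∉U) A (Via.v𝟙 V) (Via.vy V))

      spec-unique : ∀ {U v w} → New U → Spec U v → Spec U w → v ≐ w
      spec-unique {U} N s s′ with some-b (degU N)
      ... | b , b≢m , e∉U with ok-edge {b} {b} {U} (ND⇒Ok (ndU N)) (ND⇒Ok (ndU N))
      ...   | S , S⊆U , okS , _ with via-edge (AdmU N b≢m e∉U) S⊆U okS
      ...     | S₂ , V = Via.unique V (proj₁ s ext-⊆ ext-∈ (Cover.cov (C𝟙 _))) (proj₂ s (AdmU N b≢m e∉U) ext-⊆ ext-∈ (Cover.cov (Cy _)))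
                  (proj₁ s′ ext-⊆ ext-∈ (Cover.cov (C𝟙 _))) (proj₂ s′ (AdmU N b≢m e∉U) ext-⊆ ext-∈ (Cover.cov (Cy _)))

      spec-A : ∀ {U v b S a} → New U → Spec U v → S ⊆ U → (A : Adm b S) → 𝕖 b ∉ₛ U → f (P𝟙 S (deg A)) ∈A a → f (Py S A) ∈A a → v ∈A a
      spec-A {U} {v} {b} {S} {a} N s S⊆U A e∉U p p′ with via-edge (AdmU N (b≢m A) e∉U) S⊆U (ok A)
      ... | S₂ , V = A-resp (Via.unique V (Via.v𝟙 V) (Via.vy V) (proj₁ s ext-⊆ ext-∈ (Cover.cov (C𝟙 _))) (proj₂ s (AdmU N (b≢m A) e∉U) ext-⊆ ext-∈ (Cover.cov (Cy _))))
            (Via.vA₁ V (A-resp (resp (ndP𝟙 (deg A)) (⊆⇒≐ (ext-least ext-⊆ ext-∈))) p) (A-resp (resp (ndPy A) (⊆⇒≐ (ext-least ext-⊆ ext-∈))) p′))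

    opaque
      -- If equal, the A-block of another edge S₂ of U over X would contain f(S + ⟨𝟙⟩) and f(S₂ +
      -- ⟨𝟙⟩) and thus be that of X + ⟨𝟙⟩; but it contains f(S₂ + ⟨y b⟩), against `avoid𝟙`.
      not-P𝟙 : ∀ {U v S} → New U → Spec U v → S ⊆ U → (d : Deg S) → ¬ v ≐ f (P𝟙 S d)
      not-P𝟙 {U} {v} {S} N sv S⊆U d e with some-b (degU N)
      ... | b , b≢m , e∉U with pick {b = b} {S} {U} ℕₚ.≤-refl S⊆U (ND⇒Ok (ndU N)) | edgeA {ext (tailSp S) 𝟙 (λ h → 𝟙∉ d (tailSp-⊆ ! h))} (𝟙-ND ext-∈)
      ...   | s , s∈ , s∉ , sb | a′ , ca = go (A-join (fP~ A₂))
        where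
        X : Pre
        X = tailSp S
        S₂ : Edge
        S₂ = ext X s (λ p → s∉ (tailSp-⊆ ! p))
        S₂⊆U : S₂ ⊆ U
        S₂⊆U = ext-least (⊆-trans tailSp-⊆ S⊆U) s∈
        A₂ : Adm b S₂
        A₂ = adm-mono S₂⊆U (AdmU N b≢m e∉U) (λ b∈ → s , ext-∈ , sb b∈)
        s∉P : s ∉ₛ P𝟙 S d
        s∉P p with ext-inv p
        ... | α , t , t∈ , e′ = s∉ (IsSub.resp (isSub S) {t} (λ i → sym (trans (e′ i) (trans (+-congʳ (trans (*-congʳ α≈0) (zeroˡ _))) (+-identityˡ _)))) t∈)
          where
          α≈0 : α ≈ 0#
          α≈0 = trans (sym (*-identityʳ α)) (trans (sym (+-identityʳ _)) (trans (+-congˡ (sym (d t∈))) (trans (sym (e′ m)) (degU N s∈))))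
        X⊆P : ext X 𝟙 (λ h → 𝟙∉ d (tailSp-⊆ ! h)) ⊆ P𝟙 S d
        X⊆P = ext-least (⊆-trans tailSp-⊆ ext-⊆) ext-∈
        X⊆P₂ : ext X 𝟙 (λ h → 𝟙∉ d (tailSp-⊆ ! h)) ⊆ P𝟙 S₂ (deg A₂)
        X⊆P₂ = ext-least (⊆-trans ext-⊆ ext-⊆) ext-∈
        go : (∃ λ a → f (P𝟙 S₂ (deg A₂)) ∈A a × f (Py S₂ A₂) ∈A a) → ⊥
        go (a , p , p′) = avoid𝟙 A₂ ext-⊆ ca (A-uniq (hom (ndP𝟙 d) (ndP𝟙 (deg A₂)) (star-adj X⊆P X⊆P₂ (λ h → s∉P (bwd h ! (ext-⊆ ! ext-∈)))))
          (A-resp e (spec-A N sv S₂⊆U A₂ e∉U p p′)) p (ca X⊆P (ndP𝟙 d)) (ca X⊆P₂ (ndP𝟙 (deg A₂))) p′)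

      not-Py : ∀ {U v S b} → New U → Spec U v → S ⊆ U → (A : Adm b S) → 𝕖 b ∉ₛ U → ¬ v ≐ f (Py S A)
      not-Py {U} {v} {S} {b} N sv S⊆U A e∉U e with shrink {b = b} {b} {S} (ok A) (ok A) | outside ℕₚ.≤-refl S U
      ... | X , X⊆S , okX , _ | s , s∈ , s∉ with edgeA {ext X (y b) (λ h → y∉ (deg A) (b≢m A) (X⊆S ! h))} (y-ND (b≢m A) ext-∈ (Ok-mono ext-⊆ okX))
      ...   | a′ , ca = go (A-join (fP~ A₂))
        where
        S₂ : Edge
        S₂ = ext X s (λ p → s∉ (X⊆S ! p))
        S₂⊆U : S₂ ⊆ U
        S₂⊆U = ext-least (⊆-trans X⊆S S⊆U) s∈
        A₂ : Adm b S₂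
        A₂ = adm-mono S₂⊆U (AdmU N (b≢m A) e∉U) (Ok-mono ext-⊆ okX)
        s∉P : s ∉ₛ Py S A
        s∉P p with ext-inv p
        ... | α , t , t∈ , e′ = s∉ (IsSub.resp (isSub S) {t} (λ i → sym (trans (e′ i) (trans (+-congʳ (trans (*-congʳ α≈0) (zeroˡ _))) (+-identityˡ _)))) t∈)
          where
          α≈0 : α ≈ 0#
          α≈0 = trans (sym (*-identityʳ α)) (trans (*-congˡ (sym (y-off (b≢m A)))) (trans (sym (+-identityʳ _)) (trans (+-congˡ (sym (deg A t∈))) (trans (sym (e′ m)) (degU N s∈)))))
        X⊆P : ext X (y b) (λ h → y∉ (deg A) (b≢m A) (X⊆S ! h)) ⊆ Py S A
        X⊆P = ext-least (⊆-trans X⊆S ext-⊆) ext-∈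
        X⊆P₂ : ext X (y b) (λ h → y∉ (deg A) (b≢m A) (X⊆S ! h)) ⊆ Py S₂ A₂
        X⊆P₂ = ext-least (⊆-trans ext-⊆ ext-⊆) ext-∈
        go : (∃ λ a → f (P𝟙 S₂ (deg A₂)) ∈A a × f (Py S₂ A₂) ∈A a) → ⊥
        go (a , p , p′) = avoidy A₂ ext-⊆ okX ca (A-uniq (hom (ndPy A) (ndPy A₂) (star-adj X⊆P X⊆P₂ (λ h → s∉P (bwd h ! (ext-⊆ ! ext-∈)))))
          (A-resp e (spec-A N sv S₂⊆U A₂ e∉U p p′)) p′ (ca X⊆P (ndPy A)) (ca X⊆P₂ (ndPy A₂)) p)

    opaque
      deg-of : ∀ {U : Vtx} → ¬ ND J U → ND J′ U → Deg U
      deg-of ¬nd nd′ = ¬Hits (λ h → ¬nd (h All.∷ nd′))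

    value : ∀ U → Dec (ND J U) → Dec (ND J′ U) → Vtx
    value U (yes _) _ = f U
    value U (no h) (yes p) = proj₁ (new-value (mkNew (deg-of h p) p))
    -- An arbitrary value on vertices that J′ still excludes.
    value U (no _) (no _) = U

    opaque
      g : Vtx → Vtx
      g U = value U (ND? J U) (ND? J′ U)

      g-old : ∀ {U} → ND J U → g U ≐ f U
      g-old {U} nd = go (ND? J U)
        where
        go : ∀ d → value U d (ND? J′ U) ≐ f U
        go (yes _) = ≐-refl
        go (no h) = ⊥-elim (h nd)

      g-new : ∀ {U} → ¬ ND J U → ND J′ U → Spec U (g U)
      g-new {U} ¬nd nd′ = go (ND? J U) (ND? J′ U)
        where
        go : ∀ d d′ → Spec U (value U d d′)
        go (yes nd) _ = ⊥-elim (¬nd nd)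
        go (no h) (yes p) = proj₂ (new-value (mkNew (deg-of h p) p))
        go (no _) (no h) = ⊥-elim (h nd′)

      new-¬ND : ∀ {U} → New U → ¬ ND J U
      new-¬ND N ((x , x∈ , x≉) All.∷ _) = x≉ (degU N x∈)

      hits-top : ∀ {i j} {S : Sp i} {U : Sp (suc i)} {u} → S ⊆ U → u ∈ₛ U → u ∉ₛ S → ¬ Hits j S → Hits j U → ¬ u j ≈ 0#
      hits-top {j = j} S⊆U u∈ u∉ ¬h (x , x∈ , x≉) u≈0 with hyper-inv S⊆U u∈ u∉ x∈
      ... | α , s , s∈ , e = x≉ (trans (e j) (trans (+-cong (trans (*-congˡ u≈0) (zeroʳ α)) (¬Hits ¬h s∈)) (+-identityˡ 0#)))

      P𝟙-fix : ∀ {S} (d d′ : Deg S) → f (P𝟙 S d) ≐ f (P𝟙 S d′)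
      P𝟙-fix d d′ = resp (ndP𝟙 d) (⊆⇒≐ (ext-least ext-⊆ ext-∈))

    opaque
      memberA : ∀ {S W b a} → S ⊆ W → ND J′ W → (𝟙∉W : 𝟙 ∉ₛ W) (A : Adm b S) → 𝕖 b ∉ₛ ext W 𝟙 𝟙∉W → f (P𝟙 S (deg A)) ∈A a → f (Py S A) ∈A a → g W ∈A a
      memberA {S} {W} {b} {a} S⊆W ndW 𝟙∉W A e∉W p p′ with ND? J W
      ... | no ¬nd = spec-A nw (g-new ¬nd ndW) S⊆W A (λ h → e∉W (ext-⊆ ! h)) p p′
        where
        nw : New W
        nw = mkNew (deg-of ¬nd ndW) ndW
      ... | yes nd = A-resp (≐-sym (g-old nd)) (same-A {S₀ = ext (tailSp S) 𝟙 (λ h → 𝟙∉ (deg A) (tailSp-⊆ ! h))} {P = P𝟙 S (deg A)} {P₁ = Py S A} {T₁ = T₁} {T₂ = ext W 𝟙 𝟙∉W}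
            (𝟙-ND ext-∈) (ext-least (⊆-trans tailSp-⊆ ext-⊆) ext-∈) ext-⊆ (ext-least (⊆-trans S⊆W ext-⊆) ext-∈) (λ h → e∉W (y⇒𝕖 (h ! ext-∈) ext-∈))
            (Cover.cov (cap𝟙 {T₁} (ext-⊆ ! ext-∈))) (Cover.cov cW) (ndPy A) (ext-least (⊆-trans ext-⊆ ext-⊆) ext-∈) (P𝟙≭Py A)
            (Cover.cov cW ext-⊆ nd) (hom nd (ndP𝟙 (deg A)) (star-adj {S = S} S⊆W ext-⊆ (λ e → 𝟙∉W (bwd e ! ext-∈))))
            (hom nd (ndPy A) (star-adj {S = S} S⊆W ext-⊆ (λ e → e∉W (y⇒𝕖 (ext-⊆ ! (bwd e ! ext-∈)) ext-∈)))) p p′)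
        where
        T₁ : Cap
        T₁ = ext (P𝟙 S (deg A)) (y b) (y∉+𝟙 (deg A) (b≢m A) (e∉ A))
        cW : Cover (ext W 𝟙 𝟙∉W)
        cW = cap𝟙 ext-∈

      in-cap𝟙 : ∀ {W T} → ND J′ W → W ⊆ T → (𝟙∈ : 𝟙 ∈ₛ T) → g W ∈B Cover.blk (cap𝟙 {T} 𝟙∈)
      in-cap𝟙 {W} ndW W⊆T 𝟙∈ with ND? J W
      ... | yes nd = B-resp (≐-sym (g-old nd)) (Cover.cov (cap𝟙 𝟙∈) W⊆T nd)
      ... | no ¬nd = proj₁ (g-new ¬nd ndW) W⊆T 𝟙∈ (Cover.cov (cap𝟙 𝟙∈))

    -- If 𝟙 ∈ U + W, both values lie in the block of U + ⟨𝟙⟩ and only their difference is at stake.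
    -- If not, U + ⟨𝟙⟩ and W + ⟨𝟙⟩ share just S + ⟨𝟙⟩, which makes the values differ, and a common
    -- block has to be found.
    module NewEdge {U W : Vtx} (N : New U) (ndW : ND J′ W) (S : Edge) (S⊆U : S ⊆ U) (S⊆W : S ⊆ W) (W⊈U : W ⊈ U) where
      sv : Spec U (g U)
      sv = g-new (new-¬ND N) (ndU N)
      degS : Deg S
      degS p = degU N (S⊆U ! p)
      opaque
        w : Vect
        w = proj₁ (⊈-witness W⊈U)
        w∈ : w ∈ₛ W
        w∈ = proj₁ (proj₂ (⊈-witness W⊈U))
        w∉ : w ∉ₛ U
        w∉ = proj₂ (proj₂ (⊈-witness W⊈U))
        u : Vect
        u = proj₁ (outside ℕₚ.≤-refl S U)
        u∈ : u ∈ₛ U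
        u∈ = proj₁ (proj₂ (outside ℕₚ.≤-refl S U))
        u∉ : u ∉ₛ S
        u∉ = proj₂ (proj₂ (outside ℕₚ.≤-refl S U))
      w∉S : w ∉ₛ S
      w∉S p = w∉ (S⊆U ! p)
      T : Cap
      T = ext U w w∉
      opaque
        W⊆T : W ⊆ T
        W⊆T = ⊆-trans (ext-hyper {x∉ = w∉S} S⊆W w∈) (ext-least (⊆-trans S⊆U ext-⊆) ext-∈)
        P⊆ : ∀ {T′ : Cap} → S ⊆ T′ → 𝟙 ∈ₛ T′ → P𝟙 S degS ⊆ T′
        P⊆ h p = ext-least h p

        case₁ : 𝟙 ∈ₛ W → g U ~ g W
        case₁ 𝟙∈W = ~-resp ≐-refl (≐-trans (resp (ndP𝟙 degS) (⊆⇒≐ (ext-least S⊆W 𝟙∈W))) (≐-sym (g-old (𝟙-ND 𝟙∈W))))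
          (B-adj (proj₁ sv ext-⊆ ext-∈ (Cover.cov (C𝟙 (degU N)))) (Cover.cov (C𝟙 (degU N)) (P⊆ (⊆-trans S⊆U ext-⊆) ext-∈) (ndP𝟙 degS)) (not-P𝟙 N sv S⊆U degS))

      module Through (𝟙∉W : 𝟙 ∉ₛ W) (𝟙∈T : 𝟙 ∈ₛ T) where
        opaque
          decomp : ∃ λ u′ → u′ ∈ₛ U × (∀ i → 1# ≈ w i + u′ i)
          decomp with ext-inv 𝟙∈T
          ... | α , u′ , u′∈ , e with bin α
          ...   | inj₁ α≈0 = ⊥-elim (𝟙∉ (degU N) (IsSub.resp (isSub U) {u′} (λ i → sym (trans (e i) (trans (+-congʳ (trans (*-congʳ α≈0) (zeroˡ _))) (+-identityˡ _)))) u′∈))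
          ...   | inj₂ α≈1 = u′ , u′∈ , λ i → trans (e i) (+-congʳ (trans (*-congʳ α≈1) (*-identityˡ _)))

          u′∉S : proj₁ decomp ∉ₛ S
          u′∉S p = 𝟙∉W (IsSub.resp (isSub W) {w +ᵥ proj₁ decomp} (λ i → sym (proj₂ (proj₂ decomp) i)) (IsSub.add (isSub W) w∈ (S⊆W ! p)))

          -- At a coordinate of J′ missed by S both w and u′ would be 1, yet they add up to 𝟙.
          ndS : ND J′ S
          ndS = All.tabulate (λ {j} j∈ → decidable-stable (Hits? j S) (λ ¬h → 1≉0 (trans (proj₂ (proj₂ decomp) j)
            (trans (+-cong (≉0⇒1 (hits-top S⊆W w∈ w∉S ¬h (All.lookup ndW j∈))) (≉0⇒1 (hits-top S⊆U (proj₁ (proj₂ decomp)) u′∉S ¬h (All.lookup (ndU N) j∈)))) 1+1))))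

          ndW′ : ND J W
          ndW′ = (w , w∈ , λ e → 1≉0 (trans (proj₂ (proj₂ decomp) m) (trans (+-cong e (degU N (proj₁ (proj₂ decomp)))) (+-identityˡ 0#)))) All.∷ ndW

        opaque
          case₂ : g U ~ g W
          case₂ with some-b𝟙 {T} 𝟙∈T
          ... | b , b≢m′ , e∉T with shrink {b = b} {b} {S} (ND⇒Ok ndS) (ND⇒Ok ndS)
          ...   | X , X⊆S , okX , _ = ~-resp ≐-refl (≐-sym (g-old ndW′)) (B-adj
                  (proj₁ sv ext-⊆ ext-∈ (Cover.cov (C𝟙 (degU N)))) (Cover.cov (C𝟙 (degU N)) (⊆-trans W⊆T (eqdim (ext-least ext-⊆ 𝟙∈T))) ndW′)
                  -- Equal values would lie in the blocks of U + ⟨y b⟩ and W + ⟨y b⟩, hence be f(S +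
                  -- ⟨y b⟩).
                  (λ e → not-Py N sv S⊆U AS e∉U (caps-share {S = ext X (y b) (λ p → y∉ degS b≢m′ (X⊆S ! p))} {P = Py S AS} {T₁ = U+y AU} {T₂ = T₅}
                    (y-ND b≢m′ ext-∈ (Ok-mono ext-⊆ okX)) (ext-least (⊆-trans X⊆S ext-⊆) ext-∈) (ext-least (⊆-trans S⊆U ext-⊆) ext-∈) (ext-least (⊆-trans S⊆W ext-⊆) ext-∈)
                    (λ h → e∉T (y⇒𝕖 (bwd (caps-meet W⊈U ext-⊆ W⊆T (⊆-trans ext-⊆ h) ext-⊆) ! ext-∈) 𝟙∈T))
                    (Cover.cov (Cy AU)) (Cover.cov c₅) (proj₂ sv AU ext-⊆ ext-∈ (Cover.cov (Cy AU))) (B-resp (≐-sym e) (Cover.cov c₅ ext-⊆ ndW′)))))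
            where
            e∉U : 𝕖 b ∉ₛ U
            e∉U p = e∉T (ext-⊆ ! p)
            AU : Adm b U
            AU = AdmU N b≢m′ e∉U
            AS : Adm b S
            AS = adm-mono S⊆U AU (ND⇒Ok ndS)
            T₅ : Cap
            T₅ = ext W (y b) (λ p → e∉T (y⇒𝕖 (W⊆T ! p) 𝟙∈T))
            c₅ : Cover T₅
            c₅ = capy b≢m′ ext-∈ (Ok-mono ext-⊆ (ND⇒Ok ndW))

      module Beside (𝟙∉W : 𝟙 ∉ₛ W) (𝟙∉T : 𝟙 ∉ₛ T) where
        Tw : Cap
        Tw = ext W 𝟙 𝟙∉W
        opaque
          not-eq : ¬ g U ≐ g W
          not-eq e = not-P𝟙 N sv S⊆U degS (caps-share {S = ext (tailSp S) 𝟙 (λ h → 𝟙∉ degS (tailSp-⊆ ! h))} {P = P𝟙 S degS} {T₁ = U+𝟙 (degU N)} {T₂ = Tw}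
            (𝟙-ND ext-∈) (ext-least (⊆-trans tailSp-⊆ ext-⊆) ext-∈) (P⊆ (⊆-trans S⊆U ext-⊆) ext-∈) (P⊆ (⊆-trans S⊆W ext-⊆) ext-∈)
            (λ h → 𝟙∉T (bwd (caps-meet W⊈U ext-⊆ W⊆T (⊆-trans ext-⊆ h) ext-⊆) ! ext-∈))
            (Cover.cov (C𝟙 (degU N))) (Cover.cov (cap𝟙 {Tw} ext-∈)) (proj₁ sv ext-⊆ ext-∈ (Cover.cov (C𝟙 (degU N)))) (B-resp (≐-sym e) (in-cap𝟙 ndW ext-⊆ ext-∈)))

          A-route : ∀ {b b′} (A : Adm b S) (A′ : Adm b′ S) → 𝕖 b ∉ₛ U → 𝕖 b′ ∉ₛ Tw → g U ~ g W
          A-route A A′ e∉U e∉Tw with A-join (fP~ A)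
          ... | a , p , p′ = A-adj (spec-A N sv S⊆U A e∉U p p′) (memberA S⊆W ndW 𝟙∉W A′ e∉Tw (A-resp (P𝟙-fix (deg A) (deg A′)) p) (AB A A′ p p′)) not-eq

          B-route : ∀ {b} → Adm b S → 𝕖 b ∉ₛ U → y b ∈ₛ W → g U ~ g W
          B-route {b} A e∉U y∈W = B-adj (proj₂ sv AU ext-⊆ ext-∈ (Cover.cov (Cy AU))) (B-resp (≐-sym (g-old nd)) (Cover.cov (Cy AU) W⊆ nd)) not-eq
            where
            AU : Adm b U
            AU = AdmU N (b≢m A) e∉U
            nd : ND J W
            nd = y-ND (b≢m A) y∈W (ND⇒Ok ndW)
            W⊆ : W ⊆ U+y AU
            W⊆ = ⊆-trans (ext-hyper {x∉ = y∉ degS (b≢m A)} S⊆W y∈W) (ext-least (⊆-trans S⊆U ext-⊆) ext-∈)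

          regular : ND J′ S → g U ~ g W
          regular ndS with some-b {U} (degU N) | some-b𝟙 {Tw} ext-∈
          ... | b , b≢m′ , e∉U | b′ , b′≢m , e∉Tw = A-route (adm-mono S⊆U (AdmU N b≢m′ e∉U) (ND⇒Ok ndS)) (mkAdm degS b′≢m (λ p → e∉Tw (ext-⊆ ! (S⊆W ! p))) (ND⇒Ok ndS)) e∉U e∉Tw

        -- S vanishes at j₀ while u and w are 1 there. So for b ≠ j₀ any 𝕖 b in U or W is already in
        -- S, and b can be chosen by looking at S alone.
        module Special (j₀ : Fin n) (j₀∈ : j₀ ∈ᴸ J′) (¬hit : ¬ Hits j₀ S) where
          opaque
            zero-at : ∀ {i} {R : Sp (suc i)} {Q : Sp i} {r b} → (∀ {x} → x ∈ₛ Q → x j₀ ≈ 0#) → (r∉ : r ∉ₛ Q) → ¬ r j₀ ≈ 0# → ¬ b ≡ j₀ → 𝕖 b ∈ₛ ext Q r r∉ → 𝕖 b ∈ₛ Q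
            zero-at {Q = Q} {r} {b} z r∉ rj b≢j₀ p with ext-inv p
            ... | α , s , s∈ , e with α ≟ 0#
            ...   | yes α≈0 = IsSub.resp (isSub Q) {s} (λ i → sym (trans (e i) (trans (+-congʳ (trans (*-congʳ α≈0) (zeroˡ _))) (+-identityˡ _)))) s∈
            ...   | no α≉0 = ⊥-elim (*-≉0 α≉0 rj (trans (sym (+-identityʳ _)) (trans (+-congˡ (sym (z s∈))) (trans (sym (e j₀)) (𝕖-off b≢j₀)))))

            uj : ∀ {j} → j ∈ᴸ J′ → ¬ Hits j S → u j ≈ 1#
            uj j∈ h = ≉0⇒1 (hits-top S⊆U u∈ u∉ h (All.lookup (ndU N) j∈))
            wj : ∀ {j} → j ∈ᴸ J′ → ¬ Hits j S → w j ≈ 1#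
            wj j∈ h = ≉0⇒1 (hits-top S⊆W w∈ w∉S h (All.lookup ndW j∈))

            -- Otherwise each j ≠ m has 𝕖 j in S or is in J′ and missed by S, where u and w are 1.
            -- Then w - 𝟙, if W hits m, or else w - u is a combination of the 𝕖 j in S, giving 𝟙 ∈ W
            -- or w ∈ U.
            usable : ∃ λ b → ¬ b ≡ m × Ok b S × 𝕖 b ∉ₛ S
            usable with Fₚ.any? (λ b → ¬? (b Fₚ.≟ m) ×-dec (Ok? b S ×-dec ¬? (𝕖 b ∈? S)))
            ... | yes (b , p , p′ , p″) = b , p , p′ , p″
            ... | no ∄ = ⊥-elim (go (Hits? m W))
              where
              split-j : ∀ j → ¬ j ≡ m → (j ∈ᴸ J′ × ¬ Hits j S) ⊎ (𝕖 j ∈ₛ S)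
              split-j j j≢m with 𝕖 j ∈? S
              ... | yes p = inj₂ p
              ... | no p with j ∈ᴸ? J′ | Hits? j S
              ...   | yes j∈ | no ¬h = inj₁ (j∈ , ¬h)
              ...   | yes j∈ | yes h = ⊥-elim (∄ (j , j≢m , (λ _ → h) , p))
              ...   | no j∉ | _ = ⊥-elim (∄ (j , j≢m , (λ j∈ → ⊥-elim (j∉ j∈)) , p))
              go : Dec (Hits m W) → ⊥
              go (yes hm) = 𝟙∉W (IsSub.resp (isSub W) (λ i → solve 1 (λ w → w :- (w :- con (+ 1)) := con (+ 1)) refl (w i)) (IsSub.sub (isSub W) w∈ (S⊆W ! coord-in S (w -ᵥ 𝟙) coord)))
                where
                coord : ∀ j → (w j + - 1# ≈ 0#) ⊎ (𝕖 j ∈ₛ S)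
                coord j with j Fₚ.≟ m
                ... | yes ≡.refl = inj₁ (trans (+-congʳ (≉0⇒1 (hits-top S⊆W w∈ w∉S (λ (x , x∈ , x≉) → x≉ (degS x∈)) hm))) (-‿inverseʳ 1#))
                ... | no j≢m with split-j j j≢m
                ...   | inj₂ p = inj₂ p
                ...   | inj₁ (j∈ , ¬h) = inj₁ (trans (+-congʳ (wj j∈ ¬h)) (-‿inverseʳ 1#))
              go (no ¬hm) = w∉ (IsSub.resp (isSub U) (λ i → solve 2 (λ w u → (w :- u) :+ u := w) refl (w i) (u i)) (IsSub.add (isSub U) (S⊆U ! coord-in S (w -ᵥ u) coord) u∈))
                where
                coord : ∀ j → (w j + - u j ≈ 0#) ⊎ (𝕖 j ∈ₛ S)
                coord j with j Fₚ.≟ m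
                ... | yes ≡.refl = inj₁ (trans (+-cong (¬Hits ¬hm w∈) (-‿cong (degU N u∈))) (-‿inverseʳ 0#))
                ... | no j≢m with split-j j j≢m
                ...   | inj₂ p = inj₂ p
                ...   | inj₁ (j∈ , ¬h) = inj₁ (trans (+-cong (wj j∈ ¬h) (-‿cong (uj j∈ ¬h))) (-‿inverseʳ 1#))

            special : g U ~ g W
            special with usable
            ... | b , b≢m′ , okS , e∉S = decide (𝕖 b ∈? Tw)
              where
              AS : Adm b S
              AS = mkAdm degS b≢m′ e∉S okS
              b≢j₀ : ¬ b ≡ j₀
              b≢j₀ ≡.refl = ¬hit (okS j₀∈)
              off-S : ∀ {x} → x ∈ₛ S → x j₀ ≈ 0#
              off-S = ¬Hits ¬hit
              1-≉ : ∀ {x} → x ≈ 1# → ¬ x ≈ 0#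
              1-≉ e h = 1≉0 (trans (sym e) h)
              e∉U : 𝕖 b ∉ₛ U
              e∉U p = e∉S (zero-at {R = U} off-S u∉ (1-≉ (uj j₀∈ ¬hit)) b≢j₀ (ext-hyper S⊆U u∈ ! p))
              e∉W : 𝕖 b ∉ₛ W
              e∉W p = e∉S (zero-at {R = W} off-S w∉S (1-≉ (wj j₀∈ ¬hit)) b≢j₀ (ext-hyper S⊆W w∈ ! p))
              decide : Dec (𝕖 b ∈ₛ Tw) → g U ~ g W
              decide (no e∉Tw) = A-route AS AS e∉U e∉Tw
              decide (yes e∈Tw) with ext-inv e∈Tw
              ... | γ , w′ , w′∈ , e with bin γ
              ...   | inj₁ γ≈0 = ⊥-elim (e∉W (IsSub.resp (isSub W) {w′} (λ i → sym (trans (e i) (trans (+-congʳ (trans (*-congʳ γ≈0) (zeroˡ _))) (+-identityˡ _)))) w′∈))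
              -- From 𝕖 b = 𝟙 + w′ it follows that y b = 𝟙 + 𝕖 b = w′ is in W.
              ...   | inj₂ γ≈1 = B-route AS e∉U (IsSub.resp (isSub W) {w′} (λ i → sym (trans (+-congˡ (trans (e i) (+-congʳ (trans (*-congʳ γ≈1) (*-identityˡ 1#)))))
                          (trans (solve 1 (λ w → con (+ 1) :+ (con (+ 1) :+ w) := (con (+ 1) :+ con (+ 1)) :+ w) refl (w′ i)) (trans (+-congʳ 1+1) (+-identityˡ _))))) w′∈)

        opaque
          case₃ : g U ~ g W
          case₃ with ND? J′ S
          ... | yes ndS = regular ndS
          ... | no ¬nd with find (¬All⇒Any¬ (λ j → Hits? j S) J′ ¬nd)
          ...   | j₀ , j₀∈ , ¬hit = Special.special j₀ j₀∈ ¬hit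

      opaque
        new-hom : g U ~ g W
        new-hom with 𝟙 ∈? W | 𝟙 ∈? T
        ... | yes 𝟙∈W | _ = case₁ 𝟙∈W
        ... | no 𝟙∉W | yes 𝟙∈T = Through.case₂ 𝟙∉W 𝟙∈T
        ... | no 𝟙∉W | no 𝟙∉T = Beside.case₃ 𝟙∉W 𝟙∉T

    opaque
      g-hom : ∀ {U W} → ND J′ U → ND J′ W → U ~ W → g U ~ g W
      g-hom {U} {W} ndU′ ndW′ U~W with ND? J U | ND? J W
      ... | yes nd | yes nd′ = ~-resp (≐-sym (g-old nd)) (≐-sym (g-old nd′)) (hom nd nd′ U~W)
      ... | no ¬nd | _ = NewEdge.new-hom (mkNew (deg-of ¬nd ndU′) ndU′) ndW′ (core U~W) (core-l U~W) (core-r U~W) (λ h → differ U~W (eqdim h))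
      ... | yes _ | no ¬nd = ~-sym (NewEdge.new-hom (mkNew (deg-of ¬nd ndW′) ndW′) ndU′ (core U~W) (core-r U~W) (core-l U~W) (differ U~W))

      g-resp : ∀ {U W} → ND J′ U → U ≐ W → g U ≐ g W
      g-resp {U} {W} ndU′ e with ND? J U
      ... | yes nd = ≐-trans (g-old nd) (≐-trans (resp nd e) (≐-sym (g-old (ND-mono (fwd e) nd))))
      ... | no ¬nd = spec-unique (mkNew (deg-of ¬nd ndU′) ndU′) (g-new ¬nd ndU′)
              ((λ U⊆T → proj₁ sW (⊆-trans (bwd e) U⊆T)) , (λ A U⊆T → proj₂ sW (mkAdm (λ p → deg A (bwd e ! p)) (b≢m A) (λ p → e∉ A (bwd e ! p)) (Ok-mono (fwd e) (ok A))) (⊆-trans (bwd e) U⊆T)))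
        where
        sW : Spec W (g W)
        sW = g-new (λ nd → ¬nd (ND-mono (bwd e) nd)) (ND-mono (fwd e) ndU′)

    module M′ = Maps G J′ g

    opaque
      g-edgeA : ∀ {S : Edge} → ND J′ S → ∃ λ a → M′.CovA a S
      g-edgeA {S} ndS with Hits? m S
      ... | yes h with edgeA (h All.∷ ndS)
      ...   | a , ca = a , λ S⊆U _ → A-resp (≐-sym (g-old (ND-mono S⊆U (h All.∷ ndS)))) (ca S⊆U (ND-mono S⊆U (h All.∷ ndS)))
      g-edgeA {S} ndS | no ¬h with some-b𝟙 {T} 𝟙∈T
        where
        degS : Deg S
        degS = ¬Hits ¬h
        T : Cap
        T = ext (P𝟙 S degS) (proj₁ (outside k<n (P𝟙 S degS) 𝕖-basis)) (proj₂ (proj₂ (outside k<n (P𝟙 S degS) 𝕖-basis)))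
        𝟙∈T : 𝟙 ∈ₛ T
        𝟙∈T = ext-⊆ ! ext-∈
      ... | b , b≢m′ , e∉T = found (A-join (fP~ AS))
        where
        degS : Deg S
        degS = ¬Hits ¬h
        AS : Adm b S
        AS = mkAdm degS b≢m′ (λ p → e∉T (ext-⊆ ! (ext-⊆ ! p))) (ND⇒Ok ndS)
        found : (∃ λ a → f (P𝟙 S degS) ∈A a × f (Py S AS) ∈A a) → ∃ λ a → M′.CovA a S
        found (a , p , p′) = a , cov
          where
          cov : M′.CovA a S
          cov {U} S⊆U ndU′ with 𝟙 ∈? U
          ... | yes 𝟙∈U = A-resp (≐-trans (resp (ndP𝟙 degS) (⊆⇒≐ (ext-least S⊆U 𝟙∈U))) (≐-sym (g-old (𝟙-ND 𝟙∈U)))) p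
          ... | no 𝟙∉U with some-b𝟙 {ext U 𝟙 𝟙∉U} ext-∈
          ...   | b′ , b′≢m , e∉U = memberA S⊆U ndU′ 𝟙∉U A′ e∉U (A-resp (P𝟙-fix degS degS) p) (AB AS A′ p p′)
            where
            A′ : Adm b′ S
            A′ = mkAdm degS b′≢m (λ p → e∉U (ext-⊆ ! (S⊆U ! p))) (ND⇒Ok ndS)

      cap-over : (U : Vtx) → Σ Cap λ T → (U ⊆ T) × (𝟙 ∈ₛ T)
      cap-over U with 𝟙 ∈? U
      ... | no h = ext U 𝟙 h , ext-⊆ , ext-∈
      ... | yes p with 𝕖-outside k<n U
      ...   | i , h = ext U (𝕖 i) h , ext-⊆ , ext-⊆ ! p

      -- If the blocks agreed, the pencil between S₁ and a cap over U₀ containing 𝟙, with one vertex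
      -- over S₂, would give q + 2 images in a₂ and in the B-block of the cap.
      g-sep : ∀ {S₁ S₂ : Edge} {U₀ : Vtx} {a₁ a₂} → ND J′ S₁ → ND J′ S₂ → S₁ ⊆ U₀ → S₂ ⊆ U₀ → S₂ ⊈ S₁ → M′.CovA a₁ S₁ → M′.CovA a₂ S₂ →
        ∀ {v w} → v ~ w → v ∈A a₁ → w ∈A a₁ → v ∈A a₂ → w ∈A a₂ → ⊥
      g-sep {S₁} {S₂} {U₀} {a₁} {a₂} nd₁ nd₂ s₁ s₂ ne c₁ c₂ v~w v₁ w₁ v₂ w₂ with cap-over U₀
      ... | T , U₀⊆T , 𝟙∈T with outside ℕₚ.≤-refl U₀ T
      ...   | t , t∈ , t∉ = go (A∩B {a₂} {Cover.blk (cap𝟙 {T} 𝟙∈T)} (g ∘ c) c∈A c∈B)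
        where
        open Pencil S₁ T (⊆-trans s₁ U₀⊆T) using (pen; pen-⊆; pen-inj)
        Q : Vtx
        Q = ext S₂ t (λ p → t∉ (s₂ ! p))
        Q⊆T : Q ⊆ T
        Q⊆T = ext-least (⊆-trans s₂ U₀⊆T) t∈
        S₁⊈Q : S₁ ⊈ Q
        S₁⊈Q h = t∉ (bwd (edges-span ne s₁ s₂ h ext-⊆) ! ext-∈)
        c : Fin (suc (suc q)) → Vtx
        c zero = Q
        c (suc i) = pen i
        ndc : ∀ i → ND J′ (c i)
        ndc zero = ND-mono ext-⊆ nd₂
        ndc (suc i) = ND-mono ext-⊆ nd₁
        c⊆T : ∀ i → c i ⊆ T
        c⊆T zero = Q⊆T
        c⊆T (suc i) = pen-⊆ i
        c-inj : ∀ i j → c i ≐ c j → i ≡ j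
        c-inj zero zero e = ≡.refl
        c-inj zero (suc j) e = ⊥-elim (S₁⊈Q (⊆-trans ext-⊆ (bwd e)))
        c-inj (suc i) zero e = ⊥-elim (S₁⊈Q (⊆-trans ext-⊆ (fwd e)))
        c-inj (suc i) (suc j) e = ≡.cong suc (pen-inj i j e)
        c∈A : ∀ i → g (c i) ∈A a₂
        c∈A zero = c₂ ext-⊆ (ndc zero)
        c∈A (suc i) = A-uniq v~w v₁ w₁ v₂ w₂ (c₁ ext-⊆ (ndc (suc i)))
        c∈B : ∀ i → g (c i) ∈B Cover.blk (cap𝟙 {T} 𝟙∈T)
        c∈B i = in-cap𝟙 (ndc i) (c⊆T i) 𝟙∈T
        go : Collide (g ∘ c) → ⊥
        go (i , j , i≢j , e) = ~⇒≭ (g-hom (ndc i) (ndc j) (top-adj (c⊆T i) (c⊆T j) (λ h → i≢j (c-inj i j h)))) e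

    extension : Extension G J J′ f
    extension = record
      { g = g
      ; invariant = record { resp = g-resp ; hom = g-hom ; edgeA = g-edgeA ; sep = g-sep }
      ; agree = g-old
      ; uniq = uniq′ }
      where
      uniq′ : ∀ (h : Vtx → Vtx) → (∀ {U W} → U ~ W → h U ~ h W) → (∀ {U} → ND J U → h U ≐ f U) → ∀ {U} → ND J′ U → h U ≐ g U
      uniq′ h h-hom h≐f {U} nd′ with ND? J U
      ... | yes nd = ≐-trans (h≐f nd) (≐-sym (g-old nd))
      ... | no ¬nd = spec-unique nw (spec-mk (degU nw) (Cover.strong (C𝟙 (degU nw)) (h U) (nbr ext-⊆)) (λ A → Cover.strong (Cy A) (h U) (nbr ext-⊆))) (g-new ¬nd nd′)
        where
        nw : New U
        nw = mkNew (deg-of ¬nd nd′) nd′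
        nbr : ∀ {T : Cap} → U ⊆ T → ∀ P → P ⊆ T → ND J P → h U ~ f P
        nbr U⊆T P P⊆T ndP = ~-resp ≐-refl (h≐f ndP) (h-hom (top-adj U⊆T P⊆T (λ e → ¬nd (ND-mono (bwd e) ndP))))

  binary-all : (∀ x → (x ≈ 0#) ⊎ (x ≈ 1#)) → (G : Geo) (J : List (Fin n)) (f : Vtx → Vtx) → Maps.Inv G J f → Extension G J List.[] f
  binary-all bin G List.[] f i = record { g = f ; invariant = i ; agree = λ _ → ≐-refl ; uniq = λ h h-hom h≐f → h≐f }
  binary-all bin G (m List.∷ J′) f i = compose e (binary-all bin G J′ (Extension.g e) (Extension.invariant e))
    where
    e : Extension G (m List.∷ J′) J′ f
    e = Binary.extension bin G m J′ f i

-- Assembly of part (1)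

module Assemble (F : Field) (q : ℕ) (hs : HasSize F q) where
  extend : ∀ n k₂ d₂ (n≡ : suc (suc (suc d₂)) ℕ.+ suc k₂ ≡ n) → 3 ≤ q ⊎ 3 ≤ suc (suc k₂) →
    ∀ G J f → Grassmannian.Maps.Inv F q hs n k₂ d₂ n≡ G J f → Grassmannian.Extension F q hs n k₂ d₂ n≡ G J List.[] f
  extend n k₂ d₂ n≡ big G J f i with Grassmannian.third-or-binary F q hs n k₂ d₂ n≡ | big
  ... | inj₁ (ω , ω≉0 , ω≉1) | _ = Grassmannian.LargeField.extension F q hs n k₂ d₂ n≡ ω ω≉0 ω≉1 G J f i
  ... | inj₂ bin | inj₁ 3≤q = ⊥-elim (Grassmannian.binary⇒q≤2 F q hs n k₂ d₂ n≡ bin 3≤q)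
  extend n (suc k₃) d₂ n≡ big G J f i | inj₂ bin | inj₂ _ = BinaryStep.binary-all F q hs n k₃ d₂ n≡ bin G J f i
  extend n 0ⁿ d₂ n≡ big G J f i | inj₂ bin | inj₂ (s≤s (s≤s ()))

  module Part1 (n k₂ d₂ : ℕ) (n≡ : suc (suc (suc d₂)) ℕ.+ suc k₂ ≡ n) (big : 3 ≤ q ⊎ 3 ≤ suc (suc k₂)) where
    open Grassmannian F q hs n k₂ d₂ n≡

    module For (f : Gn.Code → Gn.Gr) (iso : Gn.IsIsoOntoSubgraph f) where
      private
        f-resp : ∀ C D → proj₁ C Gn.≈ₛ proj₁ D → f C Gn.≈ₛ f D
        f-resp = proj₁ iso
        f-inj : ∀ C D → f C Gn.≈ₛ f D → proj₁ C Gn.≈ₛ proj₁ D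
        f-inj = proj₁ (proj₂ iso)
        f-adj : ∀ C D → Gn.Adj (proj₁ C) (proj₁ D) → Gn.Adj (f C) (f D)
        f-adj = proj₂ (proj₂ iso)

      code : ∀ U → ND J₀ U → Gn.Code
      code U nd = toGr U , ND⇒NonDeg (toGr U) (ND-mono (bwd (to-from U)) nd)

      value : ∀ U → Dec (ND J₀ U) → Vtx
      value U (yes nd) = toSp (f (code U nd))
      value U (no _) = U

      opaque
        f̂ : Vtx → Vtx
        f̂ U = value U (ND? J₀ U)

        -- The proof stored in the code need not be the given one, so it is returned; `f-resp` makes
        -- the choice harmless.
        f̂-spec : ∀ {U} → ND J₀ U → ∃ λ nd → f̂ U ≐ toSp (f (code U nd))
        f̂-spec {U} nd = go (ND? J₀ U)
          where
          go : ∀ d → ∃ λ nd → value U d ≐ toSp (f (code U nd))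
          go (yes nd) = nd , ≐-refl
          go (no h) = ⊥-elim (h nd)

      opaque
        f̂-resp : ∀ {U W} → ND J₀ U → U ≐ W → f̂ U ≐ f̂ W
        f̂-resp {U} {W} ndU e with f̂-spec ndU | f̂-spec {W} (ND-mono (fwd e) ndU)
        ... | nd , p | nd′ , p′ = ≐-trans p (≐-trans (≈⇒≐ _ _ (f-resp (code U nd) (code W nd′) (≐⇒≈ _ _ (≐-trans (to-from U) (≐-trans e (≐-sym (to-from W))))))) (≐-sym p′))

        f̂-inj : ∀ {U W} → ND J₀ U → ND J₀ W → f̂ U ≐ f̂ W → U ≐ W
        f̂-inj {U} {W} ndU ndW e with f̂-spec ndU | f̂-spec ndW
        ... | nd , p | nd′ , p′ = ≐-trans (≐-sym (to-from U)) (≐-trans (≈⇒≐ _ _ (f-inj (code U nd) (code W nd′) (≐⇒≈ _ _ (≐-trans (≐-sym p) (≐-trans e p′))))) (to-from W))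

        f̂-hom : ∀ {U W} → ND J₀ U → ND J₀ W → U ~ W → f̂ U ~ f̂ W
        f̂-hom {U} {W} ndU ndW h with f̂-spec ndU | f̂-spec ndW
        ... | nd , p | nd′ , p′ = ~-resp (≐-sym p) (≐-sym p′) (Adj⇒~ _ _ (f-adj (code U nd) (code W nd′) (~⇒Adj _ _ (~-resp (≐-sym (to-from U)) (≐-sym (to-from W)) h))))

        f̂-code : ∀ C → f̂ (toSp (proj₁ C)) ≐ toSp (f C)
        f̂-code C with f̂-spec {toSp (proj₁ C)} (NonDeg⇒ND (proj₁ C) (proj₂ C))
        ... | nd , p = ≐-trans p (≈⇒≐ _ _ (f-resp (code (toSp (proj₁ C)) nd) C (≐⇒≈ _ _ (to-from (toSp (proj₁ C))))))

      embedding : Embedding J₀ f̂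
      embedding = record { resp = f̂-resp ; hom = f̂-hom ; inj = f̂-inj }

      opaque
        started : Σ Geo λ G → Maps.Inv G J₀ f̂
        started with FirstEdgeAll.first-edge F q hs n k₂ d₂ n≡ J₀ f̂ embedding
        ... | G , S , nd , c = G , Start.start G J₀ f̂ embedding nd c

        extended : Extension (proj₁ started) J₀ List.[] f̂
        extended = extend n k₂ d₂ n≡ big (proj₁ started) J₀ f̂ (proj₂ started)

      module E = Extension extended
      module Fin′ = Final (proj₁ started) E.g E.invariant

      opaque
        g′ : Gn.Gr → Gn.Gr
        g′ U = toGr (E.g (toSp U))

        g′-sp : ∀ U → toSp (g′ U) ≐ E.g (toSp U)
        g′-sp U = to-from (E.g (toSp U))

      opaque
        automorphism : Gn.IsAutomorphism g′
        automorphism = (λ U W e → ≐⇒≈ _ _ (≐-trans (g′-sp U) (≐-trans (Maps.Inv.resp E.invariant All.[] (≈⇒≐ U W e)) (≐-sym (g′-sp W)))))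
          , (λ U W e → ≐⇒≈ _ _ (Fin′.g-inj (≐-trans (≐-sym (g′-sp U)) (≐-trans (≈⇒≐ _ _ e) (g′-sp W)))))
          , (λ W → toGr (proj₁ (Fin′.g-onto (toSp W))) , ≐⇒≈ _ _ (≐-trans (g′-sp _) (≐-trans (Maps.Inv.resp E.invariant All.[] (to-from _)) (proj₂ (Fin′.g-onto (toSp W))))))
          , (λ U W → (λ h → ~⇒Adj _ _ (~-resp (≐-sym (g′-sp U)) (≐-sym (g′-sp W)) (Maps.Inv.hom E.invariant All.[] All.[] (Adj⇒~ U W h)))) ,
                     (λ h → ~⇒Adj _ _ (Fin′.g-reflects (~-resp (g′-sp U) (g′-sp W) (Adj⇒~ _ _ h)))))

        extends : Gn.Extends g′ f
        extends C = ≐⇒≈ _ _ (≐-trans (g′-sp (proj₁ C)) (≐-trans (E.agree (NonDeg⇒ND (proj₁ C) (proj₂ C))) (f̂-code C)))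

        unique : ∀ h → Gn.IsAutomorphism h → Gn.Extends h f → ∀ U → h U Gn.≈ₛ g′ U
        unique h (h-resp , _ , _ , h-adj) h-ext U = ≐⇒≈ (h U) (g′ U) (≐-trans (≈⇒≐ (h U) (h (toGr (toSp U))) (h-resp U (toGr (toSp U)) (≐⇒≈ _ _ (≐-sym (to-from (toSp U))))))
            (≐-trans (E.uniq h′ h′-hom h′≐f̂ {toSp U} All.[]) (≐-sym (g′-sp U))))
          where
          h′ : Vtx → Vtx
          h′ V = toSp (h (toGr V))
          h′-hom : ∀ {V W} → V ~ W → h′ V ~ h′ W
          h′-hom {V} {W} a = Adj⇒~ _ _ (proj₁ (h-adj (toGr V) (toGr W)) (~⇒Adj _ _ (~-resp (≐-sym (to-from V)) (≐-sym (to-from W)) a)))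
          h′≐f̂ : ∀ {V} → ND J₀ V → h′ V ≐ f̂ V
          h′≐f̂ {V} nd with f̂-spec nd
          ... | nd′ , p = ≐-trans (≈⇒≐ _ _ (h-ext (code V nd′))) (≐-sym p)

    part1 : ∀ (f : Gn.Code → Gn.Gr) → Gn.IsIsoOntoSubgraph f →
      (Σ (Gn.Gr → Gn.Gr) λ g → Gn.IsAutomorphism g × Gn.Extends g f) ×
      (∀ g g′ → Gn.IsAutomorphism g → Gn.Extends g f → Gn.IsAutomorphism g′ → Gn.Extends g′ f → ∀ U → g U Gn.≈ₛ g′ U)
    part1 f iso = (g′ , automorphism , extends) , λ g h ag eg ah eh U x →
        (λ p → proj₂ (unique h ah eh U x) (proj₁ (unique g ag eg U x) p)) , (λ p → proj₂ (unique g ag eg U x) (proj₁ (unique h ah eh U x) p))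
      where open For f iso

-- The counterexample for q = k = 2

module Exceptional (F : Field) (q : ℕ) (hs : HasSize F q) (d₂ : ℕ) (n≡ : suc (suc (suc d₂)) ℕ.+ 1 ≡ suc (suc (suc (suc d₂)))) where
  open Grassmannian F q hs (suc (suc (suc (suc d₂)))) 0 d₂ n≡

  -- Linear with kernel spanned by 𝟙, so it only moves the planes that avoid 𝟙.
  π : Vect → Vect
  π x i = x i + - x zero

  opaque
    1≉0 : ¬ 1# ≈ 0#
    1≉0 e = 0≉1 (sym e)

    π-cong : ∀ {x y} → x ≈ᵥ y → π x ≈ᵥ π y
    π-cong e i = +-cong (e i) (-‿cong (e zero))

    π-head : ∀ x → π x zero ≈ 0#
    π-head x = -‿inverseʳ (x zero)

    π-add : ∀ x y i → π (x +ᵥ y) i ≈ π x i + π y i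
    π-add x y i = solve 4 (λ a b c d → (a :+ b) :- (c :+ d) := (a :- c) :+ (b :- d)) refl (x i) (y i) (x zero) (y zero)

    π-scale : ∀ α x i → π (α · x) i ≈ α * π x i
    π-scale α x i = solve 3 (λ α a c → (α :* a) :- (α :* c) := α :* (a :- c)) refl α (x i) (x zero)

    π-fibre : ∀ {x y} → π x ≈ᵥ π y → ∀ i → x i ≈ (x zero + - y zero) * 1# + y i
    π-fibre {x} {y} e i = trans (solve 2 (λ a c → a := (a :- c) :+ c) refl (x i) (x zero))
      (trans (+-congʳ (e i)) (solve 3 (λ a c d → (a :- d) :+ c := (c :- d) :* con (+ 1) :+ a) refl (y i) (x zero) (y zero)))

    preimage-sub : ∀ {P} → IsSub P → IsSub (λ x → P (π x))
    preimage-sub P-sub = record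
      { resp = λ e → IsSub.resp P-sub (π-cong e)
      ; nil = IsSub.resp P-sub (λ i → sym (-‿inverseʳ 0#)) (IsSub.nil P-sub)
      ; add = λ {x} {y} p p′ → IsSub.resp P-sub (λ i → sym (π-add x y i)) (IsSub.add P-sub p p′)
      ; scale = λ α {x} p → IsSub.resp P-sub (λ i → sym (π-scale α x i)) (IsSub.scale P-sub α p) }

    image-sub : ∀ {P} → IsSub P → IsSub (λ y → ∃ λ x → P x × y ≈ᵥ π x)
    image-sub P-sub = record
      { resp = λ e (x , p , h) → x , p , (λ i → trans (sym (e i)) (h i))
      ; nil = 0ᵥ , IsSub.nil P-sub , (λ i → sym (-‿inverseʳ 0#))
      ; add = λ (x , p , h) (x′ , p′ , h′) → x +ᵥ x′ , IsSub.add P-sub p p′ , (λ i → trans (+-cong (h i) (h′ i)) (sym (π-add x x′ i)))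
      ; scale = λ α (x , p , h) → α · x , IsSub.scale P-sub α p , (λ i → trans (*-congˡ (h i)) (sym (π-scale α x i))) }

    -- A relation among the images lifts to one among the vectors up to a multiple of 𝟙, and 𝟙 is
    -- outside their span.
    π-ind : ∀ {m} (vs : Fam m) → ¬ (𝟙 ∈Span vs) → Ind vs → Ind (π ∘ vs)
    π-ind {0ⁿ} vs _ _ = tt
    π-ind {suc m} vs 𝟙∉ (v∉ , ind′) = notin , π-ind (vs ∘ suc) (λ p → 𝟙∉ (tail-∈ {vs = vs} p)) ind′
      where
      notin : ¬ (π (vs zero) ∈Span (π ∘ vs ∘ suc))
      notin p with span-least (image-sub (span-sub (vs ∘ suc))) (λ j → vs (suc j) , gen-∈ (vs ∘ suc) j , λ _ → refl) _ p
      ... | x , x∈ , e with (vs zero zero + - x zero) ≟ 0#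
      ...   | yes γ≈0 = v∉ (IsSub.resp (span-sub (vs ∘ suc)) (λ i → sym (trans (π-fibre e i) (trans (+-congʳ (trans (*-congʳ γ≈0) (zeroˡ _))) (+-identityˡ _)))) x∈)
      ...   | no γ≉0 = 𝟙∉ (IsSub.uncomb (span-sub vs) {_} {𝟙} {x} {vs zero} γ≉0 (π-fibre e) (head-∈ vs) (tail-∈ {vs = vs} x∈))

  opaque
    image : ∀ {m} (S : Sp m) → 𝟙 ∉ₛ S → Sp m
    image S 𝟙∉ = sp (π ∘ fam S) (π-ind (fam S) (λ p → 𝟙∉ ⟨ p ⟩) (ind S))

    ∈-image : ∀ {m} {S : Sp m} {𝟙∉ : 𝟙 ∉ₛ S} {x} → x ∈ₛ S → π x ∈ₛ image S 𝟙∉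
    ∈-image {S = S} {𝟙∉} = least S (preimage-sub (isSub (image S 𝟙∉))) (λ j → gen (image S 𝟙∉) j)

    image-inv : ∀ {m} {S : Sp m} {𝟙∉ : 𝟙 ∉ₛ S} {y} → y ∈ₛ image S 𝟙∉ → ∃ λ x → x ∈ₛ S × y ≈ᵥ π x
    image-inv {S = S} {𝟙∉} = least (image S 𝟙∉) (image-sub (isSub S)) (λ j → fam S j , gen S j , λ _ → refl)

  value : (U : Vtx) → Dec (𝟙 ∈ₛ U) → Vtx
  value U (yes _) = U
  value U (no 𝟙∉) = image U 𝟙∉

  opaque
    φ : Vtx → Vtx
    φ U = value U (𝟙 ∈? U)

    φ-in : ∀ {U} → 𝟙 ∈ₛ U → φ U ≐ U
    φ-in {U} 𝟙∈ with 𝟙 ∈? U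
    ... | yes _ = ≐-refl
    ... | no 𝟙∉ = ⊥-elim (𝟙∉ 𝟙∈)

    φ-out : ∀ {U} → 𝟙 ∉ₛ U → ∀ {y} → y ∈ₛ φ U → ∃ λ x → x ∈ₛ U × y ≈ᵥ π x
    φ-out {U} 𝟙∉ p with 𝟙 ∈? U
    ... | yes 𝟙∈ = ⊥-elim (𝟙∉ 𝟙∈)
    ... | no _ = image-inv p

    -- Holds for the fixed planes as well, since a plane containing 𝟙 is stable under π.
    π-φ : ∀ {U x} → x ∈ₛ U → π x ∈ₛ φ U
    π-φ {U} {x} p with 𝟙 ∈? U
    ... | yes 𝟙∈ = IsSub.comb (isSub U) (- x zero) {𝟙} {x} {π x} (λ i → solve 2 (λ a c → a :- c := :- c :* con (+ 1) :+ a) refl (x i) (x zero)) 𝟙∈ p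
    ... | no _ = ∈-image p

  opaque
    φ-avoids : ∀ {U} → 𝟙 ∉ₛ U → 𝟙 ∉ₛ φ U
    φ-avoids 𝟙∉ p with φ-out 𝟙∉ p
    ... | x , _ , e = 1≉0 (trans (e zero) (π-head x))

    φ-mono : ∀ {U W : Vtx} → 𝟙 ∉ₛ U → U ⊆ W → φ U ⊆ φ W
    φ-mono {U} {W} 𝟙∉ h = incl go
      where
      go : ∀ {y} → y ∈ₛ φ U → y ∈ₛ φ W
      go p with φ-out 𝟙∉ p
      ... | x , x∈ , e = IsSub.resp (isSub (φ W)) (λ i → sym (e i)) (π-φ (h ! x∈))

    φ-resp : ∀ {U W} → U ≐ W → φ U ≐ φ W
    φ-resp {U} {W} e with 𝟙 ∈? U
    ... | yes 𝟙∈ = ≐-trans (φ-in 𝟙∈) (≐-trans e (≐-sym (φ-in (fwd e ! 𝟙∈))))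
    ... | no 𝟙∉ = ⊆⇒≐ (φ-mono 𝟙∉ (fwd e))

  module _ (bin : ∀ x → (x ≈ 0#) ⊎ (x ≈ 1#)) where
    opaque
      ≉0⇒≈1 : ∀ {x} → ¬ x ≈ 0# → x ≈ 1#
      ≉0⇒≈1 {x} h with bin x
      ... | inj₁ p = ⊥-elim (h p)
      ... | inj₂ p = p

      full-line : (S : Edge) → (∀ i → Hits i S) → 𝟙 ∈ₛ S
      full-line S hits = IsSub.resp (isSub S) (λ i → ≉0⇒≈1 (s≉0 i)) (gen S zero)
        where
        s≉0 : ∀ i → ¬ fam S zero i ≈ 0#
        s≉0 i h with hits i
        ... | x , x∈ , x≉ = x≉ (least S (coord-sub i) (λ { zero → h }) x∈)

      outside-hits : ∀ {S : Edge} {U : Vtx} {u} → S ⊆ U → u ∈ₛ U → u ∉ₛ S → ∀ {i} → ¬ Hits i S → Hits i U → u i ≈ 1#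
      outside-hits {S} {U} {u} S⊆U u∈ u∉ {i} miss (x , x∈ , x≉) = ≉0⇒≈1 u≉
        where
        u≉ : ¬ u i ≈ 0#
        u≉ h with hyper-inv S⊆U u∈ u∉ x∈
        ... | α , s , s∈ , e = x≉ (trans (e i) (trans (+-cong (trans (*-congˡ h) (zeroʳ α)) (¬Hits miss s∈)) (+-identityˡ 0#)))

      -- If distinct U and W avoiding 𝟙 had the same image, they would meet in a line S and some w
      -- in W would be 𝟙 + u with u in U. At a coordinate missed by S non-degeneracy makes w and u
      -- both 1, so 1 = 1 + 1. Hence S misses no coordinate and is ⟨𝟙⟩, a contradiction.
      φ-inj : ∀ {U W} → ND J₀ U → ND J₀ W → φ U ≐ φ W → U ≐ W
      φ-inj {U} {W} ndU ndW e with 𝟙 ∈? U | 𝟙 ∈? W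
      ... | yes p | yes p′ = ≐-trans (≐-sym (φ-in p)) (≐-trans e (φ-in p′))
      ... | yes p | no p′ = ⊥-elim (φ-avoids p′ (fwd e ! (bwd (φ-in p) ! p)))
      ... | no p | yes p′ = ⊥-elim (φ-avoids p (bwd e ! (bwd (φ-in p′) ! p′)))
      ... | no 𝟙∉U | no 𝟙∉W = decidable-stable (U ≐? W) (λ ne → absurd (λ h → ne (≐-sym (⊆⇒≐ h))))
        where
        fibre : ∀ {w} → w ∈ₛ W → ∃ λ u → u ∈ₛ U × (∀ i → w i ≈ (w zero + - u zero) * 1# + u i)
        fibre {w} w∈ with φ-out {U} 𝟙∉U (bwd e ! π-φ w∈)
        ... | u , u∈ , h = u , u∈ , π-fibre h
        T : Cap
        T = ext U 𝟙 𝟙∉U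
        W⊆T : W ⊆ T
        W⊆T = incl go
          where
          go : ∀ {w} → w ∈ₛ W → w ∈ₛ T
          go w∈ with fibre w∈
          ... | u , u∈ , h = ext-intro {x∉ = 𝟙∉U} _ h u∈
        absurd : ¬ W ⊈ U
        absurd W⊈U with meet {T = T} ext-⊆ W⊆T W⊈U | ⊈-witness W⊈U
        ... | S , S⊆U , S⊆W | w , w∈ , w∉ with fibre w∈
        ...   | u , u∈ , h = 𝟙∉U (S⊆U ! full-line S (λ i → decidable-stable (Hits? i S) (clash i)))
          where
          γ : Carrier
          γ = w zero + - u zero
          γ≉0 : ¬ γ ≈ 0#
          γ≉0 γ≈0 = w∉ (IsSub.resp (isSub U) (λ i → sym (trans (h i) (trans (+-congʳ (trans (*-congʳ γ≈0) (zeroˡ _))) (+-identityˡ _)))) u∈)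
          u∉S : u ∉ₛ S
          u∉S p = 𝟙∉W (IsSub.uncomb (isSub W) {γ} {𝟙} {u} {w} γ≉0 h w∈ (S⊆W ! p))
          clash : ∀ i → ¬ ¬ Hits i S
          clash i miss = 1≉0 (trans (solve 0 (con (+ 1) := (con (+ 1) :+ con (+ 1)) :- con (+ 1)) refl) (trans (+-congʳ (trans (sym two) w1)) (-‿inverseʳ 1#)))
            where
            w1 : w i ≈ 1#
            w1 = outside-hits S⊆W w∈ (λ p → w∉ (S⊆U ! p)) miss (All.lookup ndW (∈-allFin i))
            u1 : u i ≈ 1#
            u1 = outside-hits S⊆U u∈ u∉S miss (All.lookup ndU (∈-allFin i))
            two : w i ≈ 1# + 1#
            two = trans (h i) (+-cong (trans (*-identityʳ γ) (≉0⇒≈1 γ≉0)) u1)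

      image-⊆ : ∀ {S : Edge} {U} {𝟙∉ : 𝟙 ∉ₛ S} → S ⊆ U → image S 𝟙∉ ⊆ φ U
      image-⊆ {S} {U} {𝟙∉} h = incl go
        where
        go : ∀ {y} → y ∈ₛ image S 𝟙∉ → y ∈ₛ φ U
        go p with image-inv p
        ... | x , x∈ , e = IsSub.resp (isSub (φ U)) (λ i → sym (e i)) (π-φ (h ! x∈))

      -- The common line maps to a common line unless it is ⟨𝟙⟩, in which case both planes are
      -- fixed.
      φ-hom : ∀ {U W} → ND J₀ U → ND J₀ W → U ~ W → φ U ~ φ W
      φ-hom {U} {W} ndU ndW (adj S S⊆U S⊆W U⊈W) with 𝟙 ∈? S
      ... | yes 𝟙∈ = ~-resp (≐-sym (φ-in (S⊆U ! 𝟙∈))) (≐-sym (φ-in (S⊆W ! 𝟙∈))) (adj S S⊆U S⊆W U⊈W)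
      ... | no 𝟙∉ = star-adj (image-⊆ {𝟙∉ = 𝟙∉} S⊆U) (image-⊆ S⊆W) (λ e → U⊈W (fwd (φ-inj ndU ndW e)))

  opaque
    ∉nilSp : ∀ {x} i → ¬ x i ≈ 0# → x ∉ₛ nilSp
    ∉nilSp i h p = h (nilSp-least (coord-sub i) _ p)

  line : ∀ x i → ¬ x i ≈ 0# → Edge
  line x i h = ext nilSp x (∉nilSp i h)

  opaque
    line-inv : ∀ {x i h y} → y ∈ₛ line x i h → ∃ λ α → ∀ i → y i ≈ α * x i
    line-inv {x} {i} {h} p with ext-inv {x∉ = ∉nilSp {x} i h} p
    ... | α , s , s∈ , e = α , λ i → trans (e i) (trans (+-congˡ (nilSp-least (coord-sub i) s s∈)) (+-identityʳ _))

    ∉line : ∀ {x i h y} j → x j ≈ 0# → ¬ y j ≈ 0# → y ∉ₛ line x i h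
    ∉line {x} {i} {h} j xj yj p with line-inv {x} {i} {h} p
    ... | α , e = yj (trans (e j) (trans (*-congˡ xj) (zeroʳ α)))

    plane : ∀ (x y : Vect) i j → ¬ x i ≈ 0# → x j ≈ 0# → ¬ y j ≈ 0# → Vtx
    plane x y i j h g g′ = ext (line x i h) y (∉line {x} {i} {h} {y} j g g′)

    plane-∈ˡ : ∀ {x y i j h g g′} → x ∈ₛ plane x y i j h g g′
    plane-∈ˡ = ext-⊆ ! ext-∈

    plane-∈ʳ : ∀ {x y i j h g g′} → y ∈ₛ plane x y i j h g g′
    plane-∈ʳ = ext-∈

    plane-inv : ∀ {x y i j h g g′ z} → z ∈ₛ plane x y i j h g g′ → ∃ λ α → ∃ λ β → ∀ i → z i ≈ α * x i + β * y i
    plane-inv {x} {y} {i} {j} {h} p with ext-inv p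
    ... | β , s , s∈ , e with line-inv {x} {i} {h} s∈
    ...   | α , e′ = α , β , λ i → trans (e i) (trans (+-congˡ (e′ i)) (+-comm _ _))

  -- Since a + c = 𝟙, the map π sends a and c to the same line. The vectors b and d make both planes
  -- non-degenerate and keep their intersection zero, as the first four coordinates show.
  a b c d : Vect
  a zero = 0#
  a (suc zero) = 0#
  a (suc (suc _)) = 1#
  b zero = 1#
  b (suc zero) = 1#
  b (suc (suc zero)) = 1#
  b (suc (suc (suc _))) = 0#
  c zero = 1#
  c (suc zero) = 1#
  c (suc (suc _)) = 0#
  d zero = 0#
  d (suc _) = 1#

  M M′ : Vtx
  M = plane a b (suc (suc zero)) zero 1≉0 refl 1≉0
  M′ = plane c d zero (suc (suc zero)) 1≉0 refl 1≉0

  opaque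
    M-ND : ND J₀ M
    M-ND = All.tabulate (λ {i} _ → go i)
      where
      go : ∀ i → Hits i M
      go zero = b , plane-∈ʳ , 1≉0
      go (suc zero) = b , plane-∈ʳ , 1≉0
      go (suc (suc _)) = a , plane-∈ˡ , 1≉0

    M′-ND : ND J₀ M′
    M′-ND = All.tabulate (λ {i} _ → go i)
      where
      go : ∀ i → Hits i M′
      go zero = c , plane-∈ˡ , 1≉0
      go (suc _) = d , plane-∈ʳ , 1≉0

    M-M′ : ∀ {x} → x ∈ₛ M → x ∈ₛ M′ → x ∈ₛ nilSp
    M-M′ {x} p p′ with plane-inv p | plane-inv p′
    ... | α , β , e | γ , δ , e′ = IsSub.resp (isSub nilSp) {0ᵥ} {x} (λ i → sym (trans (e i) (trans (+-cong (trans (*-congʳ α≈0) (zeroˡ _)) (trans (*-congʳ β≈0) (zeroˡ _))) (+-identityˡ 0#)))) (IsSub.nil (isSub nilSp))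
      where
      eq : ∀ i → α * a i + β * b i ≈ γ * c i + δ * d i
      eq i = trans (sym (e i)) (e′ i)
      β≈γ : β ≈ γ
      β≈γ = trans (solve 2 (λ α β → β := α :* con (+ 0) :+ β :* con (+ 1)) refl α β) (trans (eq zero) (solve 2 (λ γ δ → γ :* con (+ 1) :+ δ :* con (+ 0) := γ) refl γ δ))
      β≈γ+δ : β ≈ γ + δ
      β≈γ+δ = trans (solve 2 (λ α β → β := α :* con (+ 0) :+ β :* con (+ 1)) refl α β) (trans (eq (suc zero)) (solve 2 (λ γ δ → γ :* con (+ 1) :+ δ :* con (+ 1) := γ :+ δ) refl γ δ))
      α+β≈δ : α + β ≈ δ
      α+β≈δ = trans (solve 2 (λ α β → α :+ β := α :* con (+ 1) :+ β :* con (+ 1)) refl α β) (trans (eq (suc (suc zero))) (solve 2 (λ γ δ → γ :* con (+ 0) :+ δ :* con (+ 1) := δ) refl γ δ))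
      α≈δ : α ≈ δ
      α≈δ = trans (solve 2 (λ α β → α := α :* con (+ 1) :+ β :* con (+ 0)) refl α β) (trans (eq (suc (suc (suc zero)))) (solve 2 (λ γ δ → γ :* con (+ 0) :+ δ :* con (+ 1) := δ) refl γ δ))
      δ≈0 : δ ≈ 0#
      δ≈0 = trans (solve 2 (λ γ δ → δ := (γ :+ δ) :- γ) refl γ δ) (trans (+-cong (trans (sym β≈γ+δ) β≈γ) refl) (-‿inverseʳ γ))
      α≈0 : α ≈ 0#
      α≈0 = trans α≈δ δ≈0
      β≈0 : β ≈ 0#
      β≈0 = trans (sym (+-identityˡ β)) (trans (+-congʳ (sym α≈0)) (trans α+β≈δ δ≈0))

    M≁M′ : ¬ M ~ M′
    M≁M′ (adj S S⊆M S⊆M′ _) with outside (s≤s z≤n) nilSp S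
    ... | x , x∈ , x∉ = x∉ (M-M′ (S⊆M ! x∈) (S⊆M′ ! x∈))

    M≭M′ : ¬ M ≐ M′
    M≭M′ e with outside (s≤s z≤n) nilSp M
    ... | x , x∈ , x∉ = x∉ (M-M′ x∈ (fwd e ! x∈))

    -- The nonadjacent planes M and M′ become adjacent, since π a = a = − π c.
    φM~φM′ : (∀ x → (x ≈ 0#) ⊎ (x ≈ 1#)) → φ M ~ φ M′
    φM~φM′ bin = star-adj (sub {M} a∈) (sub {M′} a∈′) (λ e → M≭M′ (φ-inj bin M-ND M′-ND e))
      where
      sub : ∀ {U} → a ∈ₛ φ U → line a (suc (suc zero)) 1≉0 ⊆ φ U
      sub {U} p = ext-least (incl (nilSp-least (isSub (φ U)) _)) p
      a∈ : a ∈ₛ φ M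
      a∈ = IsSub.resp (isSub (φ M)) (λ i → trans (+-congˡ (solve 0 (:- con (+ 0) := con (+ 0)) refl)) (+-identityʳ (a i))) (π-φ plane-∈ˡ)
      c↦a : ∀ i → - 1# * π c i ≈ a i
      c↦a zero = solve 0 (:- con (+ 1) :* (con (+ 1) :- con (+ 1)) := con (+ 0)) refl
      c↦a (suc zero) = solve 0 (:- con (+ 1) :* (con (+ 1) :- con (+ 1)) := con (+ 0)) refl
      c↦a (suc (suc _)) = solve 0 (:- con (+ 1) :* (con (+ 0) :- con (+ 1)) := con (+ 1)) refl
      a∈′ : a ∈ₛ φ M′
      a∈′ = IsSub.resp (isSub (φ M′)) c↦a (IsSub.scale (isSub (φ M′)) (- 1#) (π-φ plane-∈ˡ))

  module Graph (bin : ∀ x → (x ≈ 0#) ⊎ (x ≈ 1#)) where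
    opaque
      f : Gn.Code → Gn.Gr
      f C = toGr (φ (toSp (proj₁ C)))

      f-sp : ∀ C → toSp (f C) ≐ φ (toSp (proj₁ C))
      f-sp C = to-from (φ (toSp (proj₁ C)))

    nd : ∀ (C : Gn.Code) → ND J₀ (toSp (proj₁ C))
    nd C = NonDeg⇒ND (proj₁ C) (proj₂ C)

    opaque
      ≈-refl : ∀ U → U Gn.≈ₛ U
      ≈-refl U x = (λ p → p) , (λ p → p)

      ≈-sym : ∀ {U W} → U Gn.≈ₛ W → W Gn.≈ₛ U
      ≈-sym e x = proj₂ (e x) , proj₁ (e x)

      ≈-trans : ∀ {U W Z} → U Gn.≈ₛ W → W Gn.≈ₛ Z → U Gn.≈ₛ Z
      ≈-trans e e′ x = proj₁ (e′ x) ∘ proj₁ (e x) , proj₂ (e x) ∘ proj₂ (e′ x)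

      Adj-resp : ∀ {U U′ W W′} → U Gn.≈ₛ U′ → W Gn.≈ₛ W′ → Gn.Adj U W → Gn.Adj U′ W′
      Adj-resp {U} {U′} {W} {W′} e e′ h = ~⇒Adj U′ W′ (~-resp (≈⇒≐ U U′ e) (≈⇒≐ W W′ e′) (Adj⇒~ U W h))

      f-resp : ∀ C D → proj₁ C Gn.≈ₛ proj₁ D → f C Gn.≈ₛ f D
      f-resp C D e = ≐⇒≈ (f C) (f D) (≐-trans (f-sp C) (≐-trans (φ-resp (≈⇒≐ (proj₁ C) (proj₁ D) e)) (≐-sym (f-sp D))))

      f-inj : ∀ C D → f C Gn.≈ₛ f D → proj₁ C Gn.≈ₛ proj₁ D
      f-inj C D e = ≐⇒≈ (proj₁ C) (proj₁ D) (φ-inj bin (nd C) (nd D) (≐-trans (≐-sym (f-sp C)) (≐-trans (≈⇒≐ (f C) (f D) e) (f-sp D))))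

      f-adj : ∀ C D → Gn.Adj (proj₁ C) (proj₁ D) → Gn.Adj (f C) (f D)
      f-adj C D h = ~⇒Adj (f C) (f D) (~-resp (≐-sym (f-sp C)) (≐-sym (f-sp D)) (φ-hom bin (nd C) (nd D) (Adj⇒~ (proj₁ C) (proj₁ D) h)))

    -- Only transported edges are included: f CM and f CM′ are adjacent as planes but not joined
    -- here.
    graph : Gn.Subgraph
    graph = record
      { Vtx = λ U → ∃ λ C → f C Gn.≈ₛ U
      ; Edg = λ U W → ∃ λ C → ∃ λ D → f C Gn.≈ₛ U × f D Gn.≈ₛ W × Gn.Adj (proj₁ C) (proj₁ D)
      ; Vtx-resp = λ U W e (C , h) → C , ≈-trans {f C} {U} {W} h e
      ; Edg-resp = λ U U′ W W′ e e′ (C , D , h , h′ , r) → C , D , ≈-trans {f C} {U} {U′} h e , ≈-trans {f D} {W} {W′} h′ e′ , r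
      ; Edg-vtx = λ U W (C , D , h , h′ , r) → (C , h) , (D , h′)
      ; Edg-adj = λ U W (C , D , h , h′ , r) → Adj-resp {f C} {U} {f D} {W} h h′ (f-adj C D r) }

    opaque
      f-iso : Gn.IsIsoOnto f graph
      f-iso = f-resp , f-inj , (λ C → C , ≈-refl (f C)) , (λ U v → v)
        , λ C D → (λ r → C , D , ≈-refl (f C) , ≈-refl (f D) , r)
                , (λ (C₁ , D₁ , h , h′ , r) → Adj-resp {proj₁ C₁} {proj₁ C} {proj₁ D₁} {proj₁ D} (f-inj C₁ C h) (f-inj D₁ D h′) r)

    CM CM′ : Gn.Code
    CM = toGr M , ND⇒NonDeg (toGr M) (ND-mono (bwd (to-from M)) M-ND)
    CM′ = toGr M′ , ND⇒NonDeg (toGr M′) (ND-mono (bwd (to-from M′)) M′-ND)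

    opaque
      fM-adj : Gn.Adj (f CM) (f CM′)
      fM-adj = ~⇒Adj (f CM) (f CM′) (~-resp
        (≐-sym (≐-trans (f-sp CM) (φ-resp (to-from M)))) (≐-sym (≐-trans (f-sp CM′) (φ-resp (to-from M′)))) (φM~φM′ bin))

      not-adj : ¬ Gn.Adj (toGr M) (toGr M′)
      not-adj h = M≁M′ (~-resp (to-from M) (to-from M′) (Adj⇒~ (toGr M) (toGr M′) h))

      -- Any such h takes some codes C and D to f CM and f CM′, which are adjacent planes. An
      -- automorphism extending h would make C and D adjacent, so `graph` would join their images,
      -- which makes M and M′ adjacent.
      no-extension : ∀ h → Gn.IsIsoOnto h graph → ¬ (∃ λ g → Gn.IsAutomorphism g × Gn.Extends g h)
      no-extension h (_ , _ , _ , onto , h-adj) (g , (_ , _ , _ , g-adj) , g-ext) with onto (f CM) (CM , ≈-refl (f CM)) | onto (f CM′) (CM′ , ≈-refl (f CM′))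
      ... | C , e | D , e′ = conclude (proj₁ (h-adj C D) C~D)
        where
        C~D : Gn.Adj (proj₁ C) (proj₁ D)
        C~D = proj₂ (g-adj (proj₁ C) (proj₁ D)) (Adj-resp {f CM} {g (proj₁ C)} {f CM′} {g (proj₁ D)}
          (≈-sym {g (proj₁ C)} {f CM} (≈-trans {g (proj₁ C)} {h C} {f CM} (g-ext C) e))
          (≈-sym {g (proj₁ D)} {f CM′} (≈-trans {g (proj₁ D)} {h D} {f CM′} (g-ext D) e′)) fM-adj)
        conclude : ¬ Gn.Subgraph.Edg graph (h C) (h D)
        conclude (C₁ , D₁ , p , p′ , r) = not-adj (Adj-resp {proj₁ C₁} {toGr M} {proj₁ D₁} {toGr M′}
          (f-inj C₁ CM (≈-trans {f C₁} {h C} {f CM} p e)) (f-inj D₁ CM′ (≈-trans {f D₁} {h D} {f CM′} p′ e′)) r)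

  part2 : q ≡ 2 → Σ Gn.Subgraph λ S →
    (∃ λ h → Gn.IsIsoOnto h S) × (∀ h → Gn.IsIsoOnto h S → ¬ (∃ λ g → Gn.IsAutomorphism g × Gn.Extends g h))
  part2 q≡2 = graph , (f , f-iso) , no-extension
    where open Graph (q≡2⇒binary q≡2)

codimension : ∀ {n k₂} → suc (suc k₂) < n → suc (suc (suc (n ∸ suc (suc (suc k₂))))) ℕ.+ suc k₂ ≡ suc n
codimension {n} {k₂} h = ≡.trans (≡.cong (3 ℕ.+_) (ℕₚ.+-suc (n ∸ suc (suc (suc k₂))) k₂))
  (≡.cong suc (≡.trans (≡.sym (≡.trans (ℕₚ.+-suc _ _) (≡.cong suc (≡.trans (ℕₚ.+-suc _ _) (≡.cong suc (ℕₚ.+-suc _ _)))))) (ℕₚ.m∸n+n≡m h)))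

theorem1 : (F : Field) (q : ℕ) → HasSize F q → (n k : ℕ) → 1 < k → k < n ∸ 1 →
    let open Grassmann F n k in
    ((3 ≤ q ⊎ 3 ≤ k) →
      ∀ (f : Code → Gr) → IsIsoOntoSubgraph f →
        (Σ (Gr → Gr) λ g → IsAutomorphism g × Extends g f) ×
        (∀ g g' → IsAutomorphism g → Extends g f → IsAutomorphism g' → Extends g' f →
          ∀ U → g U ≈ₛ g' U)) ×
    (q ≡ 2 → k ≡ 2 →
      Σ Subgraph λ S →
        (∃ λ h → IsIsoOnto h S) ×
        (∀ h → IsIsoOnto h S → ¬ (∃ λ g → IsAutomorphism g × Extends g h)))
theorem1 F q hs (suc n) (suc (suc k₂)) (s≤s (s≤s z≤n)) k<n =
    -- The space has dimension n + 1, so this value of `d₂` is its dimension minus k + 2.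
    Assemble.Part1.part1 F q hs (suc n) k₂ (n ∸ suc (suc (suc k₂))) (codimension k<n) , exceptional n k<n
  where
  exceptional : ∀ n → suc (suc k₂) < n → q ≡ 2 → suc (suc k₂) ≡ 2 → let open Grassmann F (suc n) (suc (suc k₂)) in
    Σ Subgraph λ S → (∃ λ h → IsIsoOnto h S) × (∀ h → IsIsoOnto h S → ¬ (∃ λ g → IsAutomorphism g × Extends g h))
  exceptional (suc (suc (suc d₂))) (s≤s (s≤s (s≤s _))) q≡2 ≡.refl =
    Exceptional.part2 F q hs d₂ (ℕₚ.+-comm (suc (suc (suc d₂))) 1) q≡2
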